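{- Let $n,\ell,t$ be integers with $1\leq t\leq n-2$ and $n+t+2\leq \ell$, and assume $(\ell,q)\neq(n+t+2,2)$ and $(\ell,q)\neq(n+t+3,2)$. Let $\mathcal{F}\subseteq{V\brack n,0}$ be a non-trivial $t$-intersecting family. Then: (i) If $1\leq t\leq \frac{n}{2}-1$, then $|\mathcal{F}|\leq q^{\ell(n-t)}-\prod_{j=1}^{n-t}(q^\ell-q^j)+q^{n-t}(q^t-1)$, with equality if and only if $\mathcal{F}=\mathcal{H}_1(X,M)$ for some $(t,0)$-subspace $X$ and $(n+1,1)$-subspace $M$ of $V$ with $X\subseteq M$. (ii) If $\frac{n}{2}-\frac{1}{2}\leq t\leq n-2$, then $|\mathcal{F}|\leq q^{\ell(n-t-1)}\theta_{t+2}-q^{\ell(n-t-2)+1}\theta_{t+1}$, with equality if and only if $\mathcal{F}=\{F\in{V\brack n,0}:\dim(F\cap Z)\ge t+1\}$ for some $(t+2,0)$-subspace $Z$ of $V$.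
   Context: Let $q$ be a prime power, $V$ an $(n+\ell)$-dimensional vector space over $\mathbb{F}_q$ and $W$ a fixed $\ell$-dimensional subspace of $V$. A subspace $P$ of $V$ has type $(m,s)$ (is an $(m,s)$-subspace) if $\dim P=m$ and $\dim(P\cap W)=s$. For a subspace $S$ of $V$, ${S\brack m,s}$ denotes the set of all $(m,s)$-subspaces of $V$ contained in $S$. $\theta_a=(q^a-1)/(q-1)$. A family $\mathcal{F}\subseteq{V\brack n,0}$ is $t$-intersecting if $\dim(A\cap B)\ge t$ for all $A,B\in\mathcal F$; it is non-trivial if $\dim(\bigcap_{F\in\mathcal F}F)<t$. For a $(t,0)$-subspace $X$ and an $(n+1,1)$-subspace $M$ with $X\subseteq M$, $\mathcal{H}_1(X,M)=\{F\in{V\brack n,0}: X\subseteq F,\ \dim(F\cap M)\ge t+1\}\cup{M\brack n,0}$. -}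

module Defs where

open import Level using (Level; 0ℓ) renaming (suc to lsuc)
open import Data.Nat using (_∸_)
open import Data.Nat using (ℕ; zero; suc; _≤_; _<_) renaming (_+_ to _+ℕ_; _*_ to _*ℕ_; _^_ to _^ℕ_)
open import Data.Fin using (Fin)
open import Data.Vec using (Vec; []; _∷_; zipWith; replicate; foldr; map)
open import Data.Vec.Relation.Unary.All as VAll using ()
open import Data.List using (List; length)
import Data.List as List
import Data.Unit
open import Data.List.Membership.Propositional using (_∈_)
open import Data.List.Relation.Unary.All using (All)
open import Data.List.Relation.Unary.AllPairs using (AllPairs)
open import Data.Product using (Σ; _×_; _,_; ∃)
open import Data.Sum using (_⊎_)
open import Relation.Binary.PropositionalEquality using (_≡_; _≢_)
open import Relation.Nullary using (¬_)
open import Function.Bundles using (_↔_)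

record FiniteField : Set₁ where
  infixl 6 _+_
  infixl 7 _*_
  field
    Carrier : Set
    _+_ _*_ : Carrier → Carrier → Carrier
    -_      : Carrier → Carrier
    0# 1#   : Carrier
    +-assoc : ∀ x y z → (x + y) + z ≡ x + (y + z)
    +-comm  : ∀ x y → x + y ≡ y + x
    +-identityˡ : ∀ x → 0# + x ≡ x
    -‿inverseˡ  : ∀ x → (- x) + x ≡ 0#
    *-assoc : ∀ x y z → (x * y) * z ≡ x * (y * z)
    *-comm  : ∀ x y → x * y ≡ y * x
    *-identityˡ : ∀ x → 1# * x ≡ x
    distribˡ : ∀ x y z → x * (y + z) ≡ x * y + x * z
    0≢1     : 0# ≢ 1#
    inverse : ∀ x → x ≢ 0# → Σ Carrier (λ y → y * x ≡ 1#)
    size    : ℕ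
    enum    : Fin size ↔ Carrier

module LinAlg {𝔽 : FiniteField} where
  open FiniteField 𝔽

  Vect : ℕ → Set
  Vect N = Vec Carrier N

  _⊕_ : ∀ {N} → Vect N → Vect N → Vect N
  _⊕_ = zipWith _+_

  _·_ : ∀ {N} → Carrier → Vect N → Vect N
  c · v = map (c *_) v

  𝟎 : ∀ {N} → Vect N
  𝟎 = replicate _ 0#

  lincomb : ∀ {N m} → Vec Carrier m → Vec (Vect N) m → Vect N
  lincomb []       []       = 𝟎
  lincomb (c ∷ cs) (b ∷ bs) = (c · b) ⊕ lincomb cs bs

  record Subspace (N : ℕ) : Set₁ where
    field
      _∋_   : Vect N → Set
      ∋-𝟎   : _∋_ 𝟎
      ∋-⊕   : ∀ {u v} → _∋_ u → _∋_ v → _∋_ (u ⊕ v)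
      ∋-·   : ∀ c {v} → _∋_ v → _∋_ (c · v)
  open Subspace public

  _⊆S_ : ∀ {N} → Subspace N → Subspace N → Set
  P ⊆S Q = ∀ v → P ∋ v → Q ∋ v

  _≐_ : ∀ {N} → Subspace N → Subspace N → Set
  P ≐ Q = P ⊆S Q × Q ⊆S P

  whole : ∀ {N} → Subspace N
  whole = record { _∋_ = λ _ → Data.Unit.⊤ ; ∋-𝟎 = _ ; ∋-⊕ = λ _ _ → _ ; ∋-· = λ _ _ → _ }

  _∩_ : ∀ {N} → Subspace N → Subspace N → Subspace N
  P ∩ Q = record
    { _∋_ = λ v → P ∋ v × Q ∋ v
    ; ∋-𝟎 = ∋-𝟎 P , ∋-𝟎 Q
    ; ∋-⊕ = λ { (a , b) (c , d) → ∋-⊕ P a c , ∋-⊕ Q b d }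
    ; ∋-· = λ { k (a , b) → ∋-· P k a , ∋-· Q k b }
    }

  ⋂ : ∀ {N} → List (Subspace N) → Subspace N
  ⋂ List.[] = whole
  ⋂ (P List.∷ Ps) = P ∩ ⋂ Ps

  LinIndep : ∀ {N m} → Vec (Vect N) m → Set
  LinIndep {m = m} bs = ∀ (cs : Vec Carrier m) → lincomb cs bs ≡ 𝟎 → cs ≡ replicate m 0#

  IsBasis : ∀ {N m} → Subspace N → Vec (Vect N) m → Set
  IsBasis {m = m} P bs =
    VAll.All (P ∋_) bs × LinIndep bs
    × (∀ v → P ∋ v → Σ (Vec Carrier m) (λ cs → lincomb cs bs ≡ v))

  HasDim : ∀ {N} → Subspace N → ℕ → Set
  HasDim {N} P m = Σ (Vec (Vect N) m) (IsBasis P)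

  DimGE : ∀ {N} → Subspace N → ℕ → Set
  DimGE P k = Σ ℕ (λ m → HasDim P m × k ≤ m)

  DimLT : ∀ {N} → Subspace N → ℕ → Set
  DimLT P k = Σ ℕ (λ m → HasDim P m × m < k)

  HasType : ∀ {N} → Subspace N → Subspace N → ℕ → ℕ → Set
  HasType W P m s = HasDim P m × HasDim (P ∩ W) s

  -- families of subspaces are given as duplicate-free lists;  |F| = length F
  Distinct : ∀ {N} → List (Subspace N) → Set₁
  Distinct = AllPairs (λ P Q → ¬ (P ≐ Q))

  _∈F_ : ∀ {N} → Subspace N → List (Subspace N) → Set₁
  _∈F_ {N} P ℱ = Σ (Subspace N) (λ Q → Q ∈ ℱ × Q ≐ P)

  -- the family ℱ is exactly { P : cond P } (cond invariant under ≐ in practice)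
  FamilyIs : ∀ {N} → List (Subspace N) → (Subspace N → Set) → Set₁
  FamilyIs ℱ cond = (∀ P → P ∈ ℱ → cond P) × (∀ P → cond P → P ∈F ℱ)

  TIntersecting : ∀ {N} → ℕ → List (Subspace N) → Set₁
  TIntersecting t ℱ = ∀ A B → A ∈ ℱ → B ∈ ℱ → DimGE (A ∩ B) t

  NonTrivial : ∀ {N} → ℕ → List (Subspace N) → Set
  NonTrivial t ℱ = DimLT (⋂ ℱ) t

open LinAlg public

-- θ a = (q^a - 1)/(q - 1) = 1 + q + ... + q^(a-1)
θ : ℕ → ℕ → ℕ
θ q zero    = 0
θ q (suc a) = q ^ℕ a +ℕ θ q a

prodTerm : ℕ → ℕ → ℕ → ℕ
prodTerm q ℓ zero    = 1
prodTerm q ℓ (suc k) = (q ^ℕ ℓ ∸ q ^ℕ suc k) *ℕ prodTerm q ℓ k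

{-# OPTIONS --safe #-}
module Submission where

open import Defs using (FiniteField; module LinAlg; θ; prodTerm)
open import Level using (Level; 0ℓ; _⊔_) renaming (suc to lsuc)
open import Data.Empty using (⊥-elim)
open import Data.Fin using (Fin)
import Data.Fin as Fin
import Data.Fin.Properties as Fin
open import Data.List using (List; []; _∷_; length; _++_; cartesianProductWith; allFin)
import Data.List as List
import Data.List.Properties as List
open import Data.List.Membership.Propositional using (_∈_; lose; find)
open import Data.List.Membership.Propositional.Properties using (∈-map⁺; ∈-map⁻)
import Data.List.Relation.Unary.All as All
open import Data.List.Relation.Unary.AllPairs using (AllPairs; _∷_)
import Data.List.Relation.Unary.AllPairs.Properties as AllPairs
open import Data.List.Relation.Unary.Any as Any using (Any; here; there; any?)
open import Data.Nat using (ℕ; zero; suc; pred; _+_; _*_; _∸_; _^_; _≤_; _<_; z≤n; s≤s; _≤?_; _<?_; NonZero; >-nonZero) renaming (_≟_ to _≟ℕ_)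
open import Data.Nat.Properties hiding (_≟_; _≤?_; _<?_)
open import Data.Nat.Tactic.RingSolver using (solve-∀)
open import Data.Product using (Σ; _×_; _,_; ∃; proj₁; proj₂)
open import Data.Sum using (_⊎_; inj₁; inj₂; [_,_]′; map)
open import Data.Unit using (⊤; tt)
open import Data.Vec using (Vec; []; _∷_; replicate)
import Data.Vec.Properties as Vec
open import Data.Vec.Relation.Unary.All as VAll using ([]; _∷_)
open import Function.Bundles using (_↔_; _⇔_; mk⇔; Inverse)
open import Relation.Binary.Definitions using (DecidableEquality)
open import Relation.Binary.PropositionalEquality
open import Relation.Nullary using (¬_; Dec; yes; no; ¬?; _×-dec_; _⊎-dec_)
open import Relation.Nullary.Decidable using (map′)

-- A decidable subspace has dimension m exactly when it has q ^ m vectors, so dimensions are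
-- handled by counting vectors. Write Q = q ^ ℓ and d = n - t, and let degree(S) be the number of
-- members of ℱ containing S. If every F ∈ ℱ with S ⊆ F contains at least a vectors of a set P,
-- then a * degree(S) ≤ Σ_{v ∈ P} degree(S + v); equality versions of this count both extremal families.
-- A cover is a subspace meeting every member in dimension ≥ t; non-triviality says that no
-- cover has dimension t, and if S is not a cover then degree(S) ≤ θ_{d+1} max degree(S + v). Starting from
-- a cover of minimal dimension ≥ t + 2, this already makes ℱ too small. If the minimal dimension
-- is t + 1, call a (t+1)-space T heavy if degree(T) > θ_{d+1} Q ^ (d - 2). Heavy spaces are covers and
-- pairwise meet in dimension ≥ t, so they either all contain a common t-space X, or three of them
-- span a (t+2)-space Z met by every member in dimension t + 1. In the first case, pick B ∈ ℱ not
-- containing X: either every member not containing X lies in M = X + B, and then ℱ ⊆ ℋ₁(X, M),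
-- or the heavy spaces lie in a hyperplane of M and ℱ is too small.

-- Indicators and finite sums

-- Membership in a subspace is a bare predicate, so counting and searching need decidability. A
-- basis supplies it, and since every k-dimensional subspace is the span of a k-tuple of vectors,
-- the existence of a cover or of a heavy subspace is settled by a finite search. Counting vectors
-- replaces Gaussian binomials and quotient spaces by recurrences with a common factor such as q^t -
-- q^i, cancelled at each step. The two bounds compete through their coefficients of Q^(d-1): q θ_d
-- for ℋ₁(X, M) and θ_{t+2} for the family of Z. Since q θ_d = θ_{d+1} - 1, the first wins when t +
-- 2 ≤ d and the second when d ≤ t + 1, which are the two ranges of t. Every remaining case has size
-- at most (q^d + q^(d-1)) Q^(d-1) or q^(t+1) Q^(d-1), below the winner in either range. Terms of
-- order Q^(d-2) are absorbed because ℓ is large; constants such as 8 and 16, produced by θ_{k+1} ≤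
-- 2 q^k, are paid for by q ≥ 3, or by two further factors q when q = 2. This is where the excluded
-- pairs (ℓ, q) enter.

module FiniteSums where

  private variable
    a b c p p′ : Level
    A : Set a
    B : Set b
    C : Set c
    P : Set p
    R : Set p′

  ⟦_⟧ : Dec P → ℕ
  ⟦ yes _ ⟧ = 1
  ⟦ no _ ⟧ = 0

  ⟦⟧-yes : (d : Dec P) → P → ⟦ d ⟧ ≡ 1
  ⟦⟧-yes (yes _) _ = refl
  ⟦⟧-yes (no ¬x) x = ⊥-elim (¬x x)

  ⟦⟧-no : (d : Dec P) → ¬ P → ⟦ d ⟧ ≡ 0
  ⟦⟧-no (yes x) ¬x = ⊥-elim (¬x x)
  ⟦⟧-no (no _) _ = refl

  ⟦⟧-mono : (d : Dec P) (e : Dec R) → (P → R) → ⟦ d ⟧ ≤ ⟦ e ⟧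
  ⟦⟧-mono (no _) e f = z≤n
  ⟦⟧-mono (yes x) e f = ≤-reflexive (sym (⟦⟧-yes e (f x)))

  ⟦⟧-cong : (d : Dec P) (e : Dec R) → (P → R) → (R → P) → ⟦ d ⟧ ≡ ⟦ e ⟧
  ⟦⟧-cong d e f g = ≤-antisym (⟦⟧-mono d e f) (⟦⟧-mono e d g)

  ⟦⟧-≡⇒ : (d : Dec P) (e : Dec R) → ⟦ d ⟧ ≡ ⟦ e ⟧ → P → R
  ⟦⟧-≡⇒ d (yes y) eq x = y
  ⟦⟧-≡⇒ d (no _) eq x = ⊥-elim (0≢1+n (trans (sym eq) (⟦⟧-yes d x)))

  ⟦⟧-× : (d : Dec P) (e : Dec R) → ⟦ d ×-dec e ⟧ ≡ ⟦ d ⟧ * ⟦ e ⟧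
  ⟦⟧-× (yes _) (yes _) = refl
  ⟦⟧-× (yes _) (no _) = refl
  ⟦⟧-× (no _) e = refl

  ⟦⟧-split : (d : Dec P) (e : Dec R) → ⟦ d ⟧ ≡ ⟦ d ×-dec e ⟧ + ⟦ d ×-dec ¬? e ⟧
  ⟦⟧-split (yes _) (yes _) = refl
  ⟦⟧-split (yes _) (no _) = refl
  ⟦⟧-split (no _) _ = refl

  ⟦⟧-weaken : (d : Dec P) {m n : ℕ} → (P → m ≤ n) → ⟦ d ⟧ * m ≤ ⟦ d ⟧ * n
  ⟦⟧-weaken (yes x) h = *-monoʳ-≤ 1 (h x)
  ⟦⟧-weaken (no _) h = z≤n

  ⟦⟧-subst : (d : Dec P) {m n : ℕ} → (P → m ≡ n) → ⟦ d ⟧ * m ≡ ⟦ d ⟧ * n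
  ⟦⟧-subst (yes x) h = cong (1 *_) (h x)
  ⟦⟧-subst (no _) h = refl

  ∑ : List A → (A → ℕ) → ℕ
  ∑ [] f = 0
  ∑ (x ∷ xs) f = f x + ∑ xs f

  infix 5 ∑-syntax
  ∑-syntax : List A → (A → ℕ) → ℕ
  ∑-syntax = ∑
  syntax ∑-syntax xs (λ x → e) = ∑[ x ← xs ] e

  module _ {A : Set a} where

    ∑-mono : (xs : List A) {f g : A → ℕ} → (∀ x → f x ≤ g x) → ∑ xs f ≤ ∑ xs g
    ∑-mono [] h = z≤n
    ∑-mono (x ∷ xs) h = +-mono-≤ (h x) (∑-mono xs h)

    ∑-cong : (xs : List A) {f g : A → ℕ} → (∀ x → f x ≡ g x) → ∑ xs f ≡ ∑ xs g
    ∑-cong [] h = refl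
    ∑-cong (x ∷ xs) h = cong₂ _+_ (h x) (∑-cong xs h)

    ∑-const : (xs : List A) (c : ℕ) → ∑ xs (λ _ → c) ≡ length xs * c
    ∑-const [] c = refl
    ∑-const (x ∷ xs) c = cong (c +_) (∑-const xs c)

    ∑-zero : (xs : List A) {f : A → ℕ} → (∀ x → f x ≡ 0) → ∑ xs f ≡ 0
    ∑-zero xs h = trans (∑-cong xs h) (trans (∑-const xs 0) (*-zeroʳ (length xs)))

    ∑-+ : (xs : List A) (f g : A → ℕ) → ∑ xs (λ x → f x + g x) ≡ ∑ xs f + ∑ xs g
    ∑-+ [] f g = refl
    ∑-+ (x ∷ xs) f g = trans (cong (f x + g x +_) (∑-+ xs f g)) (+-lemma (f x) (g x) (∑ xs f) (∑ xs g))
      where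
      +-lemma : ∀ a b c d → a + b + (c + d) ≡ a + c + (b + d)
      +-lemma = solve-∀

    ∑-*ˡ : (xs : List A) (c : ℕ) (f : A → ℕ) → ∑ xs (λ x → c * f x) ≡ c * ∑ xs f
    ∑-*ˡ [] c f = sym (*-zeroʳ c)
    ∑-*ˡ (x ∷ xs) c f = trans (cong (c * f x +_) (∑-*ˡ xs c f)) (sym (*-distribˡ-+ c (f x) (∑ xs f)))

    ∑-*ʳ : (xs : List A) (c : ℕ) (f : A → ℕ) → ∑ xs (λ x → f x * c) ≡ ∑ xs f * c
    ∑-*ʳ xs c f = trans (∑-cong xs (λ x → *-comm (f x) c)) (trans (∑-*ˡ xs c f) (*-comm c (∑ xs f)))

    ∑-++ : (xs ys : List A) (f : A → ℕ) → ∑ (xs ++ ys) f ≡ ∑ xs f + ∑ ys f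
    ∑-++ [] ys f = refl
    ∑-++ (x ∷ xs) ys f = trans (cong (f x +_) (∑-++ xs ys f)) (sym (+-assoc (f x) _ _))

    -- The source of the equality statements: applied to indicators it reverses an inclusion of
    -- subspaces of equal cardinality, and it shows that a family of extremal size inside an
    -- extremal family is all of it.
    ∑-mono-tight : (xs : List A) {f g : A → ℕ} → (∀ x → f x ≤ g x) → ∑ xs g ≤ ∑ xs f →
                   ∀ {x} → x ∈ xs → f x ≡ g x
    ∑-mono-tight (y ∷ ys) {f} {g} h le (here refl) =
      ≤-antisym (h y) (+-cancelʳ-≤ (∑ ys g) _ _ (≤-trans le (+-monoʳ-≤ (f y) (∑-mono ys h))))
    ∑-mono-tight (y ∷ ys) {f} {g} h le (there x∈) =
      ∑-mono-tight ys h (+-cancelˡ-≤ (g y) _ _ (≤-trans le (+-monoˡ-≤ (∑ ys f) (h y)))) x∈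

  ∑-map : (g : A → B) (xs : List A) (f : B → ℕ) → ∑ (List.map g xs) f ≡ ∑[ x ← xs ] f (g x)
  ∑-map g [] f = refl
  ∑-map g (x ∷ xs) f = cong (f (g x) +_) (∑-map g xs f)

  ∑-swap : (xs : List A) (ys : List B) (f : A → B → ℕ) →
           (∑[ x ← xs ] ∑[ y ← ys ] f x y) ≡ (∑[ y ← ys ] ∑[ x ← xs ] f x y)
  ∑-swap [] ys f = sym (∑-zero ys (λ _ → refl))
  ∑-swap (x ∷ xs) ys f = trans (cong (∑ ys (f x) +_) (∑-swap xs ys f)) (sym (∑-+ ys (f x) _))

  ∑-cartesian : (h : A → B → C) (xs : List A) (ys : List B) (f : C → ℕ) →
                ∑ (cartesianProductWith h xs ys) f ≡ (∑[ x ← xs ] ∑[ y ← ys ] f (h x y))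
  ∑-cartesian h [] ys f = refl
  ∑-cartesian h (x ∷ xs) ys f =
    trans (∑-++ (List.map (h x) ys) _ f) (cong₂ _+_ (∑-map (h x) ys f) (∑-cartesian h xs ys f))

  -- A finite type is given by a list in which every element occurs exactly once.
  record Finite (A : Set a) : Set a where
    field
      elems : List A
      _≟_   : DecidableEquality A
      ∑-δ   : ∀ x → (∑[ y ← elems ] ⟦ y ≟ x ⟧) ≡ 1

    ∑-pick : (g : A → ℕ) (x : A) → (∑[ y ← elems ] ⟦ y ≟ x ⟧ * g y) ≡ g x
    ∑-pick g x = begin
      (∑[ y ← elems ] ⟦ y ≟ x ⟧ * g y) ≡⟨ ∑-cong elems (λ y → ⟦⟧-subst (y ≟ x) (cong g)) ⟩
      (∑[ y ← elems ] ⟦ y ≟ x ⟧ * g x) ≡⟨ ∑-*ʳ elems (g x) _ ⟩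
      (∑[ y ← elems ] ⟦ y ≟ x ⟧) * g x ≡⟨ cong (_* g x) (∑-δ x) ⟩
      1 * g x                          ≡⟨ *-identityˡ (g x) ⟩
      g x ∎
      where open ≡-Reasoning

    complete : ∀ x → x ∈ elems
    complete x with any? (x ≟_) elems
    ... | yes x∈ = x∈
    ... | no x∉ = ⊥-elim (0≢1+n (trans (sym (absent elems x∉)) (∑-δ x)))
      where
      absent : ∀ xs → ¬ (x ∈ xs) → (∑[ y ← xs ] ⟦ y ≟ x ⟧) ≡ 0
      absent [] _ = refl
      absent (y ∷ ys) x∉ = cong₂ _+_ (⟦⟧-no (y ≟ x) λ { refl → x∉ (here refl) }) (absent ys (λ z → x∉ (there z)))

    ∃? : {P : A → Set p} → (∀ x → Dec (P x)) → Dec (∃ P)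
    ∃? P? = map′ Any.satisfied (λ { (x , px) → lose (complete x) px }) (any? P? elems)

    ∀? : {P : A → Set p} → (∀ x → Dec (P x)) → Dec (∀ x → P x)
    ∀? P? with ∃? (λ x → ¬? (P? x))
    ... | yes (x , ¬px) = no λ h → ¬px (h x)
    ... | no none = yes λ x → decide x (P? x)
      where
      decide : ∀ x → Dec _ → _
      decide x (yes px) = px
      decide x (no ¬px) = ⊥-elim (none (x , ¬px))

    ∑-unique : {P : A → Set p} (P? : ∀ x → Dec (P x)) (x : A) → P x → (∀ y → P y → y ≡ x) →
               (∑[ y ← elems ] ⟦ P? y ⟧) ≡ 1
    ∑-unique {P = P} P? x px u =
      trans (∑-cong elems (λ y → ⟦⟧-cong (P? y) (y ≟ x) (u y) (λ y≡x → subst P (sym y≡x) px))) (∑-δ x)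

    -- Trades the indicator of an existential for a sum over its witnesses; this makes spans and
    -- one-vector extensions countable.
    ∑-∃! : {P : A → Set p} (P? : ∀ x → Dec (P x)) → (∀ x y → P x → P y → x ≡ y) →
           (∑[ y ← elems ] ⟦ P? y ⟧) ≡ ⟦ ∃? P? ⟧
    ∑-∃! P? u with ∃? P?
    ... | yes (x , px) = ∑-unique P? x px (λ y py → u y x py px)
    ... | no none = ∑-zero elems (λ y → ⟦⟧-no (P? y) (λ py → none (y , py)))

  module _ {A : Set a} (fin : Finite A) where
    open Finite fin

    -- Each `g (φ x)` is expanded by `∑-pick` and the sums are swapped, so invertibility of `φ` only
    -- has to show that every `y` has exactly one preimage.
    ∑-reindex : (φ ψ : A → A) → (∀ x → ψ (φ x) ≡ x) → (∀ y → φ (ψ y) ≡ y) → (g : A → ℕ) →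
                (∑[ x ← elems ] g (φ x)) ≡ ∑ elems g
    ∑-reindex φ ψ ψφ φψ g = begin
      (∑[ x ← elems ] g (φ x))                                ≡⟨ ∑-cong elems (λ x → sym (∑-pick g (φ x))) ⟩
      (∑[ x ← elems ] ∑[ y ← elems ] ⟦ y ≟ φ x ⟧ * g y)       ≡⟨ ∑-swap elems elems _ ⟩
      (∑[ y ← elems ] ∑[ x ← elems ] ⟦ y ≟ φ x ⟧ * g y)       ≡⟨ ∑-cong elems (λ y → ∑-*ʳ elems (g y) _) ⟩
      (∑[ y ← elems ] (∑[ x ← elems ] ⟦ y ≟ φ x ⟧) * g y)     ≡⟨ ∑-cong elems (λ y → cong (_* g y) (preimage y)) ⟩
      (∑[ y ← elems ] 1 * g y)                                ≡⟨ ∑-cong elems (λ y → *-identityˡ (g y)) ⟩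
      ∑ elems g ∎
      where
      open ≡-Reasoning
      preimage : ∀ y → (∑[ x ← elems ] ⟦ y ≟ φ x ⟧) ≡ 1
      preimage y = ∑-unique (λ x → y ≟ φ x) (ψ y) (sym (φψ y)) (λ x y≡φx → trans (sym (ψφ x)) (cong ψ (sym y≡φx)))

  Fin-finite : ∀ n → Finite (Fin n)
  Fin-finite n = record { elems = allFin n ; _≟_ = Fin._≟_ ; ∑-δ = once }
    where
    once : ∀ {n} (i : Fin n) → (∑[ j ← allFin n ] ⟦ j Fin.≟ i ⟧) ≡ 1
    once {suc n} Fin.zero = cong suc (trans (cong (λ xs → ∑ xs (λ j → ⟦ j Fin.≟ Fin.zero ⟧)) (sym (List.map-tabulate {n = n} (λ j → j) Fin.suc)))
      (trans (∑-map Fin.suc (allFin n) _) (∑-zero (allFin n) (λ j → ⟦⟧-no (Fin.suc j Fin.≟ Fin.zero) λ ()))))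
    once {suc n} (Fin.suc i) = trans (cong (λ xs → ∑ xs (λ j → ⟦ j Fin.≟ Fin.suc i ⟧)) (sym (List.map-tabulate {n = n} (λ j → j) Fin.suc)))
      (trans (∑-map Fin.suc (allFin n) _)
        (trans (∑-cong (allFin n) (λ j → ⟦⟧-cong (Fin.suc j Fin.≟ Fin.suc i) (j Fin.≟ i) Fin.suc-injective (cong Fin.suc)))
          (once i)))

  ↔-finite : ∀ {n} → Fin n ↔ A → Finite A
  ↔-finite {A = A} {n = n} iso = record { elems = List.map to (allFin n) ; _≟_ = dec ; ∑-δ = once }
    where
    open Inverse iso
    open Finite (Fin-finite n) using () renaming (∑-unique to ∑-uniqueFin)
    dec : DecidableEquality A
    dec x y = map′ (λ e → trans (sym (strictlyInverseˡ x)) (trans (cong to e) (strictlyInverseˡ y))) (cong from) (from x Fin.≟ from y)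
    once : ∀ x → (∑[ y ← List.map to (allFin n) ] ⟦ dec y x ⟧) ≡ 1
    once x = trans (∑-map to (allFin n) _)
      (∑-uniqueFin (λ i → dec (to i) x) (from x) (strictlyInverseˡ x)
        (λ i e → trans (sym (strictlyInverseʳ i)) (cong from e)))

  Vec-finite : Finite A → ∀ n → Finite (Vec A n)
  Vec-finite {A = A} fin n = record { elems = vecs n ; _≟_ = Vec.≡-dec _≟_ ; ∑-δ = once n }
    where
    open Finite fin
    vecs : ∀ n → List (Vec A n)
    vecs zero = [] ∷ []
    vecs (suc n) = cartesianProductWith _∷_ elems (vecs n)
    once : ∀ n (x : Vec A n) → (∑[ y ← vecs n ] ⟦ Vec.≡-dec _≟_ y x ⟧) ≡ 1
    once zero [] = refl
    once (suc n) (x ∷ xs) = begin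
      (∑[ y ← vecs (suc n) ] ⟦ Vec.≡-dec _≟_ y (x ∷ xs) ⟧)
        ≡⟨ ∑-cartesian _∷_ elems (vecs n) _ ⟩
      (∑[ y ← elems ] ∑[ ys ← vecs n ] ⟦ Vec.≡-dec _≟_ (y ∷ ys) (x ∷ xs) ⟧)
        ≡⟨ ∑-cong elems (λ y → ∑-cong (vecs n) (λ ys → trans
             (⟦⟧-cong (Vec.≡-dec _≟_ (y ∷ ys) (x ∷ xs)) ((y ≟ x) ×-dec Vec.≡-dec _≟_ ys xs)
               (λ { refl → refl , refl }) (λ { (refl , refl) → refl }))
             (⟦⟧-× (y ≟ x) (Vec.≡-dec _≟_ ys xs)))) ⟩
      (∑[ y ← elems ] ∑[ ys ← vecs n ] ⟦ y ≟ x ⟧ * ⟦ Vec.≡-dec _≟_ ys xs ⟧)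
        ≡⟨ ∑-cong elems (λ y → ∑-*ˡ (vecs n) ⟦ y ≟ x ⟧ _) ⟩
      (∑[ y ← elems ] ⟦ y ≟ x ⟧ * (∑[ ys ← vecs n ] ⟦ Vec.≡-dec _≟_ ys xs ⟧))
        ≡⟨ ∑-cong elems (λ y → trans (cong (⟦ y ≟ x ⟧ *_) (once n xs)) (*-identityʳ _)) ⟩
      (∑[ y ← elems ] ⟦ y ≟ x ⟧)
        ≡⟨ ∑-δ x ⟩
      1 ∎
      where open ≡-Reasoning

  Vec-finite-length : (fin : Finite A) → ∀ n →
    length (Finite.elems (Vec-finite fin n)) ≡ length (Finite.elems fin) ^ n
  Vec-finite-length fin zero = refl
  Vec-finite-length fin (suc n) = begin
    length (Finite.elems (Vec-finite fin (suc n)))                  ≡⟨ sym (trans (∑-const (elems (Vec-finite fin (suc n))) 1) (*-identityʳ _)) ⟩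
    ∑ (elems (Vec-finite fin (suc n))) (λ _ → 1)                    ≡⟨ ∑-cartesian _∷_ (elems fin) _ _ ⟩
    ∑ (elems fin) (λ _ → ∑ (elems (Vec-finite fin n)) (λ _ → 1))    ≡⟨ ∑-cong (elems fin) (λ _ → trans (∑-const (elems (Vec-finite fin n)) 1) (*-identityʳ _)) ⟩
    ∑ (elems fin) (λ _ → length (elems (Vec-finite fin n)))         ≡⟨ ∑-const (elems fin) _ ⟩
    length (elems fin) * length (elems (Vec-finite fin n))          ≡⟨ cong (length (elems fin) *_) (Vec-finite-length fin n) ⟩
    length (elems fin) ^ suc n ∎
    where
    open ≡-Reasoning
    open Finite using (elems)

open FiniteSums

-- The numbers θ

module Arith (q : ℕ) (1<q : 1 < q) where

  instance
    q≢0 : NonZero q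
    q≢0 = >-nonZero (<-trans (s≤s z≤n) 1<q)

  1≤q^ : ∀ k → 1 ≤ q ^ k
  1≤q^ k = m^n>0 q k

  ^-cancel-≤ : ∀ a b → q ^ a ≤ q ^ b → a ≤ b
  ^-cancel-≤ a b le with a ≤? b
  ... | yes a≤b = a≤b
  ... | no a≰b = ⊥-elim (<⇒≱ (^-monoʳ-< q 1<q (≰⇒> a≰b)) le)

  ^-cancel-< : ∀ a b → q ^ a < q ^ b → a < b
  ^-cancel-< a b lt with suc a ≤? b
  ... | yes a<b = a<b
  ... | no a≮b = ⊥-elim (<⇒≱ lt (^-monoʳ-≤ q (≤-pred (≰⇒> a≮b))))

  ^-cancel-≡ : ∀ a b → q ^ a ≡ q ^ b → a ≡ b
  ^-cancel-≡ a b e = ≤-antisym (^-cancel-≤ a b (≤-reflexive e)) (^-cancel-≤ b a (≤-reflexive (sym e)))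

  q≡ : q ≡ suc (pred q)
  q≡ = sym (suc-pred q)

  θ-+ : ∀ m a → θ q (m + a) ≡ θ q m + q ^ m * θ q a
  θ-+ m zero = trans (cong (θ q) (+-identityʳ m)) (sym (trans (cong (θ q m +_) (*-zeroʳ (q ^ m))) (+-identityʳ _)))
  θ-+ m (suc a) = begin
    θ q (m + suc a)                               ≡⟨ cong (θ q) (+-suc m a) ⟩
    q ^ (m + a) + θ q (m + a)                     ≡⟨ cong₂ _+_ (^-distribˡ-+-* q m a) (θ-+ m a) ⟩
    q ^ m * q ^ a + (θ q m + q ^ m * θ q a)       ≡⟨ rearrange (q ^ m) (q ^ a) (θ q m) (θ q a) ⟩
    θ q m + q ^ m * θ q (suc a) ∎
    where
    open ≡-Reasoning
    rearrange : ∀ x y z w → x * y + (z + x * w) ≡ z + x * (y + w)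
    rearrange = solve-∀

  θ-suc : ∀ k → θ q (suc k) ≡ suc (q * θ q k)
  θ-suc k = trans (θ-+ 1 k) (cong (λ x → suc (x * θ q k)) (*-identityʳ q))

  q^≡1+ : ∀ k → q ^ k ≡ suc (pred q * θ q k)
  q^≡1+ k = +-cancelʳ-≡ (θ q k) _ _ (trans (θ-suc k) (cong suc (trans (cong (_* θ q k) q≡) (+-comm (θ q k) _))))

  q^∸q^ : ∀ i a → q ^ (i + a) ∸ q ^ i ≡ q ^ i * (pred q * θ q a)
  q^∸q^ i a = begin
    q ^ (i + a) ∸ q ^ i                               ≡⟨ cong (_∸ q ^ i) (trans (^-distribˡ-+-* q i a) (cong (q ^ i *_) (q^≡1+ a))) ⟩
    q ^ i * suc (pred q * θ q a) ∸ q ^ i              ≡⟨ cong (_∸ q ^ i) (*-suc (q ^ i) _) ⟩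
    q ^ i + q ^ i * (pred q * θ q a) ∸ q ^ i          ≡⟨ m+n∸m≡n (q ^ i) _ ⟩
    q ^ i * (pred q * θ q a) ∎
    where open ≡-Reasoning

  ∸-nonZero : ∀ {i t} → i < t → NonZero (q ^ t ∸ q ^ i)
  ∸-nonZero i<t = >-nonZero (m<n⇒0<n∸m (^-monoʳ-< q 1<q i<t))

  ∸-scale : ∀ a b c → q ^ (a + c) ∸ q ^ (b + c) ≡ (q ^ a ∸ q ^ b) * q ^ c
  ∸-scale a b c = trans (cong₂ _∸_ (^-distribˡ-+-* q a c) (^-distribˡ-+-* q b c)) (sym (*-distribʳ-∸ (q ^ c) (q ^ a) (q ^ b)))

  θ≤q^ : ∀ k → θ q k ≤ q ^ k
  θ≤q^ k = ≤-trans (≤-trans (≤-reflexive (sym (*-identityˡ _))) (*-monoˡ-≤ (θ q k) (≤-pred (subst (2 ≤_) q≡ 1<q))))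
                   (≤-trans (n≤1+n _) (≤-reflexive (sym (q^≡1+ k))))

  -- The only loss is the replacement of q^k by θ_{k+1} in the tail of the geometric sum.
  θ-submult : ∀ k a → θ q (k + suc a) ≤ θ q (suc k) * θ q (suc a)
  θ-submult k a = begin
    θ q (k + suc a)                                   ≡⟨ trans (cong (θ q) (+-suc k a)) (θ-+ (suc k) a) ⟩
    θ q (suc k) + q ^ suc k * θ q a                   ≡⟨ cong (θ q (suc k) +_) (*-assoc q (q ^ k) (θ q a)) ⟩
    θ q (suc k) + q * (q ^ k * θ q a)                 ≤⟨ +-monoʳ-≤ (θ q (suc k)) (*-monoʳ-≤ q (*-monoˡ-≤ (θ q a) (m≤m+n (q ^ k) (θ q k)))) ⟩
    θ q (suc k) + q * (θ q (suc k) * θ q a)           ≡⟨ rearrange (θ q (suc k)) q (θ q a) ⟩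
    θ q (suc k) * suc (q * θ q a)                     ≡⟨ cong (θ q (suc k) *_) (sym (θ-suc a)) ⟩
    θ q (suc k) * θ q (suc a) ∎
    where
    open ≤-Reasoning
    rearrange : ∀ x y z → x + y * (x * z) ≡ x * suc (y * z)
    rearrange = solve-∀

  θ-mono : ∀ {a b} → a ≤ b → θ q a ≤ θ q b
  θ-mono {a} {b} a≤b = subst (θ q a ≤_) (trans (sym (θ-+ a (b ∸ a))) (cong (θ q) (m+[n∸m]≡n a≤b))) (m≤m+n _ _)

  -- The quotient of the two differences is θ_{t+k-r} / θ_{t-r}, which is largest at r = t - 1,
  -- where it equals θ_{k+1}. One factor thus serves for all intersection dimensions below t.
  branch-ratio : ∀ r t k → r < t → q ^ (t + k) ∸ q ^ r ≤ (q ^ t ∸ q ^ r) * θ q (suc k)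
  branch-ratio r t k r<t = begin
    q ^ (t + k) ∸ q ^ r                               ≡⟨ cong (λ x → q ^ x ∸ q ^ r) exponent ⟩
    q ^ (r + (k + suc a)) ∸ q ^ r                     ≡⟨ q^∸q^ r (k + suc a) ⟩
    q ^ r * (pred q * θ q (k + suc a))                ≤⟨ *-monoʳ-≤ (q ^ r) (*-monoʳ-≤ (pred q) (θ-submult k a)) ⟩
    q ^ r * (pred q * (θ q (suc k) * θ q (suc a)))    ≡⟨ rearrange (q ^ r) (pred q) (θ q (suc k)) (θ q (suc a)) ⟩
    q ^ r * (pred q * θ q (suc a)) * θ q (suc k)      ≡⟨ cong (_* θ q (suc k)) (sym (trans (cong (λ x → q ^ x ∸ q ^ r) t≡) (q^∸q^ r (suc a)))) ⟩
    (q ^ t ∸ q ^ r) * θ q (suc k) ∎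
    where
    open ≤-Reasoning
    a = t ∸ suc r
    t≡ : t ≡ r + suc a
    t≡ = trans (sym (m+[n∸m]≡n r<t)) (sym (+-suc r a))
    exponent : t + k ≡ r + (k + suc a)
    exponent = trans (cong (_+ k) t≡) (trans (+-assoc r (suc a) k) (cong (r +_) (+-comm (suc a) k)))
    rearrange : ∀ x y z w → x * (y * (z * w)) ≡ x * (y * w) * z
    rearrange = solve-∀

  1+u≡⇒< : ∀ {i u t} → i + suc u ≡ t → i < t
  1+u≡⇒< {i} {u} refl = m<m+n i (s≤s z≤n)

-- Numerical comparisons

module Bounds (q : ℕ) (1<q : 1 < q) (t e ℓ : ℕ) (1≤t : 1 ≤ t)
  (large : (3 ≤ q × 4 + (e + (t + t)) ≤ ℓ) ⊎ 6 + (e + (t + t)) ≤ ℓ) where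

  open Arith q 1<q

  private
    Q x y d Θ s : ℕ
    Q = q ^ ℓ
    x = q ^ t
    y = q ^ e
    d = suc (suc e)
    Θ = θ q (suc d)
    s = q * θ q d

    instance
      Q≢0 : NonZero Q
      Q≢0 = m^n≢0 q ℓ

    expand : q ^ (e + (t + t)) ≡ y * (x * x)
    expand = trans (^-distribˡ-+-* q e (t + t)) (cong (y *_) (^-distribˡ-+-* q t t))

    4≤ℓ′ : 4 + (e + (t + t)) ≤ ℓ
    4≤ℓ′ = [ proj₂ , ≤-trans (+-monoˡ-≤ (e + (t + t)) (m≤m+n 4 2)) ]′ large

    -- Since n + t + 2 = 4 + e + 2t, the hypothesis on `ℓ` becomes q^4 y x^2 ≤ Q with x = q^t and y
    -- = q^e. The comparisons then become polynomial in q, x, y up to a numerical constant, and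
    -- `Q-cases` says what pays for it: q ≥ 3 or two more factors q.
    Q≥₄ : q * (q * (q * (q * (y * (x * x))))) ≤ Q
    Q≥₄ = subst (λ z → q * (q * (q * (q * z))) ≤ Q) expand (^-monoʳ-≤ q 4≤ℓ′)

    Q-cases : (3 ≤ q × q * (q * (q * (q * (y * (x * x))))) ≤ Q) ⊎ q * (q * (q * (q * (q * (q * (y * (x * x))))))) ≤ Q
    Q-cases = map (λ { (3≤q , _) → 3≤q , Q≥₄ })
      (λ h → subst (λ z → q * (q * (q * (q * (q * (q * z))))) ≤ Q) expand (^-monoʳ-≤ q h)) large

    q≤x : q ≤ x
    q≤x = subst (_≤ x) (*-identityʳ q) (^-monoʳ-≤ q 1≤t)

    θ<q^ : ∀ k → suc (θ q k) ≤ q ^ k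
    θ<q^ k = ≤-trans (s≤s (≤-trans (≤-reflexive (sym (*-identityˡ _))) (*-monoˡ-≤ (θ q k) (≤-pred (subst (2 ≤_) q≡ 1<q)))))
                     (≤-reflexive (sym (q^≡1+ k)))

    -- From θ_{k+1} = q^k + θ_k and θ_k < q^k. Repeated use is the origin of the constants 8 and 16.
    θ<2q^ : ∀ k → suc (θ q (suc k)) ≤ 2 * q ^ k
    θ<2q^ k = ≤-trans (≤-reflexive (sym (+-suc (q ^ k) (θ q k)))) (≤-trans (+-monoʳ-≤ (q ^ k) (θ<q^ k)) (≤-reflexive (cong (q ^ k +_) (sym (+-identityʳ _)))))

    θ≤2q^ : ∀ k → θ q (suc k) ≤ 2 * q ^ k
    θ≤2q^ k = ≤-trans (n≤1+n _) (θ<2q^ k)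

  -- The coefficient lies below that of Q^(d-1) in the larger extremal size: below q θ_d = q^d +
  -- q^(d-1) + ... + q when 1 ≤ t ≤ e, and below θ_{t+2} = q^(t+1) + q^t + ... + 1 when d ≤ t + 1.
  Small : ℕ → Set
  Small c = c ≤ (q ^ d + q ^ suc e) * Q ^ suc e

  private
    -- The left side is at most 8 x q^4 y^2, while q y Q is at least q^5 x^2 y^2. It remains to have
    -- 8 ≤ q x, which follows from q ≥ 3; for q = 2 the larger `ℓ` turns it into 8 ≤ q^3 x.
    rest-bound : suc (θ q (suc t)) * (Θ * Θ) ≤ q * y * Q
    rest-bound = ≤-trans (*-mono-≤ (θ<2q^ t) (*-mono-≤ (θ≤2q^ d) (θ≤2q^ d))) (≤-trans (≤-reflexive (ring₁ q x y)) (cases Q-cases))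
      where
      ring₁ : ∀ q x y → 2 * x * (2 * (q * (q * y)) * (2 * (q * (q * y)))) ≡ x * (q * q * q * q) * (y * y) * 8
      ring₁ = solve-∀
      ring₂ : ∀ q x y → x * (q * q * q * q) * (y * y) * (q * x) ≡ q * y * (q * (q * (q * (q * (y * (x * x))))))
      ring₂ = solve-∀
      ring₃ : ∀ q x y → x * (q * q * q * q) * (y * y) * (q * q * q * x) ≡ q * y * (q * (q * (q * (q * (q * (q * (y * (x * x))))))))
      ring₃ = solve-∀
      cases : _ → x * (q * q * q * q) * (y * y) * 8 ≤ q * y * Q
      cases (inj₁ (3≤q , h)) = ≤-trans (*-monoʳ-≤ (x * (q * q * q * q) * (y * y)) (≤-trans (n≤1+n 8) (*-mono-≤ 3≤q (≤-trans 3≤q q≤x))))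
        (≤-trans (≤-reflexive (ring₂ q x y)) (*-monoʳ-≤ (q * y) h))
      cases (inj₂ h) = ≤-trans (*-monoʳ-≤ (x * (q * q * q * q) * (y * y)) (*-mono-≤ (*-mono-≤ (*-mono-≤ 1<q 1<q) 1<q) (1≤q^ t)))
        (≤-trans (≤-reflexive (ring₃ q x y)) (*-monoʳ-≤ (q * y) h))

  -- Numerical end of the case in which all heavy subspaces share a t-space X. The first two
  -- summands bound the members containing X, the third those not containing X; the last two have
  -- order Q^e and together fit into q^(e+1) Q^(e+1).
  small-star : ∀ {c} → c ≤ θ q d * Q ^ suc e + Θ * (Θ * Q ^ e) + θ q (suc t) * (Θ * (Θ * Q ^ e)) → Small c
  small-star {c} h = begin
    c                                                                          ≤⟨ h ⟩
    θ q d * Q ^ suc e + Θ * (Θ * Q ^ e) + θ q (suc t) * (Θ * (Θ * Q ^ e))      ≡⟨ ring₁ (θ q d * Q ^ suc e) Θ (Q ^ e) (θ q (suc t)) ⟩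
    θ q d * Q ^ suc e + suc (θ q (suc t)) * (Θ * Θ) * Q ^ e                    ≤⟨ +-mono-≤ (*-monoˡ-≤ (Q ^ suc e) (θ≤q^ d)) (*-monoˡ-≤ (Q ^ e) rest-bound) ⟩
    q ^ d * Q ^ suc e + q * y * Q * Q ^ e                                      ≡⟨ ring₂ (q ^ d) Q (Q ^ e) (q * y) ⟩
    (q ^ d + q ^ suc e) * Q ^ suc e ∎
    where
    open ≤-Reasoning
    ring₁ : ∀ a Θ z w → a + Θ * (Θ * z) + w * (Θ * (Θ * z)) ≡ a + suc w * (Θ * Θ) * z
    ring₁ = solve-∀
    ring₂ : ∀ a Q z b → a * (Q * z) + b * Q * z ≡ (a + b) * (Q * z)
    ring₂ = solve-∀

  small-cover₁ : ∀ {c} → c ≤ θ q (suc t) * (Θ * (Θ * Q ^ e)) → Small c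
  small-cover₁ h = small-star (≤-trans h (m≤n+m _ (θ q d * Q ^ suc e + Θ * (Θ * Q ^ e))))

  -- θ_{t+2} θ_{t+1} / (q + 1) is the Gaussian binomial [t + 2 over t]. Four uses of θ_{k+1} ≤ 2 q^k
  -- give the constant 16, and (q + 1)^2 ≥ 16 once q ≥ 3.
  small-cover₂ : ∀ {c} → suc q * c ≤ θ q (suc (suc t)) * θ q (suc t) * (Θ ^ 2 * Q ^ e) → Small c
  small-cover₂ {c} h = *-cancelˡ-≤ (suc q) (begin
    suc q * c                                                     ≤⟨ h ⟩
    θ q (suc (suc t)) * θ q (suc t) * (Θ ^ 2 * Q ^ e)             ≤⟨ *-mono-≤ (*-mono-≤ (θ≤2q^ (suc t)) (θ≤2q^ t)) (*-monoˡ-≤ (Q ^ e) (*-mono-≤ (θ≤2q^ d) (*-monoˡ-≤ 1 (θ≤2q^ d)))) ⟩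
    2 * (q * x) * (2 * x) * (2 * (q * (q * y)) * (2 * (q * (q * y)) * 1) * Q ^ e)  ≡⟨ ring₁ q x y (Q ^ e) ⟩
    q * (q * q * q * q) * (x * x) * (y * y) * Q ^ e * 16          ≤⟨ cases Q-cases ⟩
    suc q * ((q * (q * y) + q * y) * (Q * Q ^ e)) ∎)
    where
    open ≤-Reasoning
    ring₁ : ∀ q x y z → 2 * (q * x) * (2 * x) * (2 * (q * (q * y)) * (2 * (q * (q * y)) * 1) * z) ≡ q * (q * q * q * q) * (x * x) * (y * y) * z * 16
    ring₁ = solve-∀
    ring₂ : ∀ q x y z → q * (q * q * q * q) * (x * x) * (y * y) * z * (suc q * suc q) ≡ suc q * ((q * (q * y) + q * y) * (q * (q * (q * (q * (y * (x * x))))) * z))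
    ring₂ = solve-∀
    ring₃ : ∀ q x y z → q * (q * q * q * q) * (x * x) * (y * y) * z * (q * q * (suc q * suc q)) ≡ suc q * ((q * (q * y) + q * y) * (q * (q * (q * (q * (q * (q * (y * (x * x))))))) * z))
    ring₃ = solve-∀
    common = q * (q * q * q * q) * (x * x) * (y * y) * Q ^ e
    cases : _ → common * 16 ≤ suc q * ((q * (q * y) + q * y) * (Q * Q ^ e))
    cases (inj₁ (3≤q , h)) = ≤-trans (*-monoʳ-≤ common (*-mono-≤ (s≤s 3≤q) (s≤s 3≤q))) (≤-trans (≤-reflexive (ring₂ q x y (Q ^ e)))
      (*-monoʳ-≤ (suc q) (*-monoʳ-≤ (q * (q * y) + q * y) (*-monoˡ-≤ (Q ^ e) h))))
    cases (inj₂ h) = ≤-trans (*-monoʳ-≤ common (*-mono-≤ {4} {q * q} {4} (*-mono-≤ 1<q 1<q) (≤-trans (m≤m+n 4 5) (*-mono-≤ (s≤s 1<q) (s≤s 1<q))))) (≤-trans (≤-reflexive (ring₃ q x y (Q ^ e)))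
      (*-monoʳ-≤ (suc q) (*-monoʳ-≤ (q * (q * y) + q * y) (*-monoˡ-≤ (Q ^ e) h))))

  -- For k = 3 + j one needs q^((k+1)t) Θ^k ≤ q^d Q^(k-1). There is room for the crude Θ ≤ q^(d+1),
  -- after which exponents alone decide, with slack j t + j + 1 at the least admissible `ℓ`.
  small-cover₃ : ∀ j u {c} → suc (suc (suc j)) + u ≡ d →
                 c ≤ q ^ (suc (suc (suc (suc j))) * t) * (Θ ^ suc (suc (suc j)) * Q ^ u) → Small c
  small-cover₃ j u {c} d≡ h = begin
    c                                                                  ≤⟨ h ⟩
    q ^ ((4 + j) * t) * (Θ ^ (3 + j) * Q ^ u)                          ≤⟨ *-monoʳ-≤ (q ^ ((4 + j) * t)) (*-monoˡ-≤ (Q ^ u) (^-monoˡ-≤ (3 + j) (θ≤q^ (suc d)))) ⟩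
    q ^ ((4 + j) * t) * ((q ^ suc d) ^ (3 + j) * Q ^ u)                ≡⟨ sym (*-assoc (q ^ ((4 + j) * t)) _ _) ⟩
    q ^ ((4 + j) * t) * (q ^ suc d) ^ (3 + j) * Q ^ u                  ≡⟨ cong (_* Q ^ u) (trans (cong (q ^ ((4 + j) * t) *_) (^-*-assoc q (suc d) (3 + j))) (sym (^-distribˡ-+-* q ((4 + j) * t) _))) ⟩
    q ^ ((4 + j) * t + suc d * (3 + j)) * Q ^ u                        ≤⟨ *-monoˡ-≤ (Q ^ u) (^-monoʳ-≤ q exponent) ⟩
    q ^ (d + ℓ * (2 + j)) * Q ^ u                                      ≡⟨ cong (_* Q ^ u) (trans (^-distribˡ-+-* q d _) (cong (q ^ d *_) (sym (^-*-assoc q ℓ (2 + j))))) ⟩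
    q ^ d * Q ^ (2 + j) * Q ^ u                                        ≡⟨ trans (*-assoc (q ^ d) _ _) (cong (q ^ d *_) (trans (sym (^-distribˡ-+-* Q (2 + j) u)) (cong (Q ^_) (suc-injective d≡)))) ⟩
    q ^ d * Q ^ suc e                                                  ≤⟨ *-monoˡ-≤ (Q ^ suc e) (m≤m+n (q ^ d) (q ^ suc e)) ⟩
    (q ^ d + q ^ suc e) * Q ^ suc e ∎
    where
    open ≤-Reasoning
    exponent : (4 + j) * t + suc d * (3 + j) ≤ d + ℓ * (2 + j)
    exponent = ≤-trans (m≤m+n _ (j * t + suc j)) (≤-trans (≤-reflexive (ring j t e)) (+-monoʳ-≤ d (*-monoˡ-≤ (2 + j) 4≤ℓ′)))
      where
      ring : ∀ j t e → (4 + j) * t + suc (suc (suc e)) * (3 + j) + (j * t + suc j) ≡ suc (suc e) + (4 + (e + (t + t))) * (2 + j)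
      ring = solve-∀

  -- Estimates for the product ∏ (Q - q^j).

  prodTerm-≤ : ∀ k → prodTerm q ℓ k ≤ Q ^ k
  prodTerm-≤ zero = ≤-refl
  prodTerm-≤ (suc k) = *-mono-≤ (m∸n≤m Q (q ^ suc k)) (prodTerm-≤ k)

  private
    -- The Bonferroni inequalities for ∏ (Q - q ^ j), multiplied by a power of Q.
    bonferroni-upper : ∀ k → k ≤ ℓ → Q * Q ^ k ≤ prodTerm q ℓ k * Q + q * θ q k * Q ^ k
    bonferroni-upper zero _ = ≤-trans (≤-reflexive (trans (*-identityʳ Q) (sym (*-identityˡ Q)))) (m≤m+n (1 * Q) _)
    bonferroni-upper (suc k) k<ℓ = goal (m∸n+n≡m (^-monoʳ-≤ q k<ℓ)) (bonferroni-upper k (<⇒≤ k<ℓ))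
      where
      goal : ∀ {c} → c + q ^ suc k ≡ Q → Q * Q ^ k ≤ prodTerm q ℓ k * Q + q * θ q k * Q ^ k →
             Q * (Q * Q ^ k) ≤ c * prodTerm q ℓ k * Q + q * (q ^ k + θ q k) * (Q * Q ^ k)
      goal {c} c≡ ih = begin
        Q * (Q * R)                                         ≡⟨ cong (_* (Q * R)) (sym c≡) ⟩
        (c + a) * (Q * R)                                   ≡⟨ *-distribʳ-+ (Q * R) c a ⟩
        c * (Q * R) + a * (Q * R)                           ≤⟨ +-monoˡ-≤ _ (*-monoʳ-≤ c ih) ⟩
        c * (P * Q + s′ * R) + a * (Q * R)                  ≡⟨ ring₁ c P Q s′ R a ⟩
        c * P * Q + (c * (s′ * R) + a * (Q * R))            ≤⟨ +-monoʳ-≤ (c * P * Q) (+-monoˡ-≤ _ (*-monoˡ-≤ (s′ * R) (subst (c ≤_) c≡ (m≤m+n c a)))) ⟩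
        c * P * Q + (Q * (s′ * R) + a * (Q * R))            ≡⟨ ring₂ (c * P * Q) Q q (θ q k) R (q ^ k) ⟩
        c * P * Q + q * (q ^ k + θ q k) * (Q * R) ∎
        where
        open ≤-Reasoning
        R = Q ^ k
        P = prodTerm q ℓ k
        s′ = q * θ q k
        a = q ^ suc k
        ring₁ : ∀ c P Q s R a → c * (P * Q + s * R) + a * (Q * R) ≡ c * P * Q + (c * (s * R) + a * (Q * R))
        ring₁ = solve-∀
        ring₂ : ∀ A Q q h R z → A + (Q * (q * h * R) + q * z * (Q * R)) ≡ A + q * (z + h) * (Q * R)
        ring₂ = solve-∀

    -- The second elementary symmetric sum of the q^j is replaced by the square of their sum s.
    -- Passing from k to k + 1 produces only s^2 + a s with a = q^(k+1), and adding a s + a^2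
    -- completes the square (a + s)^2.
    bonferroni-lower : ∀ k → k ≤ ℓ → prodTerm q ℓ k * (Q * Q) + q * θ q k * (Q * Q ^ k) ≤ Q * (Q * Q ^ k) + q * θ q k * (q * θ q k) * Q ^ k
    bonferroni-lower zero _ = ≤-reflexive (ring q Q)
      where
      ring : ∀ q Q → 1 * (Q * Q) + q * 0 * (Q * 1) ≡ Q * (Q * 1) + q * 0 * (q * 0) * 1
      ring = solve-∀
    bonferroni-lower (suc k) k<ℓ = goal (m∸n+n≡m (^-monoʳ-≤ q k<ℓ)) (bonferroni-lower k (<⇒≤ k<ℓ))
      where
      R = Q ^ k
      P = prodTerm q ℓ k
      s′ = q * θ q k
      a = q ^ suc k
      goal : ∀ {c} → c + a ≡ Q → P * (Q * Q) + s′ * (Q * R) ≤ Q * (Q * R) + s′ * s′ * R →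
             c * P * (Q * Q) + q * (q ^ k + θ q k) * (Q * (Q * R)) ≤
             Q * (Q * (Q * R)) + q * (q ^ k + θ q k) * (q * (q ^ k + θ q k)) * (Q * R)
      goal {c} c≡ ih = begin
        c * P * (Q * Q) + q * (q ^ k + θ q k) * (Q * (Q * R))
          ≡⟨ cong₂ (λ z w → c * P * (Q * Q) + z * (w * (Q * R))) (trans (*-distribˡ-+ q (q ^ k) (θ q k)) (+-comm a s′)) (sym c≡) ⟩
        c * P * (Q * Q) + (s′ + a) * ((c + a) * (Q * R))
          ≡⟨ ring₁ c P Q s′ a R ⟩
        c * (P * (Q * Q) + s′ * (Q * R)) + (a * s′ * (Q * R) + a * (c + a) * (Q * R))
          ≤⟨ +-monoˡ-≤ _ (*-monoʳ-≤ c ih) ⟩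
        c * (Q * (Q * R) + s′ * s′ * R) + (a * s′ * (Q * R) + a * (c + a) * (Q * R))
          ≡⟨ cong (λ z → c * (Q * (Q * R) + s′ * s′ * R) + (a * s′ * (Q * R) + a * z * (Q * R))) c≡ ⟩
        c * (Q * (Q * R) + s′ * s′ * R) + (a * s′ * (Q * R) + a * Q * (Q * R))
          ≡⟨ ring₂ c Q R s′ a ⟩
        (c + a) * (Q * (Q * R)) + c * (s′ * s′ * R) + a * s′ * (Q * R)
          ≤⟨ +-mono-≤ (+-mono-≤ (≤-reflexive (cong (_* (Q * (Q * R))) c≡)) (*-monoˡ-≤ (s′ * s′ * R) (subst (c ≤_) c≡ (m≤m+n c a)))) ≤-refl ⟩
        Q * (Q * (Q * R)) + Q * (s′ * s′ * R) + a * s′ * (Q * R)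
          ≤⟨ m≤m+n _ (a * s′ * (Q * R) + a * a * (Q * R)) ⟩
        Q * (Q * (Q * R)) + Q * (s′ * s′ * R) + a * s′ * (Q * R) + (a * s′ * (Q * R) + a * a * (Q * R))
          ≡⟨ ring₃ Q R s′ a ⟩
        Q * (Q * (Q * R)) + (a + s′) * (a + s′) * (Q * R)
          ≡⟨ cong (λ z → Q * (Q * (Q * R)) + z * z * (Q * R)) (sym (*-distribˡ-+ q (q ^ k) (θ q k))) ⟩
        Q * (Q * (Q * R)) + q * (q ^ k + θ q k) * (q * (q ^ k + θ q k)) * (Q * R) ∎
        where
        open ≤-Reasoning
        ring₁ : ∀ c P Q s a R → c * P * (Q * Q) + (s + a) * ((c + a) * (Q * R)) ≡ c * (P * (Q * Q) + s * (Q * R)) + (a * s * (Q * R) + a * (c + a) * (Q * R))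
        ring₁ = solve-∀
        ring₂ : ∀ c Q R s a → c * (Q * (Q * R) + s * s * R) + (a * s * (Q * R) + a * Q * (Q * R)) ≡ (c + a) * (Q * (Q * R)) + c * (s * s * R) + a * s * (Q * R)
        ring₂ = solve-∀
        ring₃ : ∀ Q R s a → Q * (Q * (Q * R)) + Q * (s * s * R) + a * s * (Q * R) + (a * s * (Q * R) + a * a * (Q * R)) ≡ Q * (Q * (Q * R)) + (a + s) * (a + s) * (Q * R)
        ring₃ = solve-∀

    d≤ℓ′ : d ≤ ℓ
    d≤ℓ′ = ≤-trans (+-monoʳ-≤ 2 (≤-trans (m≤m+n e (t + t)) (m≤n+m _ 2))) 4≤ℓ′

    P : ℕ
    P = prodTerm q ℓ d

    lower : P + s * Q ^ suc e ≤ Q ^ d + s * s * Q ^ e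
    lower = *-cancelʳ-≤ _ _ (Q * Q) ⦃ m*n≢0 Q Q ⦄ (begin
      (P + s * (Q * R)) * (Q * Q)               ≡⟨ ring₁ P s Q R ⟩
      P * (Q * Q) + s * (Q * (Q * (Q * R)))     ≤⟨ bonferroni-lower d d≤ℓ′ ⟩
      Q * (Q * (Q * (Q * R))) + s * s * (Q * (Q * R))   ≡⟨ ring₂ Q s R ⟩
      (Q * (Q * R) + s * s * R) * (Q * Q) ∎)
      where
      open ≤-Reasoning
      R = Q ^ e
      ring₁ : ∀ P s Q R → (P + s * (Q * R)) * (Q * Q) ≡ P * (Q * Q) + s * (Q * (Q * (Q * R)))
      ring₁ = solve-∀
      ring₂ : ∀ Q s R → Q * (Q * (Q * (Q * R))) + s * s * (Q * (Q * R)) ≡ (Q * (Q * R) + s * s * R) * (Q * Q)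
      ring₂ = solve-∀

    upper : Q ^ d ≤ P + s * Q ^ suc e
    upper = *-cancelʳ-≤ _ _ Q (begin
      Q * (Q * R) * Q               ≡⟨ *-comm (Q * (Q * R)) Q ⟩
      Q * (Q * (Q * R))             ≤⟨ bonferroni-upper d d≤ℓ′ ⟩
      P * Q + s * (Q * (Q * R))     ≡⟨ ring P s Q R ⟩
      (P + s * (Q * R)) * Q ∎)
      where
      open ≤-Reasoning
      R = Q ^ e
      ring : ∀ P s Q R → P * Q + s * (Q * (Q * R)) ≡ (P + s * (Q * R)) * Q
      ring = solve-∀

  -- The two bounds are known here only through subtraction-free equations, so truncated subtraction
  -- stays out of the comparisons.
  module Values (h₁ h₂ : ℕ) (h₁-eq : h₁ + (P + q ^ d) ≡ Q ^ d + q ^ (t + d))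
    (h₂-eq : h₂ + Q ^ e * (q * θ q (suc t)) ≡ Q ^ suc e * θ q (suc (suc t))) where

    private
      q^d<q^n : q ^ d < q ^ (t + d)
      q^d<q^n = ^-monoʳ-< q 1<q (m<n+m d 1≤t)

      -- The first two terms of s = q θ_d cover `Small`; the third, y = q^e, is available because 1
      -- ≤ t ≤ e, and it pays for the second-order error s^2 ≤ y Q. Strictness comes from q^d < q^n.
      small<h₁ : t ≤ e → ∀ {c} → Small c → c < h₁
      small<h₁ t≤e {c} sm = +-cancelʳ-< (P + q ^ d) c h₁ (begin-strict
        c + (P + q ^ d)           ≡⟨ sym (+-assoc c P _) ⟩
        c + P + q ^ d             ≤⟨ +-monoˡ-≤ (q ^ d) (≤-trans (+-monoˡ-≤ P sm) main) ⟩
        Q ^ d + q ^ d             <⟨ +-monoʳ-< (Q ^ d) q^d<q^n ⟩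
        Q ^ d + q ^ (t + d)       ≡⟨ sym h₁-eq ⟩
        h₁ + (P + q ^ d) ∎)
        where
        open ≤-Reasoning
        L : ℕ
        L = (q ^ d + q ^ suc e) * Q ^ suc e
        s≥ : q ^ d + q ^ suc e + y ≤ s
        s≥ = ≤-trans (+-monoʳ-≤ (q ^ d + q ^ suc e) (≤-trans (≤-reflexive (y≡ (≤-trans 1≤t t≤e))) (*-monoʳ-≤ q (pow≤θ (≤-trans 1≤t t≤e)))))
               (≤-reflexive (ring q (q ^ suc e) y (θ q e)))
          where
          ring : ∀ q a b c → q * a + q * b + q * c ≡ q * (a + (b + c))
          ring = solve-∀
          y≡ : ∀ {e} → 1 ≤ e → q ^ e ≡ q * q ^ pred e
          y≡ {suc e} _ = refl
          pow≤θ : ∀ {e} → 1 ≤ e → q ^ pred e ≤ θ q e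
          pow≤θ {suc e} _ = m≤m+n _ _
        s²≤ : s * s ≤ y * Q
        s²≤ = ≤-trans (*-mono-≤ s≤ s≤) (≤-trans (≤-reflexive (ring₁ q y)) (≤-trans (*-monoʳ-≤ (y * (q * (q * (q * (q * y))))) (*-mono-≤ (≤-trans 1<q q≤x) (≤-trans 1<q q≤x)))
                (≤-trans (≤-reflexive (ring₂ q y x)) (*-monoʳ-≤ y Q≥₄))))
          where
          s≤ : s ≤ q * (2 * (q * y))
          s≤ = *-monoʳ-≤ q (θ≤2q^ (suc e))
          ring₁ : ∀ q y → q * (2 * (q * y)) * (q * (2 * (q * y))) ≡ y * (q * (q * (q * (q * y)))) * 4
          ring₁ = solve-∀
          ring₂ : ∀ q y x → y * (q * (q * (q * (q * y)))) * (x * x) ≡ y * (q * (q * (q * (q * (y * (x * x))))))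
          ring₂ = solve-∀
        main : L + P ≤ Q ^ d
        main = +-cancelʳ-≤ (y * Q * Q ^ e) _ _ (begin
          L + P + y * Q * Q ^ e                         ≡⟨ ring (q ^ d + q ^ suc e) Q (Q ^ e) P y ⟩
          P + (q ^ d + q ^ suc e + y) * Q ^ suc e       ≤⟨ +-monoʳ-≤ P (*-monoˡ-≤ (Q ^ suc e) s≥) ⟩
          P + s * Q ^ suc e                             ≤⟨ lower ⟩
          Q ^ d + s * s * Q ^ e                         ≤⟨ +-monoʳ-≤ (Q ^ d) (*-monoˡ-≤ (Q ^ e) s²≤) ⟩
          Q ^ d + y * Q * Q ^ e ∎)
          where
          ring : ∀ a Q z P y → a * (Q * z) + P + y * Q * z ≡ P + (a + y) * (Q * z)
          ring = solve-∀

      2qx<Q : q * (2 * x) < Q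
      2qx<Q = begin-strict
        q * (2 * x)                                 <⟨ *-monoʳ-< q (*-monoˡ-< x 2<qq) ⟩
        q * (q * q * x)                             ≤⟨ *-monoʳ-≤ q (m≤m*n (q * q * x) (q * (y * x))) ⟩
        q * (q * q * x * (q * (y * x)))             ≡⟨ ring q y x ⟩
        q * (q * (q * (q * (y * (x * x)))))         ≤⟨ Q≥₄ ⟩
        Q ∎
        where
        open ≤-Reasoning
        instance
          x≢0 : NonZero x
          x≢0 = m^n≢0 q t
          qyx≢0 : NonZero (q * (y * x))
          qyx≢0 = m*n≢0 q (y * x) ⦃ q≢0 ⦄ ⦃ m*n≢0 y x ⦃ m^n≢0 q e ⦄ ⦄
        2<qq : 2 < q * q
        2<qq = ≤-trans (n≤1+n 3) (*-mono-≤ 1<q 1<q)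
        ring : ∀ q y x → q * (q * q * x * (q * (y * x))) ≡ q * (q * (q * (q * (y * (x * x)))))
        ring = solve-∀

      -- The correction subtracted in `h₂` is Q^e times this number, so it costs less than one unit
      -- in the coefficient of Q^(e+1).
      qθ<Q : q * θ q (suc t) < Q
      qθ<Q = ≤-<-trans (*-monoʳ-≤ q (θ≤2q^ t)) 2qx<Q

      small<h₂ : d ≤ suc t → ∀ {c} → Small c → c < h₂
      small<h₂ d≤ {c} sm = +-cancelʳ-< (Q ^ e * (q * θ q (suc t))) c h₂ (begin-strict
        c + Q ^ e * (q * θ q (suc t))                                    ≤⟨ +-monoˡ-≤ _ sm ⟩
        (q ^ d + q ^ suc e) * Q ^ suc e + Q ^ e * (q * θ q (suc t))      ≤⟨ +-monoˡ-≤ _ (*-monoˡ-≤ (Q ^ suc e) (+-mono-≤ (^-monoʳ-≤ q d≤) (^-monoʳ-≤ q (≤-pred d≤)))) ⟩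
        (q ^ suc t + x) * Q ^ suc e + Q ^ e * (q * θ q (suc t))          <⟨ +-monoʳ-< ((q ^ suc t + x) * Q ^ suc e) (*-monoʳ-< (Q ^ e) ⦃ m^n≢0 Q e ⦄ qθ<Q) ⟩
        (q ^ suc t + x) * Q ^ suc e + Q ^ e * Q                          ≡⟨ ring₁ (q ^ suc t + x) Q (Q ^ e) ⟩
        Q ^ suc e * (q ^ suc t + x + 1)                                  ≤⟨ *-monoʳ-≤ (Q ^ suc e) (+-monoʳ-≤ (q ^ suc t + x) (θ-mono 1≤t)) ⟩
        Q ^ suc e * (q ^ suc t + x + θ q t)                              ≡⟨ cong (Q ^ suc e *_) (+-assoc (q ^ suc t) x (θ q t)) ⟩
        Q ^ suc e * θ q (suc (suc t))                                    ≡⟨ sym h₂-eq ⟩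
        h₂ + Q ^ e * (q * θ q (suc t)) ∎)
        where
        open ≤-Reasoning
        ring₁ : ∀ a Q z → a * (Q * z) + z * Q ≡ Q * z * (a + 1)
        ring₁ = solve-∀

    -- Here q^(t+1) is the number of hyperplanes of a (t+2)-space that avoid a given point, and
    -- Q^(e+1) bounds the degree of each.
    Small₂ : ℕ → Set
    Small₂ c = c ≤ q ^ suc t * Q ^ suc e

    -- As t + 2 ≤ d, the coefficients q^(t+1) and θ_{t+2} are at most q^d, so the other two
    -- alternatives reduce to `Small`.
    beats₁ : t ≤ e → ∀ {c} → Small c ⊎ Small₂ c ⊎ c ≤ h₂ → c < h₁
    beats₁ t≤e (inj₁ sm) = small<h₁ t≤e sm
    beats₁ t≤e (inj₂ (inj₁ sm)) = small<h₁ t≤e (≤-trans sm (*-monoˡ-≤ (Q ^ suc e)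
      (≤-trans (^-monoʳ-≤ q (s≤s (≤-trans t≤e (n≤1+n e)))) (m≤m+n (q ^ d) (q ^ suc e)))))
    beats₁ t≤e {c} (inj₂ (inj₂ c≤h₂)) = small<h₁ t≤e (begin
      c                                         ≤⟨ c≤h₂ ⟩
      h₂                                        ≤⟨ m≤m+n h₂ _ ⟩
      h₂ + Q ^ e * (q * θ q (suc t))            ≡⟨ h₂-eq ⟩
      Q ^ suc e * θ q (suc (suc t))             ≤⟨ *-monoʳ-≤ (Q ^ suc e) (≤-trans (θ-mono (s≤s (s≤s t≤e))) (θ≤q^ d)) ⟩
      Q ^ suc e * q ^ d                         ≡⟨ *-comm (Q ^ suc e) (q ^ d) ⟩
      q ^ d * Q ^ suc e                         ≤⟨ *-monoˡ-≤ (Q ^ suc e) (m≤m+n (q ^ d) (q ^ suc e)) ⟩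
      (q ^ d + q ^ suc e) * Q ^ suc e ∎)
      where open ≤-Reasoning

    -- For the last alternative the first-order bound gives h₁ ≤ s Q^(e+1) + q^n. This q^n and the
    -- correction in `h₂` together stay below one Q^(e+1), and s + 1 = θ_{d+1} ≤ θ_{t+2}.
    beats₂ : d ≤ suc t → ∀ {c} → Small c ⊎ Small₂ c ⊎ c ≤ h₁ → c < h₂
    beats₂ d≤ (inj₁ sm) = small<h₂ d≤ sm
    beats₂ d≤ {c} (inj₂ (inj₁ sm)) = +-cancelʳ-< (Q ^ e * (q * θ q (suc t))) c h₂ (begin-strict
      c + Q ^ e * (q * θ q (suc t))                         ≤⟨ +-monoˡ-≤ _ sm ⟩
      q ^ suc t * Q ^ suc e + Q ^ e * (q * θ q (suc t))     <⟨ +-monoʳ-< (q ^ suc t * Q ^ suc e) (*-monoʳ-< (Q ^ e) ⦃ m^n≢0 Q e ⦄ qθ<Q) ⟩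
      q ^ suc t * Q ^ suc e + Q ^ e * Q                     ≡⟨ ring₁ (q ^ suc t) Q (Q ^ e) ⟩
      Q ^ suc e * (q ^ suc t + 1)                           ≤⟨ *-monoʳ-≤ (Q ^ suc e) (+-monoʳ-≤ (q ^ suc t) (θ-mono {1} {suc t} (s≤s z≤n))) ⟩
      Q ^ suc e * θ q (suc (suc t))                         ≡⟨ sym h₂-eq ⟩
      h₂ + Q ^ e * (q * θ q (suc t)) ∎)
      where
      open ≤-Reasoning
      ring₁ : ∀ a Q z → a * (Q * z) + z * Q ≡ Q * z * (a + 1)
      ring₁ = solve-∀
    beats₂ d≤ {c} (inj₂ (inj₂ c≤h₁)) = +-cancelʳ-< (Q ^ e * (q * θ q (suc t))) c h₂ (begin-strict
      c + Q ^ e * (q * θ q (suc t))                             ≤⟨ +-mono-≤ (≤-trans c≤h₁ h₁≤) (*-monoʳ-≤ (Q ^ e) (*-monoʳ-≤ q (θ≤2q^ t))) ⟩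
      s * Q ^ suc e + q ^ (t + d) + Q ^ e * (q * (2 * x))       ≤⟨ +-monoˡ-≤ _ (+-monoʳ-≤ (s * Q ^ suc e) (≤-trans (≤-reflexive (trans (^-distribˡ-+-* q t d) (sym (*-identityʳ _)))) (*-monoʳ-≤ (x * q ^ d) (m^n>0 Q e)))) ⟩
      s * Q ^ suc e + x * q ^ d * Q ^ e + Q ^ e * (q * (2 * x)) ≡⟨ ring₁ (s * Q ^ suc e) x q y (Q ^ e) ⟩
      s * Q ^ suc e + Q ^ e * (q * x * (q * y + 2))             <⟨ +-monoʳ-< (s * Q ^ suc e) (*-monoʳ-< (Q ^ e) ⦃ m^n≢0 Q e ⦄ tail<Q) ⟩
      s * Q ^ suc e + Q ^ e * Q                                 ≡⟨ ring₂ s Q (Q ^ e) ⟩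
      Q ^ suc e * suc s                                         ≡⟨ cong (Q ^ suc e *_) (sym (θ-suc d)) ⟩
      Q ^ suc e * θ q (suc d)                                   ≤⟨ *-monoʳ-≤ (Q ^ suc e) (θ-mono (s≤s d≤)) ⟩
      Q ^ suc e * θ q (suc (suc t))                             ≡⟨ sym h₂-eq ⟩
      h₂ + Q ^ e * (q * θ q (suc t)) ∎)
      where
      open ≤-Reasoning
      ring₁ : ∀ a x q y z → a + x * (q * (q * y)) * z + z * (q * (2 * x)) ≡ a + z * (q * x * (q * y + 2))
      ring₁ = solve-∀
      ring₂ : ∀ s Q z → s * (Q * z) + z * Q ≡ Q * z * suc s
      ring₂ = solve-∀
      h₁≤ : h₁ ≤ s * Q ^ suc e + q ^ (t + d)
      h₁≤ = +-cancelʳ-≤ P _ _ (begin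
        h₁ + P                                    ≤⟨ m≤m+n _ (q ^ d) ⟩
        h₁ + P + q ^ d                            ≡⟨ +-assoc h₁ P _ ⟩
        h₁ + (P + q ^ d)                          ≡⟨ h₁-eq ⟩
        Q ^ d + q ^ (t + d)                       ≤⟨ +-monoˡ-≤ (q ^ (t + d)) upper ⟩
        P + s * Q ^ suc e + q ^ (t + d)           ≡⟨ ring P (s * Q ^ suc e) (q ^ (t + d)) ⟩
        s * Q ^ suc e + q ^ (t + d) + P ∎)
        where
        ring : ∀ a b c → a + b + c ≡ b + c + a
        ring = solve-∀
      tail<Q : q * x * (q * y + 2) < Q
      tail<Q = begin-strict
        q * x * (q * y + 2)                             ≤⟨ *-monoʳ-≤ (q * x) (+-monoʳ-≤ (q * y) (≤-trans 1<q (≤-trans (≤-reflexive (sym (*-identityʳ q))) (*-monoʳ-≤ q (1≤q^ e))))) ⟩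
        q * x * (q * y + q * y)                         ≡⟨ ring₃ q x y ⟩
        q * (x * y) * (2 * q)                           ≤⟨ *-monoʳ-≤ (q * (x * y)) (*-monoˡ-≤ q 1<q) ⟩
        q * (x * y) * (q * q)                           <⟨ *-monoʳ-< (q * (x * y)) ⦃ m*n≢0 q (x * y) ⦃ q≢0 ⦄ ⦃ m*n≢0 x y ⦃ m^n≢0 q t ⦄ ⦃ m^n≢0 q e ⦄ ⦄ ⦄
                                                             (≤-trans (m<m+n (q * q) (*-mono-≤ (≤-trans (n≤1+n 1) 1<q) (≤-trans (n≤1+n 1) 1<q))) (≤-reflexive (ring₄ (q * q)))) ⟩
        q * (x * y) * (2 * (q * q))                     ≤⟨ *-monoʳ-≤ (q * (x * y)) (*-monoˡ-≤ (q * q) 1<q) ⟩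
        q * (x * y) * (q * (q * q))                     ≤⟨ m≤m*n _ x ⦃ m^n≢0 q t ⦄ ⟩
        q * (x * y) * (q * (q * q)) * x                 ≡⟨ ring₅ q x y ⟩
        q * (q * (q * (q * (y * (x * x)))))             ≤⟨ Q≥₄ ⟩
        Q ∎
        where
        ring₃ : ∀ q x y → q * x * (q * y + q * y) ≡ q * (x * y) * (2 * q)
        ring₃ = solve-∀
        ring₄ : ∀ a → a + a ≡ 2 * a
        ring₄ = solve-∀
        ring₅ : ∀ q x y → q * (x * y) * (q * (q * q)) * x ≡ q * (q * (q * (q * (y * (x * x)))))
        ring₅ = solve-∀

-- Linear algebra by counting

module Vectors (𝔽 : FiniteField) where
  open FiniteField 𝔽 public using (Carrier; 0#; 1#) renaming (size to q)
  open FiniteField 𝔽 using (inverse; 0≢1; enum)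
    renaming (_+_ to _+ꟳ_; _*_ to _*ꟳ_; -_ to -ꟳ_; +-assoc to +ꟳ-assoc; +-comm to +ꟳ-comm;
              +-identityˡ to +ꟳ-identityˡ; -‿inverseˡ to -ꟳ-inverseˡ; *-assoc to *ꟳ-assoc;
              *-comm to *ꟳ-comm; *-identityˡ to *ꟳ-identityˡ; distribˡ to ꟳ-distribˡ)
  open LinAlg {𝔽} public

  scalars : Finite Carrier
  scalars = ↔-finite enum

  open Finite scalars using () renaming (_≟_ to _≟ꟳ_)

  ꟳ-distribʳ : ∀ x y z → (y +ꟳ z) *ꟳ x ≡ y *ꟳ x +ꟳ z *ꟳ x
  ꟳ-distribʳ x y z = trans (*ꟳ-comm _ x) (trans (ꟳ-distribˡ x y z) (cong₂ _+ꟳ_ (*ꟳ-comm x y) (*ꟳ-comm x z)))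

  ꟳ-zeroˡ : ∀ x → 0# *ꟳ x ≡ 0#
  ꟳ-zeroˡ x = idem (trans (sym (ꟳ-distribʳ x 0# 0#)) (cong (_*ꟳ x) (+ꟳ-identityˡ 0#)))
    where
    idem : ∀ {y} → y +ꟳ y ≡ y → y ≡ 0#
    idem {y} e = trans (sym (+ꟳ-identityˡ y)) (trans (cong (_+ꟳ y) (sym (-ꟳ-inverseˡ y)))
      (trans (+ꟳ-assoc _ y y) (trans (cong (-ꟳ y +ꟳ_) e) (-ꟳ-inverseˡ y))))

  -1*x+x : ∀ x → (-ꟳ 1#) *ꟳ x +ꟳ x ≡ 0#
  -1*x+x x = trans (cong ((-ꟳ 1#) *ꟳ x +ꟳ_) (sym (*ꟳ-identityˡ x)))
    (trans (sym (ꟳ-distribʳ x (-ꟳ 1#) 1#)) (trans (cong (_*ꟳ x) (-ꟳ-inverseˡ 1#)) (ꟳ-zeroˡ x)))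

  1<q : 1 < q
  1<q = distinct (from 0#) (from 1#) λ e → 0≢1 (trans (sym (strictlyInverseˡ 0#)) (trans (cong to e) (strictlyInverseˡ 1#)))
    where
    open Inverse enum
    distinct : ∀ {s} (i j : Fin s) → i ≢ j → 1 < s
    distinct {suc zero} Fin.zero Fin.zero i≢j = ⊥-elim (i≢j refl)
    distinct {suc (suc s)} _ _ _ = s≤s (s≤s z≤n)

  open Arith q 1<q public

  private variable N m : ℕ

  ⊕-assoc : (u v w : Vect N) → (u ⊕ v) ⊕ w ≡ u ⊕ (v ⊕ w)
  ⊕-assoc = Vec.zipWith-assoc +ꟳ-assoc

  ⊕-comm : (u v : Vect N) → u ⊕ v ≡ v ⊕ u
  ⊕-comm = Vec.zipWith-comm +ꟳ-comm

  ⊕-identityˡ : (v : Vect N) → 𝟎 ⊕ v ≡ v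
  ⊕-identityˡ = Vec.zipWith-identityˡ +ꟳ-identityˡ

  ⊕-identityʳ : (v : Vect N) → v ⊕ 𝟎 ≡ v
  ⊕-identityʳ v = trans (⊕-comm v 𝟎) (⊕-identityˡ v)

  ·-distribˡ : ∀ c (u v : Vect N) → c · (u ⊕ v) ≡ (c · u) ⊕ (c · v)
  ·-distribˡ c [] [] = refl
  ·-distribˡ c (x ∷ u) (y ∷ v) = cong₂ _∷_ (ꟳ-distribˡ c x y) (·-distribˡ c u v)

  ·-distribʳ : ∀ c d (v : Vect N) → (c +ꟳ d) · v ≡ (c · v) ⊕ (d · v)
  ·-distribʳ c d [] = refl
  ·-distribʳ c d (x ∷ v) = cong₂ _∷_ (ꟳ-distribʳ x c d) (·-distribʳ c d v)

  ·-assoc : ∀ c d (v : Vect N) → (c *ꟳ d) · v ≡ c · (d · v)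
  ·-assoc c d [] = refl
  ·-assoc c d (x ∷ v) = cong₂ _∷_ (*ꟳ-assoc c d x) (·-assoc c d v)

  ·-identity : (v : Vect N) → 1# · v ≡ v
  ·-identity [] = refl
  ·-identity (x ∷ v) = cong₂ _∷_ (*ꟳ-identityˡ x) (·-identity v)

  ·-zeroˡ : (v : Vect N) → 0# · v ≡ 𝟎
  ·-zeroˡ [] = refl
  ·-zeroˡ (x ∷ v) = cong₂ _∷_ (ꟳ-zeroˡ x) (·-zeroˡ v)

  ·-zeroʳ : ∀ c → c · 𝟎 {N} ≡ 𝟎
  ·-zeroʳ {zero} c = refl
  ·-zeroʳ {suc N} c = cong₂ _∷_ (trans (*ꟳ-comm c 0#) (ꟳ-zeroˡ c)) (·-zeroʳ c)

  ⊖_ : Vect N → Vect N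
  ⊖ v = (-ꟳ 1#) · v

  ⊖-inverseˡ : (v : Vect N) → (⊖ v) ⊕ v ≡ 𝟎
  ⊖-inverseˡ [] = refl
  ⊖-inverseˡ (x ∷ v) = cong₂ _∷_ (-1*x+x x) (⊖-inverseˡ v)

  ⊖-inverseʳ : (v : Vect N) → v ⊕ (⊖ v) ≡ 𝟎
  ⊖-inverseʳ v = trans (⊕-comm v _) (⊖-inverseˡ v)

  ⊖-cancelˡ : (u v : Vect N) → (⊖ u) ⊕ (u ⊕ v) ≡ v
  ⊖-cancelˡ u v = trans (sym (⊕-assoc _ u v)) (trans (cong (_⊕ v) (⊖-inverseˡ u)) (⊕-identityˡ v))

  ⊕-cancelˡ : (u v : Vect N) → u ⊕ ((⊖ u) ⊕ v) ≡ v
  ⊕-cancelˡ u v = trans (sym (⊕-assoc u _ v)) (trans (cong (_⊕ v) (⊖-inverseʳ u)) (⊕-identityˡ v))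

  ⊕-swap : (a b c d : Vect N) → (a ⊕ b) ⊕ (c ⊕ d) ≡ (a ⊕ c) ⊕ (b ⊕ d)
  ⊕-swap a b c d = trans (⊕-assoc a b _) (trans (cong (a ⊕_) (trans (sym (⊕-assoc b c d))
    (trans (cong (_⊕ d) (⊕-comm b c)) (⊕-assoc c b d)))) (sym (⊕-assoc a c _)))

  lincomb-zero : (bs : Vec (Vect N) m) → lincomb (replicate m 0#) bs ≡ 𝟎
  lincomb-zero [] = refl
  lincomb-zero (b ∷ bs) = trans (cong₂ _⊕_ (·-zeroˡ b) (lincomb-zero bs)) (⊕-identityˡ 𝟎)

  lincomb-⊕ : (cs ds : Vec Carrier m) (bs : Vec (Vect N) m) → lincomb (cs ⊕ ds) bs ≡ lincomb cs bs ⊕ lincomb ds bs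
  lincomb-⊕ [] [] [] = sym (⊕-identityˡ 𝟎)
  lincomb-⊕ (c ∷ cs) (d ∷ ds) (b ∷ bs) =
    trans (cong₂ _⊕_ (·-distribʳ c d b) (lincomb-⊕ cs ds bs)) (⊕-swap (c · b) (d · b) _ _)

  lincomb-· : ∀ k (cs : Vec Carrier m) (bs : Vec (Vect N) m) → lincomb (k · cs) bs ≡ k · lincomb cs bs
  lincomb-· k [] [] = sym (·-zeroʳ k)
  lincomb-· k (c ∷ cs) (b ∷ bs) =
    trans (cong₂ _⊕_ (·-assoc k c b) (lincomb-· k cs bs)) (sym (·-distribˡ k (c · b) _))

  module _ (P : Subspace N) where

    ∋-⊖ : ∀ {v} → P ∋ v → P ∋ (⊖ v)
    ∋-⊖ = ∋-· P (-ꟳ 1#)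

    ∋-cancelˡ : ∀ {u v} → P ∋ u → P ∋ (u ⊕ v) → P ∋ v
    ∋-cancelˡ {u} {v} pu puv = subst (P ∋_) (⊖-cancelˡ u v) (∋-⊕ P (∋-⊖ pu) puv)

    ∋-cancelʳ : ∀ {u v} → P ∋ v → P ∋ (u ⊕ v) → P ∋ u
    ∋-cancelʳ {u} {v} pv puv = ∋-cancelˡ pv (subst (P ∋_) (⊕-comm u v) puv)

    ∋-unscale : ∀ {c v} → c ≢ 0# → P ∋ (c · v) → P ∋ v
    ∋-unscale {c} {v} c≢0 pcv with inverse c c≢0
    ... | c⁻¹ , e = subst (P ∋_) (trans (sym (·-assoc c⁻¹ c v)) (trans (cong (_· v) e) (·-identity v))) (∋-· P c⁻¹ pcv)

    ∋-lincomb : (cs : Vec Carrier m) {bs : Vec (Vect N) m} → VAll.All (P ∋_) bs → P ∋ lincomb cs bs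
    ∋-lincomb [] [] = ∋-𝟎 P
    ∋-lincomb (c ∷ cs) (pb ∷ pbs) = ∋-⊕ P (∋-· P c pb) (∋-lincomb cs pbs)

  LinIndep-injective : {bs : Vec (Vect N) m} → LinIndep bs → ∀ cs ds → lincomb cs bs ≡ lincomb ds bs → cs ≡ ds
  LinIndep-injective {bs = bs} ind cs ds e = begin
    cs                     ≡⟨ sym (⊕-identityʳ cs) ⟩
    cs ⊕ 𝟎                 ≡⟨ cong (cs ⊕_) (sym (⊖-inverseˡ ds)) ⟩
    cs ⊕ ((⊖ ds) ⊕ ds)     ≡⟨ sym (⊕-assoc cs (⊖ ds) ds) ⟩
    (cs ⊕ (⊖ ds)) ⊕ ds     ≡⟨ cong (_⊕ ds) (ind (cs ⊕ (⊖ ds)) vanish) ⟩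
    𝟎 ⊕ ds                 ≡⟨ ⊕-identityˡ ds ⟩
    ds ∎
    where
    open ≡-Reasoning
    vanish : lincomb (cs ⊕ (⊖ ds)) bs ≡ 𝟎
    vanish = trans (lincomb-⊕ cs (⊖ ds) bs) (trans (cong₂ _⊕_ e (lincomb-· _ ds bs)) (⊖-inverseʳ (lincomb ds bs)))

  spanOf : Vec (Vect N) m → Subspace N
  spanOf bs = record
    { _∋_ = λ v → ∃ λ cs → lincomb cs bs ≡ v
    ; ∋-𝟎 = replicate _ 0# , lincomb-zero bs
    ; ∋-⊕ = λ { (cs , refl) (ds , refl) → cs ⊕ ds , lincomb-⊕ cs ds bs }
    ; ∋-· = λ { k (cs , refl) → k · cs , lincomb-· k cs bs }
    }

  spanOf-generators : (bs : Vec (Vect N) m) → VAll.All (spanOf bs ∋_) bs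
  spanOf-generators [] = []
  spanOf-generators (b ∷ bs) =
    (1# ∷ replicate _ 0# , trans (cong₂ _⊕_ (·-identity b) (lincomb-zero bs)) (⊕-identityʳ b))
    ∷ VAll.map (λ { (cs , refl) → 0# ∷ cs , trans (cong (_⊕ _) (·-zeroˡ b)) (⊕-identityˡ _) }) (spanOf-generators bs)

  LinIndep-∷ : {v : Vect N} {bs : Vec (Vect N) m} → LinIndep bs → ¬ (spanOf bs ∋ v) → LinIndep (v ∷ bs)
  LinIndep-∷ {v = v} {bs} ind v∉ (c ∷ cs) e with c ≟ꟳ 0#
  ... | yes refl = cong (0# ∷_) (ind cs (trans (sym (trans (cong (_⊕ _) (·-zeroˡ v)) (⊕-identityˡ _))) e))
  ... | no c≢0 = ⊥-elim (v∉ (∋-unscale (spanOf bs) c≢0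
                   (∋-cancelʳ (spanOf bs) (cs , refl) (subst (spanOf bs ∋_) (sym e) (∋-𝟎 (spanOf bs))))))

  -- Decidable subspaces and their cardinalities.

  module Decidable (N : ℕ) where

    vectors : Finite (Vect N)
    vectors = Vec-finite scalars N

    open Finite vectors public using (∃?; ∀?) renaming (elems to 𝕍; _≟_ to _≟ᵥ_)

    length-scalars : length (Finite.elems scalars) ≡ q
    length-scalars = trans (List.length-map _ (List.allFin q)) (List.length-tabulate _)

    private variable
      p r : Level
      P : Vect N → Set p
      R : Vect N → Set r

    # : (∀ v → Dec (P v)) → ℕ
    # P? = ∑[ v ← 𝕍 ] ⟦ P? v ⟧

    #-mono : (P? : ∀ v → Dec (P v)) (R? : ∀ v → Dec (R v)) → (∀ v → P v → R v) → # P? ≤ # R?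
    #-mono P? R? h = ∑-mono 𝕍 (λ v → ⟦⟧-mono (P? v) (R? v) (h v))

    #-cong : (P? : ∀ v → Dec (P v)) (R? : ∀ v → Dec (R v)) → (∀ v → P v → R v) → (∀ v → R v → P v) → # P? ≡ # R?
    #-cong P? R? h h′ = ≤-antisym (#-mono P? R? h) (#-mono R? P? h′)

    #-split : (P? : ∀ v → Dec (P v)) (R? : ∀ v → Dec (R v)) →
              # P? ≡ # (λ v → P? v ×-dec R? v) + # (λ v → P? v ×-dec ¬? (R? v))
    #-split P? R? = trans (∑-cong 𝕍 (λ v → ⟦⟧-split (P? v) (R? v))) (∑-+ 𝕍 _ _)

    #-shift : (P? : ∀ v → Dec (P v)) (a : Vect N) → # (λ v → P? (a ⊕ v)) ≡ # P?
    #-shift P? a = ∑-reindex vectors (a ⊕_) ((⊖ a) ⊕_) (⊖-cancelˡ a) (⊕-cancelˡ a) (λ v → ⟦ P? v ⟧)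

    record DS : Set₁ where
      constructor _since_
      field
        sub : Subspace N
        dec : ∀ v → Dec (sub ∋ v)
    open DS public

    infix 4 _∈ₛ_ _⊑_ _⊑?_ _≈_ _≈?_
    infixl 7 _⊓_
    infixl 6 _⊞_

    _∈ₛ_ : Vect N → DS → Set
    v ∈ₛ A = sub A ∋ v

    _⊑_ : DS → DS → Set
    A ⊑ B = sub A ⊆S sub B

    _≈_ : DS → DS → Set
    A ≈ B = sub A ≐ sub B

    _⊑?_ : ∀ A B → Dec (A ⊑ B)
    A ⊑? B = ∀? λ v → implies (dec A v) (dec B v)
      where
      implies : ∀ {p r} {P : Set p} {R : Set r} → Dec P → Dec R → Dec (P → R)
      implies (no ¬x) _ = yes λ x → ⊥-elim (¬x x)
      implies (yes x) (yes y) = yes λ _ → y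
      implies (yes x) (no ¬y) = no λ f → ¬y (f x)

    _≈?_ : ∀ A B → Dec (A ≈ B)
    A ≈? B = (A ⊑? B) ×-dec (B ⊑? A)

    ⊑-trans : ∀ {A B C} → A ⊑ B → B ⊑ C → A ⊑ C
    ⊑-trans AB BC v v∈ = BC v (AB v v∈)

    ≈-refl : ∀ {A} → A ≈ A
    ≈-refl = (λ _ x → x) , (λ _ x → x)

    ≈-sym : ∀ {A B} → A ≈ B → B ≈ A
    ≈-sym (l , r) = r , l

    ≈-trans : ∀ {A B C} → A ≈ B → B ≈ C → A ≈ C
    ≈-trans (l , r) (l′ , r′) = (λ v x → l′ v (l v x)) , (λ v x → r v (r′ v x))

    escape : ∀ {A B} → ¬ (A ⊑ B) → ∃ λ v → v ∈ₛ A × ¬ (v ∈ₛ B)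
    escape {A} {B} A⋢B with ∃? (λ v → dec A v ×-dec ¬? (dec B v))
    ... | yes w = w
    ... | no none = ⊥-elim (A⋢B λ v v∈ → inside v v∈ (dec B v))
      where
      inside : ∀ v → v ∈ₛ A → Dec (v ∈ₛ B) → v ∈ₛ B
      inside v v∈ (yes y) = y
      inside v v∈ (no ¬y) = ⊥-elim (none (v , v∈ , ¬y))

    ∣_∣ : DS → ℕ
    ∣ A ∣ = # (dec A)

    card-mono : ∀ {A B} → A ⊑ B → ∣ A ∣ ≤ ∣ B ∣
    card-mono {A} {B} = #-mono (dec A) (dec B)

    card-cong : ∀ {A B} → A ⊑ B → B ⊑ A → ∣ A ∣ ≡ ∣ B ∣
    card-cong {A} {B} = #-cong (dec A) (dec B)

    card-tight : ∀ {A B} → A ⊑ B → ∣ B ∣ ≤ ∣ A ∣ → B ⊑ A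
    card-tight {A} {B} AB le v =
      ⟦⟧-≡⇒ (dec B v) (dec A v) (sym (∑-mono-tight 𝕍 (λ u → ⟦⟧-mono (dec A u) (dec B u) (AB u)) le (Finite.complete vectors v)))

    card-strict : ∀ {A B} → A ⊑ B → ¬ (B ⊑ A) → ∣ A ∣ < ∣ B ∣
    card-strict {A} {B} AB ¬BA with suc ∣ A ∣ ≤? ∣ B ∣
    ... | yes lt = lt
    ... | no ¬lt = ⊥-elim (¬BA (card-tight {A} {B} AB (≤-pred (≰⇒> ¬lt))))

    _⊓_ : DS → DS → DS
    A ⊓ B = (sub A ∩ sub B) since (λ v → dec A v ×-dec dec B v)

    _⊞_ : DS → DS → DS
    A ⊞ B = record
      { _∋_ = λ x → ∃ λ a → a ∈ₛ A × ∃ λ b → b ∈ₛ B × a ⊕ b ≡ x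
      ; ∋-𝟎 = 𝟎 , ∋-𝟎 (sub A) , 𝟎 , ∋-𝟎 (sub B) , ⊕-identityˡ 𝟎
      ; ∋-⊕ = λ { (a , a∈ , b , b∈ , refl) (a′ , a′∈ , b′ , b′∈ , refl) →
                  a ⊕ a′ , ∋-⊕ (sub A) a∈ a′∈ , b ⊕ b′ , ∋-⊕ (sub B) b∈ b′∈ , ⊕-swap a a′ b b′ }
      ; ∋-· = λ { k (a , a∈ , b , b∈ , refl) →
                  k · a , ∋-· (sub A) k a∈ , k · b , ∋-· (sub B) k b∈ , sym (·-distribˡ k a b) }
      } since (λ x → ∃? λ a → dec A a ×-dec ∃? λ b → dec B b ×-dec ((a ⊕ b) ≟ᵥ x))

    infixl 6 _⊹_
    -- Encoded with a single scalar, so that for v outside S each x has at most one witness `c` and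
    -- `∑-∃!` counts the extension.
    _⊹_ : DS → Vect N → DS
    S ⊹ v = record
      { _∋_ = λ x → ∃ λ c → (x ⊕ (c · v)) ∈ₛ S
      ; ∋-𝟎 = 0# , subst (_∈ₛ S) (sym (trans (⊕-identityˡ _) (·-zeroˡ v))) (∋-𝟎 (sub S))
      ; ∋-⊕ = λ { {x} {y} (c , x∈) (d , y∈) → (c +ꟳ d) ,
                  subst (_∈ₛ S) (trans (⊕-swap x (c · v) y (d · v)) (cong ((x ⊕ y) ⊕_) (sym (·-distribʳ c d v)))) (∋-⊕ (sub S) x∈ y∈) }
      ; ∋-· = λ { k {x} (c , x∈) → (k *ꟳ c) ,
                  subst (_∈ₛ S) (trans (·-distribˡ k x (c · v)) (cong ((k · x) ⊕_) (sym (·-assoc k c v)))) (∋-· (sub S) k x∈) }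
      } since (λ x → Finite.∃? scalars λ c → dec S (x ⊕ (c · v)))

    zeroS : DS
    zeroS = record
      { _∋_ = λ v → v ≡ 𝟎
      ; ∋-𝟎 = refl
      ; ∋-⊕ = λ { refl refl → ⊕-identityˡ 𝟎 }
      ; ∋-· = λ { k refl → ·-zeroʳ k }
      } since (_≟ᵥ 𝟎)

    wholeS : DS
    wholeS = whole since (λ _ → yes tt)

    span : Vec (Vect N) m → DS
    span {m} bs = spanOf bs since (λ v → Finite.∃? (Vec-finite scalars m) λ cs → lincomb cs bs ≟ᵥ v)

    zeroS-⊑ : ∀ A → zeroS ⊑ A
    zeroS-⊑ A v refl = ∋-𝟎 (sub A)

    ⊞-upperˡ : ∀ A B → A ⊑ A ⊞ B
    ⊞-upperˡ A B a a∈ = a , a∈ , 𝟎 , ∋-𝟎 (sub B) , ⊕-identityʳ a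

    ⊞-upperʳ : ∀ A B → B ⊑ A ⊞ B
    ⊞-upperʳ A B b b∈ = 𝟎 , ∋-𝟎 (sub A) , b , b∈ , ⊕-identityˡ b

    ⊞-least : ∀ {A B C} → A ⊑ C → B ⊑ C → A ⊞ B ⊑ C
    ⊞-least {C = C} AC BC _ (a , a∈ , b , b∈ , refl) = ∋-⊕ (sub C) (AC a a∈) (BC b b∈)

    ⊹-upper : ∀ S v → S ⊑ S ⊹ v
    ⊹-upper S v x x∈ = 0# , subst (_∈ₛ S) (sym (trans (cong (x ⊕_) (·-zeroˡ v)) (⊕-identityʳ x))) x∈

    ⊹-new : ∀ S v → v ∈ₛ S ⊹ v
    ⊹-new S v = -ꟳ 1# , subst (_∈ₛ S) (sym (⊖-inverseʳ v)) (∋-𝟎 (sub S))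

    ⊹-least : ∀ {S v C} → S ⊑ C → v ∈ₛ C → S ⊹ v ⊑ C
    ⊹-least {C = C} SC v∈ x (c , x∈) = ∋-cancelʳ (sub C) (∋-· (sub C) c v∈) (SC _ x∈)

    -- A nonzero coefficient at v would put v itself into `S ⊞ B`. Choosing v outside `S ⊞ B` is
    -- therefore the way to enlarge S without enlarging its intersection with B.
    ⊹-meet : ∀ {S v} B → ¬ (v ∈ₛ S ⊞ B) → ∀ x → x ∈ₛ S ⊹ v → x ∈ₛ B → x ∈ₛ S
    ⊹-meet {S} {v} B v∉ x (c , x∈) x∈B with c ≟ꟳ 0#
    ... | yes refl = subst (_∈ₛ S) (trans (cong (x ⊕_) (·-zeroˡ v)) (⊕-identityʳ x)) x∈
    ... | no c≢0 = ⊥-elim (v∉ (∋-unscale (sub (S ⊞ B)) c≢0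
                     (∋-cancelˡ (sub (S ⊞ B)) (⊞-upperʳ S B x x∈B) (⊞-upperˡ S B _ x∈))))

    card-whole : ∣ wholeS ∣ ≡ q ^ N
    card-whole = trans (∑-const 𝕍 1) (trans (*-identityʳ _) (trans (Vec-finite-length scalars N) (cong (_^ N) length-scalars)))

    card-zero : ∣ zeroS ∣ ≡ 1
    card-zero = Finite.∑-δ vectors 𝟎

    1≤card : ∀ A → 1 ≤ ∣ A ∣
    1≤card A = ≤-trans (≤-reflexive (sym card-zero)) (card-mono {zeroS} {A} (zeroS-⊑ A))

    card≡1⇒zero : ∀ {A} → ∣ A ∣ ≡ 1 → ∀ v → v ∈ₛ A → v ≡ 𝟎
    card≡1⇒zero {A} e = card-tight {zeroS} {A} (zeroS-⊑ A) (≤-reflexive (trans e (sym card-zero)))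

    zero⇒card≡1 : ∀ {A} → (∀ v → v ∈ₛ A → v ≡ 𝟎) → ∣ A ∣ ≡ 1
    zero⇒card≡1 {A} h = trans (card-cong {A} {zeroS} h (zeroS-⊑ A)) card-zero

    card-⊹ : ∀ {S v} → ¬ (v ∈ₛ S) → ∣ S ⊹ v ∣ ≡ q * ∣ S ∣
    card-⊹ {S} {v} v∉ = begin
      ∣ S ⊹ v ∣
        ≡⟨ ∑-cong 𝕍 (λ x → sym (Finite.∑-∃! scalars (λ c → dec S (x ⊕ (c · v))) (unique x))) ⟩
      (∑[ x ← 𝕍 ] ∑[ c ← cs ] ⟦ dec S (x ⊕ (c · v)) ⟧)
        ≡⟨ ∑-swap 𝕍 cs _ ⟩
      (∑[ c ← cs ] ∑[ x ← 𝕍 ] ⟦ dec S (x ⊕ (c · v)) ⟧)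
        ≡⟨ ∑-cong cs (λ c → trans (∑-cong 𝕍 (λ x → cong (λ y → ⟦ dec S y ⟧) (⊕-comm x (c · v)))) (#-shift (dec S) (c · v))) ⟩
      ∑ cs (λ _ → ∣ S ∣)
        ≡⟨ trans (∑-const cs _) (cong (_* ∣ S ∣) length-scalars) ⟩
      q * ∣ S ∣ ∎
      where
      open ≡-Reasoning
      cs = Finite.elems scalars
      unique : ∀ x c d → (x ⊕ (c · v)) ∈ₛ S → (x ⊕ (d · v)) ∈ₛ S → c ≡ d
      unique x c d c∈ d∈ with (c +ꟳ (-ꟳ d)) ≟ꟳ 0#
      ... | yes e = trans (sym (trans (+ꟳ-comm c 0#) (+ꟳ-identityˡ c))) (trans (cong (c +ꟳ_) (sym (-ꟳ-inverseˡ d)))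
                      (trans (sym (+ꟳ-assoc c _ d)) (trans (cong (_+ꟳ d) e) (+ꟳ-identityˡ d))))
      ... | no ne = ⊥-elim (v∉ (∋-unscale (sub S) ne (∋-cancelˡ (sub S) d∈ (subst (_∈ₛ S) (sym eq) c∈))))
        where
        eq : (x ⊕ (d · v)) ⊕ ((c +ꟳ (-ꟳ d)) · v) ≡ x ⊕ (c · v)
        eq = trans (⊕-assoc x _ _) (cong (x ⊕_) (trans (sym (·-distribʳ d _ v)) (cong (_· v)
          (trans (cong (d +ꟳ_) (+ꟳ-comm c _)) (trans (sym (+ꟳ-assoc d _ c))
            (trans (cong (_+ꟳ c) (trans (+ꟳ-comm d _) (-ꟳ-inverseˡ d))) (+ꟳ-identityˡ c)))))))

    -- Count pairs (a , x) with a ∈ A and x - a ∈ B. Each a occurs ∣ B ∣ times; each x in the sum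
    -- occurs ∣ A ⊓ B ∣ times, since all its representations arise from one of them by a shift in A
    -- ⊓ B.
    card-⊞ : ∀ A B → ∣ A ⊞ B ∣ * ∣ A ⊓ B ∣ ≡ ∣ A ∣ * ∣ B ∣
    card-⊞ A B = begin
      ∣ A ⊞ B ∣ * ∣ A ⊓ B ∣
        ≡⟨ sym (∑-*ʳ 𝕍 _ _) ⟩
      (∑[ x ← 𝕍 ] ⟦ dec (A ⊞ B) x ⟧ * ∣ A ⊓ B ∣)
        ≡⟨ ∑-cong 𝕍 representations ⟩
      (∑[ x ← 𝕍 ] ∑[ a ← 𝕍 ] ⟦ dec A a ×-dec dec B ((⊖ a) ⊕ x) ⟧)
        ≡⟨ ∑-swap 𝕍 𝕍 _ ⟩
      (∑[ a ← 𝕍 ] ∑[ x ← 𝕍 ] ⟦ dec A a ×-dec dec B ((⊖ a) ⊕ x) ⟧)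
        ≡⟨ ∑-cong 𝕍 (λ a → trans (∑-cong 𝕍 (λ x → ⟦⟧-× (dec A a) (dec B _))) (trans (∑-*ˡ 𝕍 ⟦ dec A a ⟧ _)
             (cong (⟦ dec A a ⟧ *_) (#-shift (dec B) (⊖ a))))) ⟩
      (∑[ a ← 𝕍 ] ⟦ dec A a ⟧ * ∣ B ∣)
        ≡⟨ ∑-*ʳ 𝕍 _ _ ⟩
      ∣ A ∣ * ∣ B ∣ ∎
      where
      open ≡-Reasoning
      representations : ∀ x → ⟦ dec (A ⊞ B) x ⟧ * ∣ A ⊓ B ∣ ≡ (∑[ a ← 𝕍 ] ⟦ dec A a ×-dec dec B ((⊖ a) ⊕ x) ⟧)
      representations x with dec (A ⊞ B) x
      ... | no x∉ = sym (∑-zero 𝕍 (λ a → ⟦⟧-no (dec A a ×-dec dec B _)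
                      (λ { (a∈ , b∈) → x∉ (a , a∈ , (⊖ a) ⊕ x , b∈ , ⊕-cancelˡ a x) })))
      ... | yes (a₀ , a₀∈ , b₀ , b₀∈ , refl) = trans (*-identityˡ _) (trans
              (#-cong (dec (A ⊓ B)) (λ c → dec A (a₀ ⊕ c) ×-dec dec B ((⊖ (a₀ ⊕ c)) ⊕ (a₀ ⊕ b₀)))
                (λ { c (c∈A , c∈B) → ∋-⊕ (sub A) a₀∈ c∈A , subst (_∈ₛ B) (sym (eq c)) (∋-⊕ (sub B) (∋-⊖ (sub B) c∈B) b₀∈) })
                (λ { c (c∈A , c∈B) → ∋-cancelˡ (sub A) a₀∈ c∈A ,
                       subst (_∈ₛ B) (⊖⊖ c) (∋-⊖ (sub B) (∋-cancelʳ (sub B) b₀∈ (subst (_∈ₛ B) (eq c) c∈B))) }))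
              (#-shift (λ a → dec A a ×-dec dec B ((⊖ a) ⊕ (a₀ ⊕ b₀))) a₀))
        where
        eq : ∀ c → (⊖ (a₀ ⊕ c)) ⊕ (a₀ ⊕ b₀) ≡ (⊖ c) ⊕ b₀
        eq c = trans (cong (_⊕ _) (·-distribˡ _ a₀ c)) (trans (⊕-swap (⊖ a₀) (⊖ c) a₀ b₀)
          (trans (cong (_⊕ _) (⊖-inverseˡ a₀)) (⊕-identityˡ _)))
        ⊖⊖ : ∀ (c : Vect N) → ⊖ (⊖ c) ≡ c
        ⊖⊖ c = trans (sym (⊕-identityʳ _)) (trans (cong ((⊖ (⊖ c)) ⊕_) (sym (⊖-inverseˡ c))) (⊖-cancelˡ (⊖ c) c))

    card-∖ : ∀ A B → # (λ v → dec A v ×-dec ¬? (dec B v)) ≡ ∣ A ∣ ∸ ∣ A ⊓ B ∣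
    card-∖ A B = sym (trans (cong (_∸ ∣ A ⊓ B ∣) (#-split (dec A) (dec B))) (m+n∸m≡n ∣ A ⊓ B ∣ _))

    dim⇒card : ∀ A → HasDim (sub A) m → ∣ A ∣ ≡ q ^ m
    dim⇒card {m} A (bs , bs∈ , ind , spans) = begin
      ∣ A ∣                                          ≡⟨ ∑-cong 𝕍 (λ v → ⟦⟧-cong (dec A v) (dec (span bs) v) (spans v) λ { (cs , refl) → ∋-lincomb (sub A) cs bs∈ }) ⟩
      ∣ span bs ∣                                    ≡⟨ ∑-cong 𝕍 (λ v → sym (Finite.∑-∃! coeffs (λ cs → lincomb cs bs ≟ᵥ v) (λ cs ds e e′ → LinIndep-injective ind cs ds (trans e (sym e′))))) ⟩
      (∑[ v ← 𝕍 ] ∑[ cs ← ℂ ] ⟦ lincomb cs bs ≟ᵥ v ⟧) ≡⟨ ∑-swap 𝕍 ℂ _ ⟩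
      (∑[ cs ← ℂ ] ∑[ v ← 𝕍 ] ⟦ lincomb cs bs ≟ᵥ v ⟧) ≡⟨ ∑-cong ℂ (λ cs → Finite.∑-unique vectors (λ v → lincomb cs bs ≟ᵥ v) (lincomb cs bs) refl (λ _ → sym)) ⟩
      ∑ ℂ (λ _ → 1)                                  ≡⟨ trans (∑-const ℂ 1) (*-identityʳ _) ⟩
      length ℂ                                       ≡⟨ trans (Vec-finite-length scalars m) (cong (_^ m) length-scalars) ⟩
      q ^ m ∎
      where
      open ≡-Reasoning
      coeffs = Vec-finite scalars m
      ℂ = Finite.elems coeffs

    -- The basis decides membership, while `P` itself stays the underlying subspace, so statements
    -- about `P` carry over definitionally.
    fromDim : (P : Subspace N) → HasDim P m → DS
    fromDim {m} P (bs , bs∈ , ind , spans) =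
      P since λ v → map′ (λ { (cs , refl) → ∋-lincomb P cs bs∈ }) (spans v) (dec (span bs) v)

    card-span : {bs : Vec (Vect N) m} → LinIndep bs → ∣ span bs ∣ ≡ q ^ m
    card-span {bs = bs} ind = dim⇒card (span bs) (bs , spanOf-generators bs , ind , (λ _ x → x))

    span-⊑ : ∀ {A} {bs : Vec (Vect N) m} → VAll.All (sub A ∋_) bs → span bs ⊑ A
    span-⊑ {A = A} bs∈ v (cs , refl) = ∋-lincomb (sub A) cs bs∈

    independent : ∀ A k → q ^ k ≤ ∣ A ∣ → Σ (Vec (Vect N) k) λ bs → VAll.All (sub A ∋_) bs × LinIndep bs
    independent A zero _ = [] , [] , λ { [] _ → refl }
    independent A (suc k) le with independent A k (≤-trans (^-monoʳ-≤ q (n≤1+n k)) le)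
    ... | bs , bs∈ , ind = extend (escape {A} {span bs} λ A⊑ → <⇒≱ (^-monoʳ-< q 1<q (n<1+n k))
                              (≤-trans le (≤-trans (card-mono {A} {span bs} A⊑) (≤-reflexive (card-span ind)))))
      where
      extend : _ → _
      extend (v , v∈ , v∉) = v ∷ bs , v∈ ∷ bs∈ , LinIndep-∷ ind v∉

    card⇒dim : ∀ A → ∣ A ∣ ≡ q ^ m → HasDim (sub A) m
    card⇒dim {m} A e with independent A m (≤-reflexive (sym e))
    ... | bs , bs∈ , ind = bs , bs∈ , ind ,
      card-tight {span bs} {A} (span-⊑ {A = A} bs∈) (≤-reflexive (trans e (sym (card-span ind))))

    -- Gives a dimension to intersections and sums about which nothing else is known. If q^k ≤ ∣ A ∣
    -- < q^(k+1), then k independent vectors already span A, since one more vector outside their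
    -- span would produce q^(k+1) elements.
    card-power : ∀ A → ∃ λ k → ∣ A ∣ ≡ q ^ k
    card-power A = search N (<-≤-trans (s≤s (≤-trans (card-mono {A} {wholeS} (λ _ _ → tt)) (≤-reflexive card-whole))) (^-monoʳ-< q 1<q (n<1+n N)))
      where
      exact : ∀ k → q ^ k ≤ ∣ A ∣ → ∣ A ∣ < q ^ suc k → ∣ A ∣ ≡ q ^ k
      exact k ge lt with independent A k ge
      ... | bs , bs∈ , ind with A ⊑? span bs
      ...   | yes A⊑ = trans (card-cong {A} {span bs} A⊑ (span-⊑ {A = A} bs∈)) (card-span ind)
      ...   | no A⋢ with escape {A} {span bs} A⋢
      ...     | v , v∈ , v∉ = ⊥-elim (<⇒≱ lt (≤-trans (≤-reflexive (sym (card-span (LinIndep-∷ ind v∉))))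
                                (card-mono {span (v ∷ bs)} {A} (span-⊑ {A = A} (v∈ ∷ bs∈)))))
      search : ∀ k → ∣ A ∣ < q ^ suc k → ∃ λ k → ∣ A ∣ ≡ q ^ k
      search k lt with q ^ k ≤? ∣ A ∣
      ... | yes ge = k , exact k ge lt
      search zero lt | no ¬ge = ⊥-elim (¬ge (1≤card A))
      search (suc k) lt | no ¬ge = search k (≰⇒> ¬ge)

    subspaceOfDim : ∀ A k → q ^ k ≤ ∣ A ∣ → ∃ λ B → B ⊑ A × ∣ B ∣ ≡ q ^ k
    subspaceOfDim A k le with independent A k le
    ... | bs , bs∈ , ind = span bs , span-⊑ {A = A} bs∈ , card-span ind

    subspaces : ℕ → List DS
    subspaces k = List.map span (Finite.elems (Vec-finite vectors k))

    -- Each k-dimensional subspace is the span of a k-tuple up to `≈`, so a property respecting `≈`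
    -- has to be tested on finitely many tuples only.
    ∃DS? : ∀ k {P : DS → Set p} → (∀ A → Dec (P A)) → (∀ {A B} → A ≈ B → P A → P B) →
           Dec (∃ λ A → ∣ A ∣ ≡ q ^ k × P A)
    ∃DS? k {P} P? resp = map′ (λ { (bs , e , pb) → span bs , e , pb }) basis
      (Finite.∃? (Vec-finite vectors k) λ bs → (∣ span bs ∣ ≟ℕ q ^ k) ×-dec P? (span bs))
      where
      basis : (∃ λ A → ∣ A ∣ ≡ q ^ k × P A) → ∃ λ bs → ∣ span {k} bs ∣ ≡ q ^ k × P (span bs)
      basis (A , e , pa) with card⇒dim A e
      ... | bs , bs∈ , ind , spans = bs , card-span ind , resp {A} {span bs} (spans , span-⊑ {A = A} bs∈) pa

-- Families of (n , 0)-subspaces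

module Attenuated (𝔽 : FiniteField) (n ℓ : ℕ)
  (W : Vectors.Decidable.DS 𝔽 (n + ℓ))
  (W-card : Vectors.Decidable.∣_∣ 𝔽 (n + ℓ) W ≡ FiniteField.size 𝔽 ^ ℓ) where

  open Vectors 𝔽
  open Decidable (n + ℓ)

  Q : ℕ
  Q = q ^ ℓ

  record Member : Set₁ where
    constructor member
    field
      ds  : DS
      dim : ∣ ds ∣ ≡ q ^ n
      off : ∣ ds ⊓ W ∣ ≡ 1
  open Member public

  off-zero : ∀ F v → v ∈ₛ ds F → v ∈ₛ W → v ≡ 𝟎
  off-zero F v v∈F v∈W = card≡1⇒zero {ds F ⊓ W} (off F) v (v∈F , v∈W)

  private
    collect : List DS → List Member
    collect [] = []
    collect (A ∷ As) with (∣ A ∣ ≟ℕ q ^ n) ×-dec (∣ A ⊓ W ∣ ≟ℕ 1)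
    ... | yes (d , o) = member A d o ∷ collect As
    ... | no _ = collect As

    collect-complete : ∀ {As A} → A ∈ As → ∣ A ∣ ≡ q ^ n → ∣ A ⊓ W ∣ ≡ 1 → Any (λ G → ds G ≈ A) (collect As)
    collect-complete {A ∷ As} (here refl) d o with (∣ A ∣ ≟ℕ q ^ n) ×-dec (∣ A ⊓ W ∣ ≟ℕ 1)
    ... | yes _ = here (≈-refl {A})
    ... | no ¬do = ⊥-elim (¬do (d , o))
    collect-complete {A ∷ As} (there A∈) d o with (∣ A ∣ ≟ℕ q ^ n) ×-dec (∣ A ⊓ W ∣ ≟ℕ 1)
    ... | yes _ = there (collect-complete A∈ d o)
    ... | no _ = collect-complete A∈ d o

    dedup : List Member → List Member
    dedup [] = []
    dedup (F ∷ Fs) with any? (λ G → ds G ≈? ds F) Fs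
    ... | yes _ = dedup Fs
    ... | no _ = F ∷ dedup Fs

    dedup-once : ∀ Fs A → (∑[ G ← dedup Fs ] ⟦ ds G ≈? A ⟧) ≡ ⟦ any? (λ G → ds G ≈? A) Fs ⟧
    dedup-once [] A = refl
    dedup-once (F ∷ Fs) A with any? (λ G → ds G ≈? ds F) Fs
    ... | yes dup = trans (dedup-once Fs A) (⟦⟧-cong (any? (λ G → ds G ≈? A) Fs) (any? (λ G → ds G ≈? A) (F ∷ Fs)) there
                      λ { (here F≈A) → Any.map (λ {G} G≈F → ≈-trans {ds G} {ds F} {A} G≈F F≈A) dup ; (there x) → x })
    ... | no ¬dup = trans (cong (⟦ ds F ≈? A ⟧ +_) (dedup-once Fs A)) (add (ds F ≈? A) (any? (λ G → ds G ≈? A) Fs) (any? (λ G → ds G ≈? A) (F ∷ Fs)))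
      where
      add : (x : Dec (ds F ≈ A)) (y : Dec (Any (λ G → ds G ≈ A) Fs)) (z : Dec (Any (λ G → ds G ≈ A) (F ∷ Fs))) → ⟦ x ⟧ + ⟦ y ⟧ ≡ ⟦ z ⟧
      add (yes F≈A) (yes any) z = ⊥-elim (¬dup (Any.map (λ {G} G≈A → ≈-trans {ds G} {A} {ds F} G≈A (≈-sym {ds F} {A} F≈A)) any))
      add (yes F≈A) (no _) z = sym (⟦⟧-yes z (here F≈A))
      add (no _) (yes any) z = sym (⟦⟧-yes z (there any))
      add (no F≉A) (no none) z = sym (⟦⟧-no z λ { (here F≈A) → F≉A F≈A ; (there any) → none any })

  -- Spans of tuples list every subspace many times; one representative of each class is kept, so
  -- that sums over `𝔸` count subspaces.
  𝔸 : List Member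
  𝔸 = dedup (collect (subspaces n))

  𝔸-once : ∀ F → (∑[ G ← 𝔸 ] ⟦ ds G ≈? ds F ⟧) ≡ 1
  𝔸-once F = trans (dedup-once _ (ds F)) (⟦⟧-yes (any? (λ G → ds G ≈? ds F) (collect (subspaces n))) occurs)
    where
    occurs : Any (λ G → ds G ≈ ds F) (collect (subspaces n))
    occurs with card⇒dim (ds F) (dim F)
    ... | bs , bs∈ , ind , spans =
      Any.map (λ {G} G≈ → ≈-trans {ds G} {span bs} {ds F} G≈ span≈F)
        (collect-complete (∈-map⁺ span (Finite.complete (Vec-finite vectors n) bs)) (card-span ind)
          (zero⇒card≡1 {span bs ⊓ W} λ { v (v∈ , v∈W) → off-zero F v (proj₁ span≈F v v∈) v∈W }))
      where
      span≈F : span bs ≈ ds F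
      span≈F = span-⊑ {A = ds F} bs∈ , spans

  private variable
    p r : Level
    Ψ : Member → Set p
    Ψ′ : Member → Set r

  -- Degrees and double counting.

  degree : (∀ F → Dec (Ψ F)) → DS → ℕ
  degree Ψ? S = ∑[ F ← 𝔸 ] ⟦ Ψ? F ×-dec (S ⊑? ds F) ⟧

  size : (∀ F → Dec (Ψ F)) → ℕ
  size Ψ? = ∑[ F ← 𝔸 ] ⟦ Ψ? F ⟧

  degree-zeroS : (Ψ? : ∀ F → Dec (Ψ F)) → degree Ψ? zeroS ≡ size Ψ?
  degree-zeroS Ψ? = ∑-cong 𝔸 λ F → ⟦⟧-cong (Ψ? F ×-dec (zeroS ⊑? ds F)) (Ψ? F) proj₁ (λ ψ → ψ , zeroS-⊑ (ds F))

  degree-none : (Ψ? : ∀ F → Dec (Ψ F)) {S : DS} → (∀ F → Ψ F → ¬ (S ⊑ ds F)) → degree Ψ? S ≡ 0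
  degree-none Ψ? {S} none = ∑-zero 𝔸 λ F → ⟦⟧-no (Ψ? F ×-dec (S ⊑? ds F)) λ { (ψ , S⊑) → none F ψ S⊑ }

  degree-mono : (Ψ? : ∀ F → Dec (Ψ F)) (Ψ′? : ∀ F → Dec (Ψ′ F)) {S T : DS} →
           (∀ F → Ψ F → S ⊑ ds F → Ψ′ F × T ⊑ ds F) → degree Ψ? S ≤ degree Ψ′? T
  degree-mono Ψ? Ψ′? {S} {T} h = ∑-mono 𝔸 λ F → ⟦⟧-mono (Ψ? F ×-dec (S ⊑? ds F)) (Ψ′? F ×-dec (T ⊑? ds F)) λ { (ψ , S⊑) → h F ψ S⊑ }

  size-split : (Ψ? : ∀ F → Dec (Ψ F)) (Ψ′? : ∀ F → Dec (Ψ′ F)) →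
               size Ψ? ≡ size (λ F → Ψ? F ×-dec Ψ′? F) + size (λ F → Ψ? F ×-dec ¬? (Ψ′? F))
  size-split Ψ? Ψ′? = trans (∑-cong 𝔸 (λ F → ⟦⟧-split (Ψ? F) (Ψ′? F))) (∑-+ 𝔸 _ _)

  size-cong : (Ψ? : ∀ F → Dec (Ψ F)) (Ψ′? : ∀ F → Dec (Ψ′ F)) → (∀ F → Ψ F → Ψ′ F) → (∀ F → Ψ′ F → Ψ F) → size Ψ? ≡ size Ψ′?
  size-cong Ψ? Ψ′? h h′ = ∑-cong 𝔸 λ F → ⟦⟧-cong (Ψ? F) (Ψ′? F) (h F) (h′ F)

  size-mono : (Ψ? : ∀ F → Dec (Ψ F)) (Ψ′? : ∀ F → Dec (Ψ′ F)) → (∀ F → Ψ F → Ψ′ F) → size Ψ? ≤ size Ψ′?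
  size-mono Ψ? Ψ′? h = ∑-mono 𝔸 λ F → ⟦⟧-mono (Ψ? F) (Ψ′? F) (h F)

  module _ {Ψ : Member → Set p} (Ψ? : ∀ F → Dec (Ψ F)) (S : DS) {P : Vect (n + ℓ) → Set r} (P? : ∀ v → Dec (P v)) where

    -- Both sides count pairs (v , F) with v in P and S ⊹ v inside F; that inclusion splits into S ⊑
    -- F and v ∈ F.
    branch : (∑[ v ← 𝕍 ] ⟦ P? v ⟧ * degree Ψ? (S ⊹ v)) ≡
             (∑[ F ← 𝔸 ] ⟦ Ψ? F ×-dec (S ⊑? ds F) ⟧ * # (λ v → P? v ×-dec dec (ds F) v))
    branch = begin
      (∑[ v ← 𝕍 ] ⟦ P? v ⟧ * degree Ψ? (S ⊹ v))
        ≡⟨ ∑-cong 𝕍 (λ v → sym (∑-*ˡ 𝔸 ⟦ P? v ⟧ _)) ⟩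
      (∑[ v ← 𝕍 ] ∑[ F ← 𝔸 ] ⟦ P? v ⟧ * ⟦ Ψ? F ×-dec ((S ⊹ v) ⊑? ds F) ⟧)
        ≡⟨ ∑-swap 𝕍 𝔸 _ ⟩
      (∑[ F ← 𝔸 ] ∑[ v ← 𝕍 ] ⟦ P? v ⟧ * ⟦ Ψ? F ×-dec ((S ⊹ v) ⊑? ds F) ⟧)
        ≡⟨ ∑-cong 𝔸 (λ F → trans (∑-cong 𝕍 (pointwise F)) (∑-*ˡ 𝕍 ⟦ Ψ? F ×-dec (S ⊑? ds F) ⟧ _)) ⟩
      (∑[ F ← 𝔸 ] ⟦ Ψ? F ×-dec (S ⊑? ds F) ⟧ * # (λ v → P? v ×-dec dec (ds F) v)) ∎
      where
      open ≡-Reasoning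
      pointwise : ∀ F v → ⟦ P? v ⟧ * ⟦ Ψ? F ×-dec ((S ⊹ v) ⊑? ds F) ⟧ ≡ ⟦ Ψ? F ×-dec (S ⊑? ds F) ⟧ * ⟦ P? v ×-dec dec (ds F) v ⟧
      pointwise F v = trans (sym (⟦⟧-× (P? v) _)) (trans
        (⟦⟧-cong (P? v ×-dec (Ψ? F ×-dec ((S ⊹ v) ⊑? ds F))) ((Ψ? F ×-dec (S ⊑? ds F)) ×-dec (P? v ×-dec dec (ds F) v))
          (λ { (pv , ψ , Sv⊑) → (ψ , ⊑-trans {S} {S ⊹ v} {ds F} (⊹-upper S v) Sv⊑) , pv , Sv⊑ v (⊹-new S v) })
          (λ { ((ψ , S⊑) , pv , v∈) → pv , ψ , ⊹-least {S} {v} {ds F} S⊑ v∈ }))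
        (⟦⟧-× (Ψ? F ×-dec (S ⊑? ds F)) (P? v ×-dec dec (ds F) v)))

    branch-lower : ∀ {a} → (∀ F → Ψ F → S ⊑ ds F → a ≤ # (λ v → P? v ×-dec dec (ds F) v)) →
                   a * degree Ψ? S ≤ (∑[ v ← 𝕍 ] ⟦ P? v ⟧ * degree Ψ? (S ⊹ v))
    branch-lower {a} h = begin
      a * degree Ψ? S                                            ≡⟨ *-comm a _ ⟩
      degree Ψ? S * a                                            ≡⟨ sym (∑-*ʳ 𝔸 a _) ⟩
      (∑[ F ← 𝔸 ] ⟦ Ψ? F ×-dec (S ⊑? ds F) ⟧ * a)           ≤⟨ ∑-mono 𝔸 (λ F → ⟦⟧-weaken (Ψ? F ×-dec (S ⊑? ds F)) λ { (ψ , S⊑) → h F ψ S⊑ }) ⟩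
      (∑[ F ← 𝔸 ] ⟦ Ψ? F ×-dec (S ⊑? ds F) ⟧ * # (λ v → P? v ×-dec dec (ds F) v)) ≡⟨ sym branch ⟩
      (∑[ v ← 𝕍 ] ⟦ P? v ⟧ * degree Ψ? (S ⊹ v)) ∎
      where open ≤-Reasoning

    -- The multiplier `κ` carries the denominator of a bound, such as the q + 1 of a Gaussian
    -- binomial, through the induction without division.
    branch-≤ : ∀ κ {a c} → (∀ F → Ψ F → S ⊑ ds F → a ≤ # (λ v → P? v ×-dec dec (ds F) v)) →
               (∀ v → P v → κ * degree Ψ? (S ⊹ v) ≤ c) → a * (κ * degree Ψ? S) ≤ # P? * c
    branch-≤ κ {a} {c} h h′ = begin
      a * (κ * degree Ψ? S)                                 ≡⟨ swap a κ _ ⟩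
      κ * (a * degree Ψ? S)                                 ≤⟨ *-monoʳ-≤ κ (branch-lower h) ⟩
      κ * (∑[ v ← 𝕍 ] ⟦ P? v ⟧ * degree Ψ? (S ⊹ v))         ≡⟨ sym (∑-*ˡ 𝕍 κ _) ⟩
      (∑[ v ← 𝕍 ] κ * (⟦ P? v ⟧ * degree Ψ? (S ⊹ v)))       ≡⟨ ∑-cong 𝕍 (λ v → swap κ ⟦ P? v ⟧ _) ⟩
      (∑[ v ← 𝕍 ] ⟦ P? v ⟧ * (κ * degree Ψ? (S ⊹ v)))       ≤⟨ ∑-mono 𝕍 (λ v → ⟦⟧-weaken (P? v) (h′ v)) ⟩
      (∑[ v ← 𝕍 ] ⟦ P? v ⟧ * c)                        ≡⟨ ∑-*ʳ 𝕍 c _ ⟩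
      # P? * c ∎
      where
      open ≤-Reasoning
      swap : ∀ x y z → x * (y * z) ≡ y * (x * z)
      swap = solve-∀

    branch-≡ : ∀ {a c} → (∀ F → Ψ F → S ⊑ ds F → # (λ v → P? v ×-dec dec (ds F) v) ≡ a) →
               (∀ v → P v → degree Ψ? (S ⊹ v) ≡ c) → a * degree Ψ? S ≡ # P? * c
    branch-≡ {a} {c} h h′ = begin
      a * degree Ψ? S                                            ≡⟨ *-comm a _ ⟩
      degree Ψ? S * a                                            ≡⟨ sym (∑-*ʳ 𝔸 a _) ⟩
      (∑[ F ← 𝔸 ] ⟦ Ψ? F ×-dec (S ⊑? ds F) ⟧ * a)           ≡⟨ ∑-cong 𝔸 (λ F → ⟦⟧-subst (Ψ? F ×-dec (S ⊑? ds F)) λ { (ψ , S⊑) → sym (h F ψ S⊑) }) ⟩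
      (∑[ F ← 𝔸 ] ⟦ Ψ? F ×-dec (S ⊑? ds F) ⟧ * # (λ v → P? v ×-dec dec (ds F) v)) ≡⟨ sym branch ⟩
      (∑[ v ← 𝕍 ] ⟦ P? v ⟧ * degree Ψ? (S ⊹ v))                  ≡⟨ ∑-cong 𝕍 (λ v → ⟦⟧-subst (P? v) (h′ v)) ⟩
      (∑[ v ← 𝕍 ] ⟦ P? v ⟧ * c)                             ≡⟨ ∑-*ʳ 𝕍 c _ ⟩
      # P? * c ∎
      where open ≡-Reasoning

  Disjoint : DS → DS → Set
  Disjoint A B = ∀ v → v ∈ₛ A → v ∈ₛ B → v ≡ 𝟎

  card-disjoint-⊞ : ∀ {A B a b} → Disjoint A B → ∣ A ∣ ≡ q ^ a → ∣ B ∣ ≡ q ^ b → ∣ A ⊞ B ∣ ≡ q ^ (a + b)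
  card-disjoint-⊞ {A} {B} {a} {b} disj ea eb = begin
    ∣ A ⊞ B ∣                   ≡⟨ sym (*-identityʳ _) ⟩
    ∣ A ⊞ B ∣ * 1               ≡⟨ cong (∣ A ⊞ B ∣ *_) (sym (zero⇒card≡1 {A ⊓ B} λ { v (x , y) → disj v x y })) ⟩
    ∣ A ⊞ B ∣ * ∣ A ⊓ B ∣       ≡⟨ card-⊞ A B ⟩
    ∣ A ∣ * ∣ B ∣               ≡⟨ cong₂ _*_ ea eb ⟩
    q ^ a * q ^ b               ≡⟨ sym (^-distribˡ-+-* q a b) ⟩
    q ^ (a + b) ∎
    where open ≡-Reasoning

  -- Members of Ψ avoid E ⊑ C; the subspaces S ⊑ C avoiding E are grown one vector at a time.
  module Chain {Ψ : Member → Set p} (Ψ? : ∀ F → Dec (Ψ F)) (C E : DS) (m s t : ℕ)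
    (E⊑C : E ⊑ C) (C-card : ∣ C ∣ ≡ q ^ m) (E-card : ∣ E ∣ ≡ q ^ s)
    (avoid : ∀ F → Ψ F → Disjoint (ds F) E) where

    record Inside (i : ℕ) (S : DS) : Set where
      constructor inside
      field
        within   : S ⊑ C
        card     : ∣ S ∣ ≡ q ^ i
        disjoint : Disjoint S E

    private
      P? : ∀ S v → Dec (v ∈ₛ C × ¬ (v ∈ₛ S ⊞ E))
      P? S v = dec C v ×-dec ¬? (dec (S ⊞ E) v)

      #P : ∀ {i S} → Inside i S → # (P? S) ≡ q ^ m ∸ q ^ (i + s)
      #P {i} {S} (inside S⊑C eS disj) = trans (card-∖ C (S ⊞ E)) (cong₂ _∸_ C-card
        (trans (card-cong {C ⊓ (S ⊞ E)} {S ⊞ E} (λ _ → proj₂) (λ v v∈ → ⊞-least {S} {E} {C} S⊑C E⊑C v v∈ , v∈))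
               (card-disjoint-⊞ {S} {E} {i} {s} disj eS E-card)))

      -- F contains S and avoids E, so F meets S ⊞ E in S only; removing S ⊞ E from F ⊓ C removes
      -- exactly the q^i vectors of S.
      #PF : ∀ {i S} → Inside i S → ∀ F → Ψ F → S ⊑ ds F → # (λ v → P? S v ×-dec dec (ds F) v) ≡ ∣ ds F ⊓ C ∣ ∸ q ^ i
      #PF {i} {S} (inside S⊑C eS disj) F ψ S⊑F = trans
        (#-cong (λ v → P? S v ×-dec dec (ds F) v) (λ v → dec (ds F ⊓ C) v ×-dec ¬? (dec S v))
          (λ { v ((v∈C , v∉) , v∈F) → (v∈F , v∈C) , λ v∈S → v∉ (⊞-upperˡ S E v v∈S) })
          (λ { v ((v∈F , v∈C) , v∉S) → (v∈C , λ v∈ → v∉S (back v v∈F v∈)) , v∈F }))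
        (trans (card-∖ (ds F ⊓ C) S) (cong (∣ ds F ⊓ C ∣ ∸_)
          (trans (card-cong {(ds F ⊓ C) ⊓ S} {S} (λ _ → proj₂) (λ v v∈ → (S⊑F v v∈ , S⊑C v v∈) , v∈)) eS)))
        where
        back : ∀ v → v ∈ₛ ds F → v ∈ₛ S ⊞ E → v ∈ₛ S
        back _ v∈F (a , a∈ , b , b∈ , refl) with avoid F ψ b (∋-cancelˡ (sub (ds F)) (S⊑F a a∈) v∈F) b∈
        ... | refl = subst (_∈ₛ S) (sym (⊕-identityʳ a)) a∈

      grow : ∀ {i S v} → Inside i S → v ∈ₛ C × ¬ (v ∈ₛ S ⊞ E) → Inside (suc i) (S ⊹ v)
      grow {i} {S} {v} (inside S⊑C eS disj) (v∈C , v∉) =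
        inside (⊹-least {S} {v} {C} S⊑C v∈C)
          (trans (card-⊹ {S} (λ v∈S → v∉ (⊞-upperˡ S E v v∈S))) (cong (q *_) eS))
          (λ x x∈ x∈E → disj x (⊹-meet {S} {v} E v∉ x x∈ x∈E) x∈E)

    -- `g u` bounds the degree of a subspace u steps short of dimension t. A step weighs the q^m -
    -- q^(i+s) vectors of C outside S ⊞ E against the at least q^t - q^i of them in each member;
    -- this is the recurrence required of `g`.
    chain-≤ : ∀ κ (g : ℕ → ℕ) → (∀ F → Ψ F → q ^ t ≤ ∣ ds F ⊓ C ∣) →
              (∀ {i u} → i + suc u ≡ t → (q ^ m ∸ q ^ (i + s)) * g u ≤ (q ^ t ∸ q ^ i) * g (suc u)) →
              (∀ {S} → Inside t S → κ * degree Ψ? S ≤ g 0) →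
              ∀ u {i S} → i + u ≡ t → Inside i S → κ * degree Ψ? S ≤ g u
    chain-≤ κ g cover step base zero {i} e ins = base (subst (λ j → Inside j _) (trans (sym (+-identityʳ i)) e) ins)
    chain-≤ κ g cover step base (suc u) {i} {S} e ins =
      *-cancelˡ-≤ (q ^ t ∸ q ^ i) ⦃ ∸-nonZero (1+u≡⇒< e) ⦄ (≤-trans
        (branch-≤ Ψ? S (P? S) κ
          (λ F ψ S⊑F → ≤-trans (∸-monoˡ-≤ (q ^ i) (cover F ψ)) (≤-reflexive (sym (#PF ins F ψ S⊑F))))
          (λ v pv → chain-≤ κ g cover step base u (trans (sym (+-suc i u)) e) (grow ins pv)))
        (≤-trans (≤-reflexive (cong (_* g u) (#P ins))) (step e)))

    chain-≡ : (g : ℕ → ℕ) → (∀ F → Ψ F → ∣ ds F ⊓ C ∣ ≡ q ^ t) →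
              (∀ {i u} → i + suc u ≡ t → (q ^ m ∸ q ^ (i + s)) * g u ≡ (q ^ t ∸ q ^ i) * g (suc u)) →
              (∀ {S} → Inside t S → degree Ψ? S ≡ g 0) →
              ∀ u {i S} → i + u ≡ t → Inside i S → degree Ψ? S ≡ g u
    chain-≡ g cover step base zero {i} e ins = base (subst (λ j → Inside j _) (trans (sym (+-identityʳ i)) e) ins)
    chain-≡ g cover step base (suc u) {i} {S} e ins =
      *-cancelˡ-≡ _ _ (q ^ t ∸ q ^ i) ⦃ ∸-nonZero (1+u≡⇒< e) ⦄ (trans
        (branch-≡ Ψ? S (P? S)
          (λ F ψ S⊑F → trans (#PF ins F ψ S⊑F) (cong (_∸ q ^ i) (cover F ψ)))
          (λ v pv → chain-≡ g cover step base u (trans (sym (+-suc i u)) e) (grow ins pv)))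
        (trans (cong (_* g u) (#P ins)) (step e)))

  ⊑-member : ∀ F {S} → ∣ S ∣ ≡ q ^ n → S ⊑ ds F → ds F ⊑ S
  ⊑-member F {S} eS S⊑ = card-tight {S} {ds F} S⊑ (≤-reflexive (trans (dim F) (sym eS)))

  degree-self : (Ψ? : ∀ F → Dec (Ψ F)) {S : DS} → ∣ S ∣ ≡ q ^ n → Disjoint S W → (∀ F → ds F ≈ S → Ψ F) → degree Ψ? S ≡ 1
  degree-self Ψ? {S} eS disj resp = trans
    (∑-cong 𝔸 λ F → ⟦⟧-cong (Ψ? F ×-dec (S ⊑? ds F)) (ds F ≈? S)
      (λ { (_ , S⊑) → ⊑-member F {S} eS S⊑ , S⊑ }) (λ F≈S → resp F F≈S , proj₂ F≈S))
    (𝔸-once (member S eS (zero⇒card≡1 {S ⊓ W} λ { v (x , y) → disj v x y })))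

  All : Member → Set
  All _ = ⊤

  all : ∀ F → Dec (All F)
  all _ = yes tt

  -- The chain with C the whole space and E = W: there are q^(n+ℓ) - q^(i+ℓ) = (q^n - q^i) Q
  -- candidates, and each member contains q^n - q^i of them, so every step contributes a factor Q.
  extensions : ∀ u {i S} → i + u ≡ n → ∣ S ∣ ≡ q ^ i → Disjoint S W → degree all S ≡ Q ^ u
  extensions u {i} {S} e eS disj =
    chain-≡ (Q ^_)
      (λ F _ → trans (card-cong {ds F ⊓ wholeS} {ds F} (λ _ → proj₁) (λ _ x → x , tt)) (dim F))
      (λ {i} {u} _ → trans (cong (_* Q ^ u) (∸-scale n i ℓ)) (*-assoc (q ^ n ∸ q ^ i) Q (Q ^ u)))
      (λ { {S} (inside _ eS disj) → degree-self all {S} eS disj (λ _ _ → tt) })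
      u {i} {S} e (inside (λ _ _ → tt) eS disj)
    where open Chain all wholeS W (n + ℓ) ℓ n (λ _ _ → tt) card-whole W-card (λ F _ → off-zero F)

  degree-≤ : (Ψ? : ∀ F → Dec (Ψ F)) → ∀ u {i S} → i + u ≡ n → ∣ S ∣ ≡ q ^ i → degree Ψ? S ≤ Q ^ u
  degree-≤ Ψ? u {i} {S} e eS with (S ⊓ W) ⊑? zeroS
  ... | yes disj = ≤-trans (degree-mono Ψ? all {S} {S} (λ _ _ S⊑ → tt , S⊑)) (≤-reflexive (extensions u {i} {S} e eS (λ v x y → disj v (x , y))))
  ... | no meets = ≤-trans (≤-reflexive (degree-none Ψ? {S} λ F _ S⊑ → meets λ { v (x , y) → off-zero F v (S⊑ v x) y })) z≤n

-- The extremal families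

module Extremal (𝔽 : FiniteField) (n ℓ : ℕ)
  (W : Vectors.Decidable.DS 𝔽 (n + ℓ))
  (W-card : Vectors.Decidable.∣_∣ 𝔽 (n + ℓ) W ≡ FiniteField.size 𝔽 ^ ℓ) where

  open Vectors 𝔽
  open Decidable (n + ℓ)
  open Attenuated 𝔽 n ℓ W W-card

  -- The recurrence of the chain in a (t+1)-space: for u = t - i, the number of t-subspaces through
  -- a fixed i-dimensional subspace is θ_{u+1}.
  hyperplane-step : ∀ c {i u t} → i + suc u ≡ t →
    (q ^ suc t ∸ q ^ (i + 0)) * (θ q (suc u) * c) ≡ (q ^ t ∸ q ^ i) * (θ q (suc (suc u)) * c)
  hyperplane-step c {i} {u} refl = begin
    (q ^ suc (i + suc u) ∸ q ^ (i + 0)) * (θ q (suc u) * c)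
      ≡⟨ cong₂ (λ x y → (q ^ x ∸ q ^ y) * (θ q (suc u) * c)) (sym (+-suc i (suc u))) (+-identityʳ i) ⟩
    (q ^ (i + suc (suc u)) ∸ q ^ i) * (θ q (suc u) * c)
      ≡⟨ cong (_* (θ q (suc u) * c)) (q^∸q^ i (suc (suc u))) ⟩
    q ^ i * (pred q * θ q (suc (suc u))) * (θ q (suc u) * c)
      ≡⟨ rearrange (q ^ i) (pred q) (θ q (suc (suc u))) (θ q (suc u)) c ⟩
    q ^ i * (pred q * θ q (suc u)) * (θ q (suc (suc u)) * c)
      ≡⟨ cong (_* (θ q (suc (suc u)) * c)) (sym (q^∸q^ i (suc u))) ⟩
    (q ^ (i + suc u) ∸ q ^ i) * (θ q (suc (suc u)) * c) ∎
    where
    open ≡-Reasoning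
    rearrange : ∀ x y z w c → x * (y * z) * (w * c) ≡ x * (y * w) * (z * c)
    rearrange = solve-∀

  disjoint-zeroS : ∀ {A} → Disjoint A zeroS
  disjoint-zeroS v _ v≡0 = v≡0

  card-between : ∀ A k → q ^ k ≤ ∣ A ∣ → ∣ A ∣ < q ^ suc k → ∣ A ∣ ≡ q ^ k
  card-between A k lo hi with card-power A
  ... | j , e = trans e (cong (q ^_) {j} {k} (≤-antisym (≤-pred (^-cancel-< j (suc k) (subst (_< q ^ suc k) e hi))) (^-cancel-≤ k j (subst (q ^ k ≤_) e lo))))

  card-≥-suc : ∀ A k → q ^ k < ∣ A ∣ → q ^ suc k ≤ ∣ A ∣
  card-≥-suc A k lt with card-power A
  ... | j , e = subst (q ^ suc k ≤_) (sym e) (^-monoʳ-≤ q (^-cancel-< k j (subst (q ^ k <_) e lt)))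

  card-≤-pred : ∀ A k → ∣ A ∣ < q ^ suc k → ∣ A ∣ ≤ q ^ k
  card-≤-pred A k lt with card-power A
  ... | j , e = subst (_≤ q ^ k) (sym e) (^-monoʳ-≤ q (≤-pred (^-cancel-< j (suc k) (subst (_< q ^ suc k) e lt))))

  -- The members meeting a (t + 2)-space Z in dimension at least t + 1.

  module Star (t e : ℕ) (n≡ : suc (suc t) + e ≡ n)
    (Z : DS) (Z-card : ∣ Z ∣ ≡ q ^ suc (suc t)) (Z-off : Disjoint Z W) where

    H₂ : ∀ F → Dec (q ^ suc t ≤ ∣ ds F ⊓ Z ∣)
    H₂ F = q ^ suc t ≤? ∣ ds F ⊓ Z ∣

    private
      exact : ∀ F → Dec (∣ ds F ⊓ Z ∣ ≡ q ^ suc t)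
      exact F = ∣ ds F ⊓ Z ∣ ≟ℕ q ^ suc t

      contains : ∀ {F} → q ^ suc t ≤ ∣ ds F ⊓ Z ∣ → ¬ (∣ ds F ⊓ Z ∣ ≡ q ^ suc t) → Z ⊑ ds F
      contains {F} le ne v v∈ = proj₁ (card-tight {ds F ⊓ Z} {Z} (λ _ → proj₂)
        (≤-trans (≤-reflexive Z-card) (card-≥-suc (ds F ⊓ Z) (suc t) (≤∧≢⇒< le (λ e → ne (sym e))))) v v∈)

      full : ∀ {F} → Z ⊑ ds F → ∣ ds F ⊓ Z ∣ ≡ q ^ suc (suc t)
      full {F} Z⊑F = trans (card-cong {ds F ⊓ Z} {Z} (λ _ → proj₂) (λ v v∈ → Z⊑F v v∈ , v∈)) Z-card

      full≢ : ∀ {F} → Z ⊑ ds F → ¬ (∣ ds F ⊓ Z ∣ ≡ q ^ suc t)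
      full≢ {F} Z⊑F e = <⇒≢ (n<1+n (suc t)) (^-cancel-≡ (suc t) (suc (suc t)) (trans (sym e) (full {F} Z⊑F)))

      partition : ∀ {a b c} {A : Set a} {B : Set b} {C : Set c} (x : Dec A) (y : Dec B) (z : Dec C) →
                  (A → ¬ C → B) → (B → A) → (C → A) → (B → ¬ C) → ⟦ x ⟧ ≡ ⟦ y ⟧ + ⟦ z ⟧
      partition x (yes b) (yes c) _ _ _ bc = ⊥-elim (bc b c)
      partition x (yes b) (no _) _ ba _ _ = ⟦⟧-yes x (ba b)
      partition x (no _) (yes c) _ _ ca _ = ⟦⟧-yes x (ca c)
      partition x (no ¬b) (no ¬c) h _ _ _ = ⟦⟧-no x (λ a → ¬b (h a ¬c))

      degree-Z : degree all Z ≡ Q ^ e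
      degree-Z = extensions e {suc (suc t)} {Z} n≡ Z-card Z-off

      -- A member through the hyperplane S of Z meets Z either in S or in all of Z, so the members
      -- through Z are subtracted from those through S.
      base : ∀ {S} → S ⊑ Z → ∣ S ∣ ≡ q ^ suc t → degree exact S ≡ Q ^ suc e ∸ Q ^ e
      base {S} S⊑Z eS = begin
        degree exact S                               ≡⟨ sym (m+n∸n≡m (degree exact S) (Q ^ e)) ⟩
        degree exact S + Q ^ e ∸ Q ^ e               ≡⟨ cong (λ x → degree exact S + x ∸ Q ^ e) (sym degree-Z) ⟩
        degree exact S + degree all Z ∸ Q ^ e             ≡⟨ cong (_∸ Q ^ e) (sym split) ⟩
        degree all S ∸ Q ^ e                         ≡⟨ cong (_∸ Q ^ e) (extensions (suc e) {suc t} {S} (trans (+-suc (suc t) e) n≡) eS (λ v v∈ → Z-off v (S⊑Z v v∈))) ⟩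
        Q ^ suc e ∸ Q ^ e ∎
        where
        open ≡-Reasoning
        split : degree all S ≡ degree exact S + degree all Z
        split = trans (∑-cong 𝔸 λ F → partition (all F ×-dec (S ⊑? ds F)) (exact F ×-dec (S ⊑? ds F)) (all F ×-dec (Z ⊑? ds F))
          (λ { (_ , S⊑F) Z⋢ → decide F S⊑F (λ Z⊑ → Z⋢ (tt , Z⊑)) (exact F) , S⊑F })
          (λ { (_ , S⊑F) → tt , S⊑F })
          (λ { (_ , Z⊑F) → tt , ⊑-trans {S} {Z} {ds F} S⊑Z Z⊑F })
          (λ { (ex , _) (_ , Z⊑F) → full≢ {F} Z⊑F ex })) (∑-+ 𝔸 _ _)
          where
          decide : ∀ F → S ⊑ ds F → ¬ (Z ⊑ ds F) → Dec (∣ ds F ⊓ Z ∣ ≡ q ^ suc t) → ∣ ds F ⊓ Z ∣ ≡ q ^ suc t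
          decide F _ _ (yes ex) = ex
          decide F S⊑F Z⋢ (no ne) = ⊥-elim (Z⋢ (contains {F}
            (subst (_≤ ∣ ds F ⊓ Z ∣) eS (card-mono {S} {ds F ⊓ Z} (λ v v∈ → S⊑F v v∈ , S⊑Z v v∈))) ne))

      size-exact : size exact ≡ θ q (suc (suc t)) * (Q ^ suc e ∸ Q ^ e)
      size-exact = trans (sym (degree-zeroS exact))
        (chain-≡ (λ u → θ q (suc u) * (Q ^ suc e ∸ Q ^ e)) (λ F ex → ex)
          (hyperplane-step (Q ^ suc e ∸ Q ^ e))
          (λ { {S} (inside S⊑Z eS _) → trans (base {S} S⊑Z eS) (sym (*-identityˡ _)) })
          (suc t) {0} {zeroS} refl (inside (zeroS-⊑ Z) card-zero (disjoint-zeroS {zeroS})))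
        where open Chain exact Z zeroS (suc (suc t)) 0 (suc t) (zeroS-⊑ Z) Z-card card-zero (λ F _ → disjoint-zeroS {ds F})

    -- The two kinds of members give θ_{t+2} (Q^(e+1) - Q^e) and Q^e; the stated correction arises
    -- from θ_{t+2} - 1 = q θ_{t+1}.
    size-H₂ : size H₂ + Q ^ e * (q * θ q (suc t)) ≡ Q ^ suc e * θ q (suc (suc t))
    size-H₂ = begin
      size H₂ + Q ^ e * (q * θ q (suc t))
        ≡⟨ cong (_+ Q ^ e * (q * θ q (suc t))) (trans split (cong₂ _+_ size-exact degree-Z)) ⟩
      θ q (suc (suc t)) * (Q ^ suc e ∸ Q ^ e) + Q ^ e + Q ^ e * (q * θ q (suc t))
        ≡⟨ gather (θ q (suc (suc t)) * (Q ^ suc e ∸ Q ^ e)) (Q ^ e) (q * θ q (suc t)) ⟩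
      θ q (suc (suc t)) * (Q ^ suc e ∸ Q ^ e) + suc (q * θ q (suc t)) * Q ^ e
        ≡⟨ cong (λ x → θ q (suc (suc t)) * (Q ^ suc e ∸ Q ^ e) + x * Q ^ e) (sym (θ-suc (suc t))) ⟩
      θ q (suc (suc t)) * (Q ^ suc e ∸ Q ^ e) + θ q (suc (suc t)) * Q ^ e
        ≡⟨ sym (*-distribˡ-+ (θ q (suc (suc t))) (Q ^ suc e ∸ Q ^ e) (Q ^ e)) ⟩
      θ q (suc (suc t)) * (Q ^ suc e ∸ Q ^ e + Q ^ e)
        ≡⟨ cong (θ q (suc (suc t)) *_) (m∸n+n≡m (^-monoʳ-≤ Q ⦃ m^n≢0 q ℓ ⦄ (n≤1+n e))) ⟩
      θ q (suc (suc t)) * Q ^ suc e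
        ≡⟨ *-comm (θ q (suc (suc t))) _ ⟩
      Q ^ suc e * θ q (suc (suc t)) ∎
      where
      open ≡-Reasoning
      gather : ∀ x y z → x + y + y * z ≡ x + suc z * y
      gather = solve-∀
      split : size H₂ ≡ size exact + degree all Z
      split = trans (∑-cong 𝔸 λ F → partition (H₂ F) (exact F) (all F ×-dec (Z ⊑? ds F))
        (λ le Z⋢ → decide F le (λ Z⊑ → Z⋢ (tt , Z⊑)) (exact F))
        (λ ex → ≤-reflexive (sym ex))
        (λ { (_ , Z⊑F) → ≤-trans (^-monoʳ-≤ q (n≤1+n (suc t))) (≤-reflexive (sym (full {F} Z⊑F))) })
        (λ { ex (_ , Z⊑F) → full≢ {F} Z⊑F ex })) (∑-+ 𝔸 _ _)
        where
        decide : ∀ F → q ^ suc t ≤ ∣ ds F ⊓ Z ∣ → ¬ (Z ⊑ ds F) → Dec (∣ ds F ⊓ Z ∣ ≡ q ^ suc t) → ∣ ds F ⊓ Z ∣ ≡ q ^ suc t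
        decide F _ _ (yes ex) = ex
        decide F le Z⋢ (no ne) = ⊥-elim (Z⋢ (contains {F} le ne))

  -- The family ℋ₁(X, M).

  count-outside : ∀ A B → # (λ v → ¬? (dec A v) ×-dec ¬? (dec B v)) + (∣ A ∣ + ∣ B ∣) ≡ q ^ (n + ℓ) + ∣ A ⊓ B ∣
  count-outside A B = sym (begin
    q ^ (n + ℓ) + ∣ A ⊓ B ∣
      ≡⟨ cong (_+ ∣ A ⊓ B ∣) (trans (sym card-whole) (#-split (dec wholeS) (dec A))) ⟩
    # (λ v → yes tt ×-dec dec A v) + # (λ v → yes tt ×-dec ¬? (dec A v)) + ∣ A ⊓ B ∣
      ≡⟨ cong₂ (λ x y → x + y + ∣ A ⊓ B ∣) (#-cong (λ v → yes tt ×-dec dec A v) (dec A) (λ _ → proj₂) (λ _ → tt ,_))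
           (trans (#-cong (λ v → yes tt ×-dec ¬? (dec A v)) (λ v → ¬? (dec A v)) (λ _ → proj₂) (λ _ → tt ,_)) (#-split (λ v → ¬? (dec A v)) (dec B))) ⟩
    ∣ A ∣ + (# (λ v → ¬? (dec A v) ×-dec dec B v) + # (λ v → ¬? (dec A v) ×-dec ¬? (dec B v))) + ∣ A ⊓ B ∣
      ≡⟨ cong₂ (λ x y → ∣ A ∣ + (x + # (λ v → ¬? (dec A v) ×-dec ¬? (dec B v))) + y)
           (#-cong (λ v → ¬? (dec A v) ×-dec dec B v) (λ v → dec B v ×-dec ¬? (dec A v)) (λ { _ (x , y) → y , x }) (λ { _ (x , y) → y , x }))
           (card-cong {A ⊓ B} {B ⊓ A} (λ { _ (x , y) → y , x }) (λ { _ (x , y) → y , x })) ⟩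
    ∣ A ∣ + (# (λ v → dec B v ×-dec ¬? (dec A v)) + # (λ v → ¬? (dec A v) ×-dec ¬? (dec B v))) + ∣ B ⊓ A ∣
      ≡⟨ gather (∣ A ∣) (# (λ v → dec B v ×-dec ¬? (dec A v))) (# (λ v → ¬? (dec A v) ×-dec ¬? (dec B v))) (∣ B ⊓ A ∣) ⟩
    # (λ v → ¬? (dec A v) ×-dec ¬? (dec B v)) + (∣ A ∣ + (∣ B ⊓ A ∣ + # (λ v → dec B v ×-dec ¬? (dec A v))))
      ≡⟨ cong (λ x → # (λ v → ¬? (dec A v) ×-dec ¬? (dec B v)) + (∣ A ∣ + x)) (sym (#-split (dec B) (dec A))) ⟩
    # (λ v → ¬? (dec A v) ×-dec ¬? (dec B v)) + (∣ A ∣ + ∣ B ∣) ∎)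
    where
    open ≡-Reasoning
    gather : ∀ x y z w → x + (y + z) + w ≡ z + (x + (w + y))
    gather = solve-∀

  -- The factors Q - q^j for j = i + 1, ..., i + u with the smallest j split off first, as in
  -- growing a subspace from X; `prodTerm` splits off the largest first.
  prodFrom : ℕ → ℕ → ℕ
  prodFrom i zero = 1
  prodFrom i (suc u) = (Q ∸ q ^ suc i) * prodFrom (suc i) u

  prodFrom-last : ∀ i u → prodFrom i (suc u) ≡ (Q ∸ q ^ suc (i + u)) * prodFrom i u
  prodFrom-last i zero = cong (λ x → (Q ∸ q ^ suc x) * 1) (sym (+-identityʳ i))
  prodFrom-last i (suc u) = begin
    (Q ∸ q ^ suc i) * prodFrom (suc i) (suc u)
      ≡⟨ cong ((Q ∸ q ^ suc i) *_) (prodFrom-last (suc i) u) ⟩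
    (Q ∸ q ^ suc i) * ((Q ∸ q ^ suc (suc i + u)) * prodFrom (suc i) u)
      ≡⟨ swap (Q ∸ q ^ suc i) (Q ∸ q ^ suc (suc i + u)) _ ⟩
    (Q ∸ q ^ suc (suc i + u)) * prodFrom i (suc u)
      ≡⟨ cong (λ x → (Q ∸ q ^ suc x) * prodFrom i (suc u)) (sym (+-suc i u)) ⟩
    (Q ∸ q ^ suc (i + suc u)) * prodFrom i (suc u) ∎
    where
    open ≡-Reasoning
    swap : ∀ x y z → x * (y * z) ≡ y * (x * z)
    swap = solve-∀

  prodFrom-0 : ∀ d → prodFrom 0 d ≡ prodTerm q ℓ d
  prodFrom-0 zero = refl
  prodFrom-0 (suc d) = trans (prodFrom-last 0 d) (cong ((Q ∸ q ^ suc d) *_) (prodFrom-0 d))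

  module HiltonMilner (t d : ℕ) (n≡ : t + d ≡ n) (d≤ℓ : d ≤ ℓ) (0<d : 0 < d)
    (X : DS) (X-card : ∣ X ∣ ≡ q ^ t) (X-off : Disjoint X W)
    (M : DS) (M-card : ∣ M ∣ ≡ q ^ suc n) (M-meet : ∣ M ⊓ W ∣ ≡ q ^ 1) (X⊑M : X ⊑ M) where

    Big : Member → Set
    Big F = q ^ suc t ≤ ∣ ds F ⊓ M ∣

    H₁ : ∀ F → Dec ((X ⊑ ds F × Big F) ⊎ ds F ⊑ M)
    H₁ F = ((X ⊑? ds F) ×-dec (q ^ suc t ≤? ∣ ds F ⊓ M ∣)) ⊎-dec (ds F ⊑? M)

    private
      minimal : ∀ F → Dec (ds F ⊓ M ⊑ X)
      minimal F = (ds F ⊓ M) ⊑? X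

      low : ∀ F → Dec (ds F ⊑ M)
      low F = ds F ⊑? M

      -- Inside M the line M ⊓ W takes over the role of W, so each step contributes a factor q in
      -- place of Q.
      degree-low : ∀ u {i S} → i + u ≡ n → S ⊑ M → ∣ S ∣ ≡ q ^ i → Disjoint S W → degree low S ≡ q ^ u
      degree-low u {i} {S} e S⊑M eS disj =
        chain-≡ (q ^_)
          (λ F F⊑M → trans (card-cong {ds F ⊓ M} {ds F} (λ _ → proj₁) (λ v v∈ → v∈ , F⊑M v v∈)) (dim F))
          (λ {i} {u} _ → trans (cong (λ x → (q ^ x ∸ q ^ (i + 1)) * q ^ u) (+-comm 1 n))
            (trans (cong (_* q ^ u) (∸-scale n i 1)) (trans (*-assoc (q ^ n ∸ q ^ i) (q ^ 1) _) (cong (λ x → (q ^ n ∸ q ^ i) * (x * q ^ u)) (*-identityʳ q)))))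
          (λ { {S} (inside S⊑M eS disj) → degree-self low {S} eS (λ v v∈ v∈W → disj v v∈ (S⊑M v v∈ , v∈W)) (λ F F≈S → ⊑-trans {ds F} {S} {M} (proj₁ F≈S) S⊑M) })
          u {i} {S} e (inside S⊑M eS (λ v v∈ v∈MW → disj v v∈ (proj₂ v∈MW)))
        where open Chain low M (M ⊓ W) (suc n) 1 n (λ _ → proj₁) M-card M-meet (λ F _ v v∈ v∈MW → off-zero F v v∈ (proj₂ v∈MW))

      -- S grows from X while meeting M only in X. A new vector must lie outside A = S ⊞ W to stay
      -- off W, and outside B = S ⊞ M to create no further intersection with M.
      module Step {i u S} (e : i + suc u ≡ d) (eS : ∣ S ∣ ≡ q ^ (t + i)) (X⊑S : X ⊑ S) (S-off : Disjoint S W)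
        (S∩M : ∀ v → v ∈ₛ S → v ∈ₛ M → v ∈ₛ X) where

        A B : DS
        A = S ⊞ W
        B = S ⊞ M

        A-card : ∣ A ∣ ≡ q ^ (t + i) * Q
        A-card = trans (card-disjoint-⊞ {S} {W} {t + i} {ℓ} S-off eS W-card) (^-distribˡ-+-* q (t + i) ℓ)

        B-card : ∣ B ∣ ≡ q ^ n * q ^ suc i
        B-card = *-cancelʳ-≡ _ _ (q ^ t) ⦃ m^n≢0 q t ⦄ (begin
          ∣ B ∣ * q ^ t                   ≡⟨ cong (∣ B ∣ *_) (trans (sym X-card) (card-cong {X} {S ⊓ M} (λ v v∈ → X⊑S v v∈ , X⊑M v v∈) (λ { v (x , y) → S∩M v x y }))) ⟩
          ∣ B ∣ * ∣ S ⊓ M ∣               ≡⟨ trans (card-⊞ S M) (cong₂ _*_ (trans eS (^-distribˡ-+-* q t i)) M-card) ⟩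
          q ^ t * q ^ i * (q * q ^ n)     ≡⟨ rearrange (q ^ t) (q ^ i) q (q ^ n) ⟩
          q ^ n * (q * q ^ i) * q ^ t ∎)
          where
          open ≡-Reasoning
          rearrange : ∀ x y z w → x * y * (z * w) ≡ w * (z * y) * x
          rearrange = solve-∀

        -- The dimensions n + 1 and ℓ exceed n + ℓ by exactly the dimension 1 of M ⊓ W. So W and M
        -- span everything, hence so do A and B, and this determines ∣ A ⊓ B ∣.
        WM-card : ∣ W ⊞ M ∣ ≡ q ^ (n + ℓ)
        WM-card = *-cancelʳ-≡ _ _ (q ^ 1) ⦃ m^n≢0 q 1 ⦄ (begin
          ∣ W ⊞ M ∣ * q ^ 1               ≡⟨ cong (∣ W ⊞ M ∣ *_) (trans (sym M-meet) (card-cong {M ⊓ W} {W ⊓ M} (λ { _ (x , y) → y , x }) (λ { _ (x , y) → y , x }))) ⟩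
          ∣ W ⊞ M ∣ * ∣ W ⊓ M ∣           ≡⟨ trans (card-⊞ W M) (cong₂ _*_ W-card M-card) ⟩
          Q * (q * q ^ n)                 ≡⟨ rearrange Q q (q ^ n) ⟩
          q ^ n * Q * (q * 1)             ≡⟨ cong (_* q ^ 1) (sym (^-distribˡ-+-* q n ℓ)) ⟩
          q ^ (n + ℓ) * q ^ 1 ∎)
          where
          open ≡-Reasoning
          rearrange : ∀ x y z → x * (y * z) ≡ z * x * (y * 1)
          rearrange = solve-∀

        AB-card : ∣ A ⊞ B ∣ ≡ q ^ (n + ℓ)
        AB-card = ≤-antisym
          (≤-trans (card-mono {A ⊞ B} {wholeS} (λ _ _ → tt)) (≤-reflexive card-whole))
          (≤-trans (≤-reflexive (sym WM-card)) (card-mono {W ⊞ M} {A ⊞ B} (⊞-least {W} {M} {A ⊞ B}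
            (⊑-trans {W} {A} {A ⊞ B} (⊞-upperʳ S W) (⊞-upperˡ A B)) (⊑-trans {M} {B} {A ⊞ B} (⊞-upperʳ S M) (⊞-upperʳ A B)))))

        A∩B-card : ∣ A ⊓ B ∣ ≡ q ^ (t + i) * q ^ suc i
        A∩B-card = *-cancelˡ-≡ _ _ (q ^ (n + ℓ)) ⦃ m^n≢0 q (n + ℓ) ⦄ (begin
          q ^ (n + ℓ) * ∣ A ⊓ B ∣                         ≡⟨ cong (_* ∣ A ⊓ B ∣) (sym AB-card) ⟩
          ∣ A ⊞ B ∣ * ∣ A ⊓ B ∣                           ≡⟨ trans (card-⊞ A B) (cong₂ _*_ A-card B-card) ⟩
          q ^ (t + i) * Q * (q ^ n * q ^ suc i)           ≡⟨ rearrange (q ^ (t + i)) Q (q ^ n) (q ^ suc i) ⟩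
          q ^ n * Q * (q ^ (t + i) * q ^ suc i)           ≡⟨ cong (_* (q ^ (t + i) * q ^ suc i)) (sym (^-distribˡ-+-* q n ℓ)) ⟩
          q ^ (n + ℓ) * (q ^ (t + i) * q ^ suc i) ∎)
          where
          open ≡-Reasoning
          rearrange : ∀ x y z w → x * y * (z * w) ≡ z * y * (x * w)
          rearrange = solve-∀

        P? : ∀ v → Dec (¬ (v ∈ₛ A) × ¬ (v ∈ₛ B))
        P? v = ¬? (dec A v) ×-dec ¬? (dec B v)

        -- Inclusion-exclusion gives a c + b e - b c - a e, which factors because ∣ A ∣ ∣ B ∣ equals
        -- ∣ A ⊓ B ∣ times the number of all vectors.
        product : ∀ {P a b c e} → b ≤ a → e ≤ c → P + (b * c + a * e) ≡ a * c + b * e → P ≡ (a ∸ b) * (c ∸ e)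
        product {P} {a} {b} {c} {e} b≤a e≤c eq = +-cancelʳ-≡ (b * c + a * e) _ _ (trans eq
          (subst₂ (λ a c → a * c + b * e ≡ (a ∸ b) * (c ∸ e) + (b * c + a * e)) (m+[n∸m]≡n b≤a) (m+[n∸m]≡n e≤c) expand))
          where
          expand : ∀ {a′ c′} → (b + a′) * (e + c′) + b * e ≡ (b + a′ ∸ b) * (e + c′ ∸ e) + (b * (e + c′) + (b + a′) * e)
          expand {a′} {c′} = trans (ring b a′ e c′) (sym (cong₂ (λ x y → x * y + (b * (e + c′) + (b + a′) * e)) (m+n∸m≡n b a′) (m+n∸m≡n e c′)))
            where
            ring : ∀ b a e c → (b + a) * (e + c) + b * e ≡ a * c + (b * (e + c) + (b + a) * e)
            ring = solve-∀

        #P : # P? ≡ (q ^ n ∸ q ^ (t + i)) * (Q ∸ q ^ suc i)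
        #P = product (^-monoʳ-≤ q t+i≤n) (^-monoʳ-≤ q (≤-trans (1+u≡⇒< e) d≤ℓ))
          (trans (cong (# P? +_) (sym (cong₂ _+_ A-card B-card))) (trans (count-outside A B) (cong₂ _+_ (^-distribˡ-+-* q n ℓ) A∩B-card)))
          where
          t+i≤n : t + i ≤ n
          t+i≤n = subst (t + i ≤_) n≡ (+-monoʳ-≤ t (<⇒≤ (1+u≡⇒< e)))

        -- F avoids W and meets M inside X, so it meets A and B only in S: all its vectors outside S
        -- are candidates. Their number is the first factor of `#P` and cancels, leaving Q - q^(i+1)
        -- for each step.
        #PF : ∀ F → ds F ⊓ M ⊑ X → S ⊑ ds F → # (λ v → P? v ×-dec dec (ds F) v) ≡ q ^ n ∸ q ^ (t + i)
        #PF F F∩M S⊑F = trans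
          (#-cong (λ v → P? v ×-dec dec (ds F) v) (λ v → dec (ds F) v ×-dec ¬? (dec S v))
            (λ { v ((v∉A , _) , v∈F) → v∈F , λ v∈S → v∉A (⊞-upperˡ S W v v∈S) })
            (λ { v (v∈F , v∉S) → ((λ v∈A → v∉S (backA v v∈F v∈A)) , (λ v∈B → v∉S (backB v v∈F v∈B))) , v∈F }))
          (trans (card-∖ (ds F) S) (cong₂ _∸_ (dim F) (trans (card-cong {ds F ⊓ S} {S} (λ _ → proj₂) (λ v v∈ → S⊑F v v∈ , v∈)) eS)))
          where
          backA : ∀ v → v ∈ₛ ds F → v ∈ₛ A → v ∈ₛ S
          backA _ v∈F (a , a∈ , b , b∈ , refl) with off-zero F b (∋-cancelˡ (sub (ds F)) (S⊑F a a∈) v∈F) b∈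
          ... | refl = subst (_∈ₛ S) (sym (⊕-identityʳ a)) a∈
          backB : ∀ v → v ∈ₛ ds F → v ∈ₛ B → v ∈ₛ S
          backB _ v∈F (a , a∈ , b , b∈ , refl) = ∋-⊕ (sub S) a∈ (X⊑S b (F∩M b (∋-cancelˡ (sub (ds F)) (S⊑F a a∈) v∈F , b∈)))

      degree-minimal : ∀ u {i S} → i + u ≡ d → ∣ S ∣ ≡ q ^ (t + i) → X ⊑ S → Disjoint S W →
                  (∀ v → v ∈ₛ S → v ∈ₛ M → v ∈ₛ X) → degree minimal S ≡ prodFrom i u
      degree-minimal zero {i} {S} e eS X⊑S S-off S∩M =
        degree-self minimal {S} (trans eS (cong (q ^_) (trans (cong (t +_) (trans (sym (+-identityʳ i)) e)) n≡))) S-off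
          (λ { F F≈S v (v∈F , v∈M) → S∩M v (proj₁ F≈S v v∈F) v∈M })
      degree-minimal (suc u) {i} {S} e eS X⊑S S-off S∩M =
        *-cancelˡ-≡ _ _ (q ^ n ∸ q ^ (t + i)) ⦃ ∸-nonZero (subst (t + i <_) n≡ (+-monoʳ-< t (1+u≡⇒< e))) ⦄
          (trans (branch-≡ minimal S P? #PF next)
            (trans (cong (_* prodFrom (suc i) u) #P) (*-assoc (q ^ n ∸ q ^ (t + i)) (Q ∸ q ^ suc i) _)))
        where
        open Step {i} {u} {S} e eS X⊑S S-off S∩M
        next : ∀ v → ¬ (v ∈ₛ A) × ¬ (v ∈ₛ B) → degree minimal (S ⊹ v) ≡ prodFrom (suc i) u
        next v (v∉A , v∉B) = degree-minimal u {suc i} {S ⊹ v} (trans (sym (+-suc i u)) e)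
          (trans (card-⊹ {S} (λ v∈S → v∉A (⊞-upperˡ S W v v∈S))) (trans (cong (q *_) eS) (cong (q ^_) (sym (+-suc t i)))))
          (⊑-trans {X} {S} {S ⊹ v} X⊑S (⊹-upper S v))
          (λ x x∈ x∈W → S-off x (⊹-meet {S} {v} W v∉A x x∈ x∈W) x∈W)
          (λ x x∈ x∈M → S∩M x (⊹-meet {S} {v} M v∉B x x∈ x∈M) x∈M)

      big : ∀ F → Dec (X ⊑ ds F × Big F)
      big F = (X ⊑? ds F) ×-dec (q ^ suc t ≤? ∣ ds F ⊓ M ∣)

      lowNotX : ∀ F → Dec (ds F ⊑ M × ¬ (X ⊑ ds F))
      lowNotX F = low F ×-dec ¬? (X ⊑? ds F)

      low⇒Big : ∀ {F} → ds F ⊑ M → Big F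
      low⇒Big {F} F⊑M = ≤-trans (^-monoʳ-≤ q (subst (suc t ≤_) n≡ (m<m+n t 0<d)))
        (≤-reflexive (trans (sym (dim F)) (card-cong {ds F} {ds F ⊓ M} (λ v v∈ → v∈ , F⊑M v v∈) (λ _ → proj₁))))

      -- For a member containing X, dimension at least t + 1 of its meet with M and containment of
      -- that meet in X are complementary, because the meet contains X.
      size-X : degree all X ≡ size big + degree minimal X
      size-X = trans (∑-cong 𝔸 λ F → partition F (X ⊑? ds F) (q ^ suc t ≤? ∣ ds F ⊓ M ∣) (minimal F)) (∑-+ 𝔸 _ _)
        where
        partition : ∀ F (x : Dec (X ⊑ ds F)) (y : Dec (Big F)) (z : Dec (ds F ⊓ M ⊑ X)) →
                    ⟦ yes tt ×-dec x ⟧ ≡ ⟦ x ×-dec y ⟧ + ⟦ z ×-dec x ⟧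
        partition F (no _) y (yes _) = refl
        partition F (no _) y (no _) = refl
        partition F (yes X⊑F) (yes b) (yes z) = ⊥-elim (<⇒≱ (^-monoʳ-< q 1<q (n<1+n t))
          (≤-trans b (≤-trans (card-mono {ds F ⊓ M} {X} z) (≤-reflexive X-card))))
        partition F (yes X⊑F) (yes b) (no _) = refl
        partition F (yes X⊑F) (no _) (yes _) = refl
        partition F (yes X⊑F) (no ¬b) (no ¬z) = ⊥-elim (¬z (card-tight {X} {ds F ⊓ M} (λ v v∈ → X⊑F v v∈ , X⊑M v v∈)
          (≤-trans (card-≤-pred (ds F ⊓ M) t (≰⇒> ¬b)) (≤-reflexive (sym X-card)))))

      size-low : q ^ n ≡ q ^ d + size lowNotX
      size-low = begin
        q ^ n                                         ≡⟨ sym (degree-low n {0} {zeroS} refl (zeroS-⊑ M) card-zero (λ { _ v≡0 _ → v≡0 })) ⟩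
        degree low zeroS                                   ≡⟨ degree-zeroS low ⟩
        size low                                      ≡⟨ size-split low (λ F → X ⊑? ds F) ⟩
        degree low X + size lowNotX                        ≡⟨ cong (_+ size lowNotX) (degree-low d {t} {X} n≡ X⊑M X-card X-off) ⟩
        q ^ d + size lowNotX ∎
        where open ≡-Reasoning

      -- A member inside M meets M in dimension n ≥ t + 1, so if it contains X it is counted
      -- already; only those missing X are added.
      size-H₁′ : size H₁ ≡ size big + size lowNotX
      size-H₁′ = trans (∑-cong 𝔸 λ F → partition F (X ⊑? ds F) (q ^ suc t ≤? ∣ ds F ⊓ M ∣) (ds F ⊑? M)) (∑-+ 𝔸 _ _)
        where
        partition : ∀ F (x : Dec (X ⊑ ds F)) (y : Dec (Big F)) (z : Dec (ds F ⊑ M)) →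
                    ⟦ (x ×-dec y) ⊎-dec z ⟧ ≡ ⟦ x ×-dec y ⟧ + ⟦ z ×-dec ¬? x ⟧
        partition F (yes _) (yes _) (yes _) = refl
        partition F (yes _) (yes _) (no _) = refl
        partition F (yes _) (no ¬b) (yes z) = ⊥-elim (¬b (low⇒Big {F} z))
        partition F (yes _) (no ¬b) (no _) = refl
        partition F (no _) y (yes _) = refl
        partition F (no _) y (no _) = refl

    size-H₁ : size H₁ + (prodTerm q ℓ d + q ^ d) ≡ Q ^ d + q ^ n
    size-H₁ = begin
      size H₁ + (prodTerm q ℓ d + q ^ d)                    ≡⟨ cong₂ (λ x y → x + (y + q ^ d)) size-H₁′ (sym minimal-X) ⟩
      size big + size lowNotX + (degree minimal X + q ^ d)       ≡⟨ gather (size big) (size lowNotX) (degree minimal X) (q ^ d) ⟩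
      size big + degree minimal X + (q ^ d + size lowNotX)       ≡⟨ cong₂ _+_ (sym size-X) (sym size-low) ⟩
      degree all X + q ^ n                                       ≡⟨ cong (_+ q ^ n) (extensions d {t} {X} n≡ X-card X-off) ⟩
      Q ^ d + q ^ n ∎
      where
      open ≡-Reasoning
      gather : ∀ x y z w → x + y + (z + w) ≡ x + z + (w + y)
      gather = solve-∀
      minimal-X : degree minimal X ≡ prodTerm q ℓ d
      minimal-X = trans (degree-minimal d {0} {X} refl (trans X-card (cong (q ^_) (sym (+-identityʳ t)))) (λ _ x → x) X-off (λ _ x _ → x)) (prodFrom-0 d)

-- Structure of intersecting families

module Intersecting (𝔽 : FiniteField) (n ℓ : ℕ)
  (W : Vectors.Decidable.DS 𝔽 (n + ℓ))
  (W-card : Vectors.Decidable.∣_∣ 𝔽 (n + ℓ) W ≡ FiniteField.size 𝔽 ^ ℓ) where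

  open Vectors 𝔽
  open Decidable (n + ℓ)
  open Attenuated 𝔽 n ℓ W W-card
  open Extremal 𝔽 n ℓ W W-card

  private variable p r : Level

  representative : ∀ F → Any (λ G → ds G ≈ ds F) 𝔸
  representative F with any? (λ G → ds G ≈? ds F) 𝔸
  ... | yes x = x
  ... | no none = ⊥-elim (0≢1+n (trans (sym (absent 𝔸 none)) (𝔸-once F)))
    where
    absent : ∀ Gs → ¬ Any (λ G → ds G ≈ ds F) Gs → (∑[ G ← Gs ] ⟦ ds G ≈? ds F ⟧) ≡ 0
    absent [] _ = refl
    absent (G ∷ Gs) none = cong₂ _+_ (⟦⟧-no (ds G ≈? ds F) (λ x → none (here x))) (absent Gs (λ x → none (there x)))

  ∃Member? : {P : Member → Set p} → (∀ F → Dec (P F)) → (∀ {F G} → ds F ≈ ds G → P F → P G) → Dec (∃ P)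
  ∃Member? P? resp = map′ Any.satisfied
    (λ { (F , pF) → Any.map (λ {G} G≈F → resp (≈-sym {ds G} {ds F} G≈F) pF) (representative F) })
    (any? P? 𝔸)

  sum-big : ∀ t A B → q ^ t ≤ ∣ A ∣ → q ^ t ≤ ∣ B ∣ → ∣ A ⊓ B ∣ < q ^ t → q ^ suc t ≤ ∣ A ⊞ B ∣
  sum-big t A B a b ab = card-≥-suc (A ⊞ B) t (≰⇒> λ le → <⇒≱
    (<-≤-trans (*-monoʳ-< (∣ A ⊞ B ∣) ⦃ >-nonZero (1≤card (A ⊞ B)) ⦄ ab) (*-monoˡ-≤ (q ^ t) le))
    (≤-trans (*-mono-≤ a b) (≤-reflexive (sym (card-⊞ A B)))))

  -- A member containing S meets C in dimension ≥ t, hence in a vector outside S.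
  branch-cover : ∀ t k {Ψ : Member → Set p} (Ψ? : ∀ F → Dec (Ψ F)) C S {c} → ∣ C ∣ ≡ q ^ (t + k) →
    (∀ F → Ψ F → q ^ t ≤ ∣ ds F ⊓ C ∣) → ∣ C ⊓ S ∣ < q ^ t →
    (∀ v → ¬ (v ∈ₛ S) → degree Ψ? (S ⊹ v) ≤ c) → degree Ψ? S ≤ θ q (suc k) * c
  branch-cover t k Ψ? C S {c} C-card cover small h with card-power (C ⊓ S)
  ... | r , er = *-cancelˡ-≤ (q ^ t ∸ q ^ r) ⦃ ∸-nonZero r<t ⦄ (begin
    (q ^ t ∸ q ^ r) * degree Ψ? S                       ≡⟨ cong ((q ^ t ∸ q ^ r) *_) (sym (*-identityˡ _)) ⟩
    (q ^ t ∸ q ^ r) * (1 * degree Ψ? S)                 ≤⟨ branch-≤ Ψ? S P? 1 many (λ { v (_ , v∉) → ≤-trans (≤-reflexive (*-identityˡ _)) (h v v∉) }) ⟩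
    # P? * c                                       ≡⟨ cong (_* c) (trans (card-∖ C S) (cong₂ _∸_ C-card er)) ⟩
    (q ^ (t + k) ∸ q ^ r) * c                      ≤⟨ *-monoˡ-≤ c (branch-ratio r t k r<t) ⟩
    (q ^ t ∸ q ^ r) * θ q (suc k) * c              ≡⟨ *-assoc (q ^ t ∸ q ^ r) _ c ⟩
    (q ^ t ∸ q ^ r) * (θ q (suc k) * c) ∎)
    where
    open ≤-Reasoning
    r<t : r < t
    r<t = ^-cancel-< r t (subst (_< q ^ t) er small)
    P? : ∀ v → Dec (v ∈ₛ C × ¬ (v ∈ₛ S))
    P? v = dec C v ×-dec ¬? (dec S v)
    many : ∀ F → _ → S ⊑ ds F → q ^ t ∸ q ^ r ≤ # (λ v → P? v ×-dec dec (ds F) v)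
    many F ψ S⊑F = begin
      q ^ t ∸ q ^ r                                          ≤⟨ ∸-monoˡ-≤ (q ^ r) (cover F ψ) ⟩
      ∣ ds F ⊓ C ∣ ∸ q ^ r                                   ≡⟨ cong (∣ ds F ⊓ C ∣ ∸_) (trans (sym er) (card-cong {C ⊓ S} {(ds F ⊓ C) ⊓ S}
                                                                  (λ { v (v∈C , v∈S) → (S⊑F v v∈S , v∈C) , v∈S }) (λ { v ((_ , v∈C) , v∈S) → v∈C , v∈S }))) ⟩
      ∣ ds F ⊓ C ∣ ∸ ∣ (ds F ⊓ C) ⊓ S ∣                      ≡⟨ sym (card-∖ (ds F ⊓ C) S) ⟩
      # (λ v → dec (ds F ⊓ C) v ×-dec ¬? (dec S v))          ≤⟨ #-mono (λ v → dec (ds F ⊓ C) v ×-dec ¬? (dec S v)) (λ v → P? v ×-dec dec (ds F) v)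
                                                                  (λ { v ((v∈F , v∈C) , v∉S) → (v∈C , v∉S) , v∈F }) ⟩
      # (λ v → P? v ×-dec dec (ds F) v) ∎

  module Family {p : Level} (t e : ℕ) (n≡ : t + suc (suc e) ≡ n) (1≤t : 1 ≤ t)
    (large : (3 ≤ q × 4 + (e + (t + t)) ≤ ℓ) ⊎ 6 + (e + (t + t)) ≤ ℓ)
    {Φ : Member → Set p} (Φ? : ∀ F → Dec (Φ F)) (Φ-resp : ∀ {F G} → ds F ≈ ds G → Φ F → Φ G)
    (intersecting : ∀ {F G} → Φ F → Φ G → q ^ t ≤ ∣ ds F ⊓ ds G ∣)
    (nontrivial : ∀ S → ∣ S ∣ ≡ q ^ t → ∃ λ F → Φ F × ¬ (S ⊑ ds F)) where

    open Bounds q 1<q t e ℓ 1≤t large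

    private
      d Θ β : ℕ
      d = suc (suc e)
      Θ = θ q (suc d)
      β = Θ * Q ^ e

    -- Covers and the degree bounds they give.

    Cover : DS → Set _
    Cover S = ∀ F → Φ F → q ^ t ≤ ∣ ds F ⊓ S ∣

    -- Stated through a witness and not as a negation: the degree bound branches over the vectors of
    -- that member.
    NonCover : DS → Set _
    NonCover S = ∃ λ F → Φ F × ∣ ds F ⊓ S ∣ < q ^ t

    private
      ⊓-cong : ∀ {A A′ B B′} → A ≈ A′ → B ≈ B′ → ∣ A ⊓ B ∣ ≡ ∣ A′ ⊓ B′ ∣
      ⊓-cong {A} {A′} {B} {B′} (l , r) (l′ , r′) = card-cong {A ⊓ B} {A′ ⊓ B′}
        (λ { v (x , y) → l v x , l′ v y }) (λ { v (x , y) → r v x , r′ v y })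

      nonCover? : ∀ S → Dec (NonCover S)
      nonCover? S = ∃Member? (λ F → Φ? F ×-dec (∣ ds F ⊓ S ∣ <? q ^ t))
        (λ {F} {G} F≈G → λ { (φ , lt) → Φ-resp F≈G φ , subst (_< q ^ t) (⊓-cong {ds F} {ds G} {S} {S} F≈G (≈-refl {S})) lt })

      ¬NonCover⇒Cover : ∀ {S} → ¬ NonCover S → Cover S
      ¬NonCover⇒Cover none F φ = ≮⇒≥ (λ lt → none (F , φ , lt))

      NonCover-resp : ∀ {A B} → A ≈ B → NonCover A → NonCover B
      NonCover-resp {A} {B} A≈B (F , φ , lt) = F , φ , subst (_< q ^ t) (⊓-cong {ds F} {ds F} {A} {B} (≈-refl {ds F}) A≈B) lt

      -- The witness B has dimension t + d, meets S in dimension below t and every member in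
      -- dimension at least t. It thus serves as the cover to branch over, at the price θ_{d+1}.
      degree-nonCover : ∀ {r} {Ψ : Member → Set r} (Ψ? : ∀ F → Dec (Ψ F)) → (∀ F → Ψ F → Φ F) → ∀ S {c} → NonCover S →
                   (∀ v → ¬ (v ∈ₛ S) → degree Ψ? (S ⊹ v) ≤ c) → degree Ψ? S ≤ Θ * c
      degree-nonCover Ψ? Ψ⇒Φ S (B , φ , lt) h = branch-cover t d Ψ? (ds B) S (trans (dim B) (cong (q ^_) (sym n≡)))
        (λ F ψ → intersecting {F} {B} (Ψ⇒Φ F ψ) φ) lt h

      degree-nonCovers : ∀ k u m {S} → (∀ {m′ S} → m ≤ m′ → m′ < m + k → ∣ S ∣ ≡ q ^ m′ → NonCover S) →
                    ∣ S ∣ ≡ q ^ m → m + k + u ≡ n → degree Φ? S ≤ Θ ^ k * Q ^ u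
      degree-nonCovers zero u m {S} _ eS e′ = ≤-trans (degree-≤ Φ? u {m} {S} (trans (cong (_+ u) (sym (+-identityʳ m))) e′) eS) (≤-reflexive (sym (*-identityˡ _)))
      degree-nonCovers (suc k) u m {S} none eS e′ = ≤-trans
        (degree-nonCover Φ? (λ _ φ → φ) S (none {m} {S} ≤-refl (m<m+n m (s≤s z≤n)) eS)
          (λ v v∉ → degree-nonCovers k u (suc m) {S ⊹ v} (λ {m′} {S′} lo hi → none {m′} {S′} (≤-trans (n≤1+n m) lo) (subst (m′ <_) (sym (+-suc m k)) hi))
            (trans (card-⊹ {S} v∉) (cong (q *_) eS)) (trans (cong (_+ u) (sym (+-suc m k))) e′)))
        (≤-reflexive (sym (*-assoc Θ (Θ ^ k) (Q ^ u))))

      dim-t⇒NonCover : ∀ {S} → ∣ S ∣ ≡ q ^ t → NonCover S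
      dim-t⇒NonCover {S} eS with nontrivial S eS
      ... | F , φ , S⋢F = F , φ , ≰⇒> λ le → S⋢F (λ v v∈ → proj₁ (card-tight {ds F ⊓ S} {S} (λ _ → proj₂) (≤-trans (≤-reflexive eS) le) v v∈))

      MinimalCover : ℕ → Set _
      MinimalCover k = (∃ λ C → ∣ C ∣ ≡ q ^ (t + k) × ¬ NonCover C) × (∀ {m S} → t ≤ m → m < t + k → ∣ S ∣ ≡ q ^ m → NonCover S)

      -- The upward search stops at k = d at the latest, since any member is a cover of dimension n
      -- = t + d. A member exists by non-triviality applied to an arbitrary t-space.
      minimalCover : ∃ λ k → 1 ≤ k × k ≤ d × MinimalCover k
      minimalCover = go (suc e) 1 (+-comm (suc e) 1) (s≤s z≤n) (λ {m} {S} lo hi eS → dim-t⇒NonCover {S} (trans eS (cong (q ^_) (≤-antisym (≤-pred (subst (m <_) (+-comm t 1) hi)) lo))))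
        where
        some : ∃ Φ
        some with subspaceOfDim wholeS t (≤-trans (^-monoʳ-≤ q (≤-trans (m≤m+n t d) (≤-trans (≤-reflexive n≡) (m≤m+n n ℓ)))) (≤-reflexive (sym card-whole)))
        ... | S , _ , eS with nontrivial S eS
        ...   | F , φ , _ = F , φ
        go : ∀ fuel k → fuel + k ≡ d → 1 ≤ k → (∀ {m S} → t ≤ m → m < t + k → ∣ S ∣ ≡ q ^ m → NonCover S) → ∃ λ k → 1 ≤ k × k ≤ d × MinimalCover k
        go zero .d refl 1≤k none = d , 1≤k , ≤-refl , (ds (proj₁ some) , trans (dim (proj₁ some)) (cong (q ^_) (sym n≡)) ,
          λ { (F , φ , lt) → <⇒≱ lt (intersecting {F} {proj₁ some} φ (proj₂ some)) }) , (λ {m} {S} → none {m} {S})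
        go (suc fuel) k e′ 1≤k none with ∃DS? (t + k) (λ S → ¬? (nonCover? S)) (λ {A} {B} A≈B ¬nc nc → ¬nc (NonCover-resp {B} {A} (≈-sym {A} {B} A≈B) nc))
        ... | yes C = k , 1≤k , ≤-trans (m≤n+m k (suc fuel)) (≤-reflexive e′) , C , (λ {m} {S} → none {m} {S})
        ... | no ¬C = go fuel (suc k) (trans (+-suc fuel k) e′) (s≤s z≤n) (λ {m} {S} → next {m} {S})
          where
          next : ∀ {m S} → t ≤ m → m < t + suc k → ∣ S ∣ ≡ q ^ m → NonCover S
          next {m} {S} lo hi eS with m <? t + k
          ... | yes m<t+k = none {m} {S} lo m<t+k eS
          ... | no m≮t+k with nonCover? S
          ...   | yes nc = nc
          ...   | no ¬nc = ⊥-elim (¬C (S , trans eS (cong (q ^_) (≤-antisym (≤-pred (subst (m <_) (+-suc t k) hi)) (≮⇒≥ m≮t+k))) , ¬nc))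

      -- Each member meets a cover C in dimension ≥ t; count through the t-dimensional subspaces of C.
      module _ {r} {Ψ : Member → Set r} (Ψ? : ∀ F → Dec (Ψ F)) (C : DS) (m : ℕ) (C-card : ∣ C ∣ ≡ q ^ m)
        (cover : ∀ F → Ψ F → q ^ t ≤ ∣ ds F ⊓ C ∣) where

        open Chain Ψ? C zeroS m 0 t (zeroS-⊑ C) C-card card-zero (λ F _ → disjoint-zeroS {ds F})

        size-cover : ∀ κ g → (∀ {i u} → i + suc u ≡ t → (q ^ m ∸ q ^ (i + 0)) * g u ≤ (q ^ t ∸ q ^ i) * g (suc u)) →
                     (∀ {S} → ∣ S ∣ ≡ q ^ t → κ * degree Ψ? S ≤ g 0) → κ * size Ψ? ≤ g t
        size-cover κ g step base = subst (λ z → κ * z ≤ g t) (degree-zeroS Ψ?)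
          (chain-≤ κ g cover step (λ { {S} (inside _ eS _) → base {S} eS }) t {0} {zeroS} refl
            (inside (zeroS-⊑ C) card-zero (disjoint-zeroS {zeroS})))

      size-cover₁ : ∀ {r} {Ψ : Member → Set r} (Ψ? : ∀ F → Dec (Ψ F)) T b → ∣ T ∣ ≡ q ^ suc t → (∀ F → Ψ F → q ^ t ≤ ∣ ds F ⊓ T ∣) →
                    (∀ {S} → ∣ S ∣ ≡ q ^ t → degree Ψ? S ≤ b) → size Ψ? ≤ θ q (suc t) * b
      size-cover₁ Ψ? T b eT cover base = subst (_≤ θ q (suc t) * b) (*-identityˡ _)
        (size-cover Ψ? T (suc t) eT cover 1 (λ u → θ q (suc u) * b) (λ e → ≤-reflexive (hyperplane-step b e))
          (λ {S} eS → ≤-trans (≤-reflexive (*-identityˡ _)) (≤-trans (base {S} eS) (≤-reflexive (sym (*-identityˡ b))))))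

      -- The factor q + 1 keeps the Gaussian binomial [t + 2 over t] integral along the chain.
      size-cover₂ : ∀ C b → ∣ C ∣ ≡ q ^ (t + 2) → Cover C → (∀ {S} → ∣ S ∣ ≡ q ^ t → degree Φ? S ≤ b) →
                    suc q * size Φ? ≤ θ q (suc (suc t)) * θ q (suc t) * b
      size-cover₂ C b eC cover base = size-cover Φ? C (t + 2) eC cover (suc q) (λ u → θ q (suc (suc u)) * θ q (suc u) * b) step
        (λ {S} eS → ≤-trans (*-monoʳ-≤ (suc q) (base {S} eS)) (≤-reflexive (ring q b)))
        where
        ring : ∀ q b → suc q * b ≡ (q * 1 + (1 + 0)) * (1 + 0) * b
        ring = solve-∀
        step : ∀ {i u} → i + suc u ≡ t → (q ^ (t + 2) ∸ q ^ (i + 0)) * (θ q (suc (suc u)) * θ q (suc u) * b) ≤ (q ^ t ∸ q ^ i) * (θ q (suc (suc (suc u))) * θ q (suc (suc u)) * b)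
        step {i} {u} refl = ≤-reflexive (begin
          (q ^ (i + suc u + 2) ∸ q ^ (i + 0)) * (θ q (suc (suc u)) * θ q (suc u) * b)
            ≡⟨ cong₂ (λ z w → (q ^ z ∸ q ^ w) * (θ q (suc (suc u)) * θ q (suc u) * b)) (exponent i u) (+-identityʳ i) ⟩
          (q ^ (i + suc (suc (suc u))) ∸ q ^ i) * (θ q (suc (suc u)) * θ q (suc u) * b)
            ≡⟨ cong (_* (θ q (suc (suc u)) * θ q (suc u) * b)) (q^∸q^ i (suc (suc (suc u)))) ⟩
          q ^ i * (pred q * θ q (suc (suc (suc u)))) * (θ q (suc (suc u)) * θ q (suc u) * b)
            ≡⟨ rearrange (q ^ i) (pred q) (θ q (suc (suc (suc u)))) (θ q (suc (suc u))) (θ q (suc u)) b ⟩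
          q ^ i * (pred q * θ q (suc u)) * (θ q (suc (suc (suc u))) * θ q (suc (suc u)) * b)
            ≡⟨ cong (_* (θ q (suc (suc (suc u))) * θ q (suc (suc u)) * b)) (sym (q^∸q^ i (suc u))) ⟩
          (q ^ (i + suc u) ∸ q ^ i) * (θ q (suc (suc (suc u))) * θ q (suc (suc u)) * b) ∎)
          where
          open ≡-Reasoning
          exponent : ∀ i u → i + suc u + 2 ≡ i + suc (suc (suc u))
          exponent = solve-∀
          rearrange : ∀ x y a b c z → x * (y * a) * (b * c * z) ≡ x * (y * c) * (a * b * z)
          rearrange = solve-∀

      -- q^((k+1)t) is a crude bound for the Gaussian binomial [t + k over t]: each of the t steps
      -- costs at most θ_{k+1} ≤ q^(k+1).
      size-cover₃ : ∀ k C b → ∣ C ∣ ≡ q ^ (t + k) → Cover C → (∀ {S} → ∣ S ∣ ≡ q ^ t → degree Φ? S ≤ b) →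
                    size Φ? ≤ q ^ (suc k * t) * b
      size-cover₃ k C b eC cover base = subst (_≤ q ^ (suc k * t) * b) (*-identityˡ _)
        (size-cover Φ? C (t + k) eC cover 1 (λ u → q ^ (suc k * u) * b) step
          (λ {S} eS → ≤-trans (≤-reflexive (*-identityˡ _)) (≤-trans (base {S} eS)
            (≤-reflexive (sym (trans (cong (λ z → q ^ z * b) (*-zeroʳ (suc k))) (*-identityˡ b)))))))
        where
        open ≤-Reasoning
        step : ∀ {i u} → i + suc u ≡ t → (q ^ (t + k) ∸ q ^ (i + 0)) * (q ^ (suc k * u) * b) ≤ (q ^ t ∸ q ^ i) * (q ^ (suc k * suc u) * b)
        step {i} {u} eq = begin
          (q ^ (t + k) ∸ q ^ (i + 0)) * (q ^ (suc k * u) * b)       ≡⟨ cong (λ z → (q ^ (t + k) ∸ q ^ z) * (q ^ (suc k * u) * b)) (+-identityʳ i) ⟩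
          (q ^ (t + k) ∸ q ^ i) * (q ^ (suc k * u) * b)             ≤⟨ *-monoˡ-≤ _ (branch-ratio i t k (1+u≡⇒< eq)) ⟩
          (q ^ t ∸ q ^ i) * θ q (suc k) * (q ^ (suc k * u) * b)     ≤⟨ *-monoˡ-≤ _ (*-monoʳ-≤ (q ^ t ∸ q ^ i) (θ≤q^ (suc k))) ⟩
          (q ^ t ∸ q ^ i) * q ^ suc k * (q ^ (suc k * u) * b)       ≡⟨ rearrange (q ^ t ∸ q ^ i) (q ^ suc k) (q ^ (suc k * u)) b ⟩
          (q ^ t ∸ q ^ i) * (q ^ suc k * q ^ (suc k * u) * b)       ≡⟨ cong (λ z → (q ^ t ∸ q ^ i) * (z * b)) (trans (sym (^-distribˡ-+-* q (suc k) (suc k * u))) (cong (q ^_) (sym (*-suc (suc k) u)))) ⟩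
          (q ^ t ∸ q ^ i) * (q ^ (suc k * suc u) * b) ∎
          where
          rearrange : ∀ x y z w → x * y * (z * w) ≡ x * (y * z * w)
          rearrange = solve-∀

      -- Heavy subspaces.

      Heavy : DS → Set
      Heavy T = ∣ T ∣ ≡ q ^ suc t × β < degree Φ? T

      heavy? : ∀ T → Dec (β < degree Φ? T)
      heavy? T = β <? degree Φ? T

      degree-resp : ∀ {A B} → A ≈ B → β < degree Φ? A → β < degree Φ? B
      degree-resp {A} {B} (_ , r) lt = <-≤-trans lt (degree-mono Φ? Φ? {A} {B} (λ F φ A⊑F → φ , ⊑-trans {B} {A} {ds F} r A⊑F))

      heavy-dim+1 : ∀ {T} → Heavy T → ∀ v → ¬ (v ∈ₛ T) → degree Φ? (T ⊹ v) ≤ Q ^ e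
      heavy-dim+1 {T} (eT , _) v v∉ = degree-≤ Φ? e {suc (suc t)} {T ⊹ v} (trans (shift t e) n≡) (trans (card-⊹ {T} v∉) (cong (q *_) eT))
        where
        shift : ∀ t e → suc (suc t) + e ≡ t + suc (suc e)
        shift = solve-∀

      -- A (t+2)-space has degree at most Q^e, so a (t+1)-space that is not a cover has degree at
      -- most Θ Q^e. The threshold `β` is this value.
      heavy⇒Cover : ∀ {T} → Heavy T → Cover T
      heavy⇒Cover {T} h = ¬NonCover⇒Cover {T} λ nc → <⇒≱ (proj₂ h) (degree-nonCover Φ? (λ _ φ → φ) T nc (heavy-dim+1 {T} h))

      -- T′ is itself a cover, of dimension only t + 1, so branching over it would cost θ_2 ≤ Θ and
      -- push the degree of T down to `β`.
      heavy-meet : ∀ {T T′} → Heavy T → Heavy T′ → q ^ t ≤ ∣ T ⊓ T′ ∣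
      heavy-meet {T} {T′} h h′ = ≮⇒≥ λ lt → <⇒≱ (proj₂ h) (≤-trans
        (branch-cover t 1 Φ? T′ T (trans (proj₁ h′) (cong (q ^_) (+-comm 1 t))) (heavy⇒Cover {T′} h′)
          (subst (_< q ^ t) (card-cong {T ⊓ T′} {T′ ⊓ T} (λ { _ (x , y) → y , x }) (λ { _ (x , y) → y , x })) lt)
          (heavy-dim+1 {T} h))
        (*-monoˡ-≤ (Q ^ e) (θ-mono {2} {suc d} (s≤s (s≤s z≤n)))))

      heavy-off : ∀ {T} → Heavy T → Disjoint T W
      heavy-off {T} (_ , lt) with (T ⊓ W) ⊑? zeroS
      ... | yes disj = λ v x y → disj v (x , y)
      ... | no meets = ⊥-elim (<⇒≱ lt (≤-trans (≤-reflexive (degree-none Φ? {T} λ F _ T⊑F → meets λ { v (x , y) → off-zero F v (T⊑F v x) y })) z≤n))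

      -- T has θ_{t+1} subspaces of dimension t, none of them a cover, and each branches at cost Θ
      -- into (t+1)-spaces. Such a space contributes at most `β`: if it is heavy, no member of Ψ
      -- contains it.
      size-light : ∀ {r} {Ψ : Member → Set r} (Ψ? : ∀ F → Dec (Ψ F)) T → ∣ T ∣ ≡ q ^ suc t → Cover T → (∀ F → Ψ F → Φ F) →
                   (∀ F → Ψ F → ∀ {T′} → Heavy T′ → ¬ (T′ ⊑ ds F)) → size Ψ? ≤ θ q (suc t) * (Θ * β)
      size-light Ψ? T eT cover Ψ⇒Φ light = size-cover₁ Ψ? T (Θ * β) eT (λ F ψ → cover F (Ψ⇒Φ F ψ))
        (λ {S} eS → degree-nonCover Ψ? Ψ⇒Φ S (dim-t⇒NonCover {S} eS) (λ v v∉ → bound (S ⊹ v) (trans (card-⊹ {S} v∉) (cong (q *_) eS))))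
        where
        bound : ∀ T′ → ∣ T′ ∣ ≡ q ^ suc t → degree Ψ? T′ ≤ β
        bound T′ eT′ with heavy? T′
        ... | yes lt = ≤-trans (≤-reflexive (degree-none Ψ? {T′} (λ F ψ → light F ψ {T′} (eT′ , lt)))) z≤n
        ... | no ¬lt = ≤-trans (degree-mono Ψ? Φ? {T′} {T′} (λ F ψ T′⊑F → Ψ⇒Φ F ψ , T′⊑F)) (≮⇒≥ ¬lt)

    -- The last two constructors record only that the family lies inside an extremal one; the sizes
    -- decide later which of them can be attained for a given t.
    data Outcome : Set (lsuc 0ℓ ⊔ p) where
      small  : Small (size Φ?) → Outcome
      small₂ : size Φ? ≤ q ^ suc t * Q ^ suc e → Outcome
      hiltonMilner : ∀ X M → ∣ X ∣ ≡ q ^ t → Disjoint X W → ∣ M ∣ ≡ q ^ suc n → ∣ M ⊓ W ∣ ≡ q ^ 1 → X ⊑ M →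
        (∀ F → Φ F → (X ⊑ ds F × q ^ suc t ≤ ∣ ds F ⊓ M ∣) ⊎ ds F ⊑ M) → Outcome
      star : ∀ Z → ∣ Z ∣ ≡ q ^ suc (suc t) → Disjoint Z W → (∀ F → Φ F → q ^ suc t ≤ ∣ ds F ⊓ Z ∣) → Outcome

    private

      -- All heavy subspaces pass through a common t-space X.

      module Pencil (T : DS) (heavy : Heavy T) (X : DS) (X-card : ∣ X ∣ ≡ q ^ t) (X⊑T : X ⊑ T)
        (common : ∀ {T′} → Heavy T′ → X ⊑ T′) where

        not-containing : ∀ {B} → ¬ (X ⊑ B) → ∣ X ⊓ B ∣ < q ^ t
        not-containing {B} X⋢B = subst (∣ X ⊓ B ∣ <_) X-card (card-strict {X ⊓ B} {X} (λ _ → proj₁) (λ X⊑ → X⋢B (λ v v∈ → proj₂ (X⊑ v v∈))))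

        -- B meets T in dimension at least t, and T has dimension t + 1, so B loses at most one
        -- dimension of X.
        meet-X : ∀ {B} → Φ B → ¬ (X ⊑ ds B) → ∣ X ⊓ ds B ∣ * q ≡ q ^ t
        meet-X {B} φ X⋢B = ≤-antisym upper lower
          where
          upper : ∣ X ⊓ ds B ∣ * q ≤ q ^ t
          upper with card-power (X ⊓ ds B)
          ... | j , ej = subst (λ z → z * q ≤ q ^ t) (sym ej) (subst (_≤ q ^ t) (*-comm q (q ^ j)) (^-monoʳ-≤ q (^-cancel-< j t (subst (_< q ^ t) ej (not-containing {ds B} X⋢B)))))
          lower : q ^ t ≤ ∣ X ⊓ ds B ∣ * q
          lower = *-cancelˡ-≤ (q ^ t) ⦃ m^n≢0 q t ⦄ (begin
            q ^ t * q ^ t                                 ≤⟨ *-mono-≤ (≤-reflexive (sym X-card)) (heavy⇒Cover {T} heavy B φ) ⟩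
            ∣ X ∣ * ∣ ds B ⊓ T ∣                          ≡⟨ sym (card-⊞ X (ds B ⊓ T)) ⟩
            ∣ X ⊞ (ds B ⊓ T) ∣ * ∣ X ⊓ (ds B ⊓ T) ∣       ≤⟨ *-mono-≤ (≤-trans (card-mono {X ⊞ (ds B ⊓ T)} {T} (⊞-least {X} {ds B ⊓ T} {T} X⊑T (λ _ → proj₂))) (≤-reflexive (proj₁ heavy)))
                                                               (card-mono {X ⊓ (ds B ⊓ T)} {X ⊓ ds B} (λ { v (x , y , _) → x , y })) ⟩
            q * q ^ t * ∣ X ⊓ ds B ∣                      ≡⟨ rearrange q (q ^ t) (∣ X ⊓ ds B ∣) ⟩
            q ^ t * (∣ X ⊓ ds B ∣ * q) ∎)
            where
            open ≤-Reasoning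
            rearrange : ∀ x y z → x * y * z ≡ y * (z * x)
            rearrange = solve-∀

        join-card : ∀ {B} → Φ B → ¬ (X ⊑ ds B) → ∣ X ⊞ ds B ∣ ≡ q ^ suc n
        join-card {B} φ X⋢B = *-cancelʳ-≡ _ _ (∣ X ⊓ ds B ∣) ⦃ >-nonZero (1≤card (X ⊓ ds B)) ⦄ (begin
          ∣ X ⊞ ds B ∣ * ∣ X ⊓ ds B ∣         ≡⟨ card-⊞ X (ds B) ⟩
          ∣ X ∣ * ∣ ds B ∣                    ≡⟨ cong₂ _*_ (trans X-card (sym (meet-X {B} φ X⋢B))) (dim B) ⟩
          ∣ X ⊓ ds B ∣ * q * q ^ n            ≡⟨ trans (*-assoc (∣ X ⊓ ds B ∣) q _) (*-comm (∣ X ⊓ ds B ∣) _) ⟩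
          q ^ suc n * ∣ X ⊓ ds B ∣ ∎)
          where open ≡-Reasoning

        -- T′ is generated by X and ds B ⊓ T′: both have dimension at least t, and they meet in
        -- dimension below t because B does not contain X.
        heavy⊑join : ∀ {B T′} → Φ B → ¬ (X ⊑ ds B) → Heavy T′ → T′ ⊑ X ⊞ ds B
        heavy⊑join {B} {T′} φ X⋢B h′ = ⊑-trans {T′} {X ⊞ (ds B ⊓ T′)} {X ⊞ ds B}
          (card-tight {X ⊞ (ds B ⊓ T′)} {T′} (⊞-least {X} {ds B ⊓ T′} {T′} (common {T′} h′) (λ _ → proj₂))
            (≤-trans (≤-reflexive (proj₁ h′)) (sum-big t X (ds B ⊓ T′) (≤-reflexive (sym X-card)) (heavy⇒Cover {T′} h′ B φ)
              (≤-<-trans (card-mono {X ⊓ (ds B ⊓ T′)} {X ⊓ ds B} (λ { v (x , y , _) → x , y })) (not-containing {ds B} X⋢B)))))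
          (⊞-least {X} {ds B ⊓ T′} {X ⊞ ds B} (⊞-upperˡ X (ds B)) (λ v v∈ → ⊞-upperʳ X (ds B) v (proj₁ v∈)))

        module _ (B : Member) (φB : Φ B) (X⋢B : ¬ (X ⊑ ds B)) where

          M : DS
          M = X ⊞ ds B

          -- ds B and W already span the whole space, hence so do M and W; comparing dimensions
          -- leaves 1 for the intersection.
          M-meet : ∣ M ⊓ W ∣ ≡ q ^ 1
          M-meet = *-cancelˡ-≡ _ _ (q ^ (n + ℓ)) ⦃ m^n≢0 q (n + ℓ) ⦄ (begin
            q ^ (n + ℓ) * ∣ M ⊓ W ∣           ≡⟨ cong (_* ∣ M ⊓ W ∣) (sym spans) ⟩
            ∣ M ⊞ W ∣ * ∣ M ⊓ W ∣             ≡⟨ card-⊞ M W ⟩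
            ∣ M ∣ * ∣ W ∣                     ≡⟨ cong₂ _*_ (join-card {B} φB X⋢B) W-card ⟩
            q * q ^ n * Q                     ≡⟨ rearrange q (q ^ n) Q ⟩
            q ^ n * Q * q ^ 1                 ≡⟨ cong (_* q ^ 1) (sym (^-distribˡ-+-* q n ℓ)) ⟩
            q ^ (n + ℓ) * q ^ 1 ∎)
            where
            open ≡-Reasoning
            rearrange : ∀ x y z → x * y * z ≡ y * z * (x * 1)
            rearrange = solve-∀
            spans : ∣ M ⊞ W ∣ ≡ q ^ (n + ℓ)
            spans = ≤-antisym (≤-trans (card-mono {M ⊞ W} {wholeS} (λ _ _ → tt)) (≤-reflexive card-whole))
              (≤-trans (≤-reflexive (sym (card-disjoint-⊞ {ds B} {W} {n} {ℓ} (off-zero B) (dim B) W-card)))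
                (card-mono {ds B ⊞ W} {M ⊞ W} (⊞-least {ds B} {W} {M ⊞ W} (⊑-trans {ds B} {M} {M ⊞ W} (⊞-upperʳ X (ds B)) (⊞-upperˡ M W)) (⊞-upperʳ M W))))

          -- F ⊓ M contains X together with F ⊓ B. The latter has dimension at least t and cannot
          -- contain X.
          big : ∀ {F} → Φ F → X ⊑ ds F → q ^ suc t ≤ ∣ ds F ⊓ M ∣
          big {F} φ X⊑F = ≤-trans
            (sum-big t X (ds F ⊓ ds B) (≤-reflexive (sym X-card)) (intersecting {F} {B} φ φB)
              (≤-<-trans (card-mono {X ⊓ (ds F ⊓ ds B)} {X ⊓ ds B} (λ { v (x , _ , y) → x , y })) (not-containing {ds B} X⋢B)))
            (card-mono {X ⊞ (ds F ⊓ ds B)} {ds F ⊓ M} (⊞-least {X} {ds F ⊓ ds B} {ds F ⊓ M}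
              (λ v v∈ → X⊑F v v∈ , ⊞-upperˡ X (ds B) v v∈) (λ { v (x , y) → x , ⊞-upperʳ X (ds B) v y })))

          -- A second member outside M confines the heavy subspaces to X ⊞ B′, hence to a hyperplane of M.
          module _ (B′ : Member) (φB′ : Φ B′) (X⋢B′ : ¬ (X ⊑ ds B′)) (B′⋢M : ¬ (ds B′ ⊑ M)) where

            M′ : DS
            M′ = X ⊞ ds B′

            P? : ∀ v → Dec (v ∈ₛ ds B × ¬ (v ∈ₛ X))
            P? v = dec (ds B) v ×-dec ¬? (dec X v)

            B⋢M′ : ¬ (ds B ⊑ M′)
            B⋢M′ B⊑M′ = B′⋢M (⊑-trans {ds B′} {M′} {M} (⊞-upperʳ X (ds B′))
              (card-tight {M} {M′} (⊞-least {X} {ds B} {M′} (⊞-upperˡ X (ds B′)) B⊑M′)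
                (≤-reflexive (trans (join-card {B′} φB′ X⋢B′) (sym (join-card {B} φB X⋢B))))))

            -- Branching runs over the vectors of B outside X, of which each member through X
            -- contains at least `a`. Those in M′ are charged Q^(e+1); there are at most a θ_d of
            -- them, as B ⊓ M′ is a proper subspace of B. For the others X ⊹ v is not inside M′,
            -- hence not heavy, and the charge is `β`; for uniformity `β` is charged to every
            -- vector.
            degree-X : degree Φ? X ≤ θ q d * Q ^ suc e + Θ * β
            degree-X with card-power (X ⊓ ds B)
            ... | j , ej = *-cancelˡ-≤ a ⦃ ∸-nonZero j<t ⦄ (begin
              a * degree Φ? X
                ≤⟨ branch-lower Φ? X P? many ⟩
              (∑[ v ← 𝕍 ] ⟦ P? v ⟧ * degree Φ? (X ⊹ v))
                ≤⟨ ∑-mono 𝕍 (λ v → pointwise v (P? v) (dec M′ v)) ⟩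
              (∑[ v ← 𝕍 ] (⟦ P? v ×-dec dec M′ v ⟧ * Q ^ suc e + ⟦ P? v ⟧ * β))
                ≡⟨ trans (∑-+ 𝕍 _ _) (cong₂ _+_ (∑-*ʳ 𝕍 (Q ^ suc e) _) (∑-*ʳ 𝕍 β _)) ⟩
              # (λ v → P? v ×-dec dec M′ v) * Q ^ suc e + # P? * β
                ≤⟨ +-mono-≤ (*-monoˡ-≤ (Q ^ suc e) inM′) (*-monoˡ-≤ β all-P) ⟩
              a * θ q d * Q ^ suc e + a * Θ * β
                ≡⟨ rearrange a (θ q d) (Q ^ suc e) Θ β ⟩
              a * (θ q d * Q ^ suc e + Θ * β) ∎)
              where
              open ≤-Reasoning
              a = q ^ t ∸ q ^ j
              rearrange : ∀ a x y z w → a * x * y + a * z * w ≡ a * (x * y + z * w)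
              rearrange = solve-∀
              j<t : j < t
              j<t = ^-cancel-< j t (subst (_< q ^ t) ej (not-containing {ds B} X⋢B))
              ej′ : ∀ {A} → X ⊓ ds B ⊑ A → ∣ (ds B ⊓ A) ⊓ X ∣ ≡ q ^ j
              ej′ {A} h = trans (card-cong {(ds B ⊓ A) ⊓ X} {X ⊓ ds B} (λ { v ((x , _) , y) → y , x }) (λ { v (x , y) → (y , h v (x , y)) , x })) ej
              many : ∀ F → Φ F → X ⊑ ds F → a ≤ # (λ v → P? v ×-dec dec (ds F) v)
              many F φ X⊑F = ≤-trans (∸-mono (intersecting {B} {F} φB φ) (≤-reflexive (ej′ {ds F} (λ v v∈ → X⊑F v (proj₁ v∈)))))
                (≤-trans (≤-reflexive (sym (card-∖ (ds B ⊓ ds F) X)))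
                  (#-mono (λ v → dec (ds B ⊓ ds F) v ×-dec ¬? (dec X v)) (λ v → P? v ×-dec dec (ds F) v) (λ { v ((x , y) , z) → (x , z) , y })))
              pointwise : ∀ v (x : Dec (v ∈ₛ ds B × ¬ (v ∈ₛ X))) (y : Dec (v ∈ₛ M′)) →
                          ⟦ x ⟧ * degree Φ? (X ⊹ v) ≤ ⟦ x ×-dec y ⟧ * Q ^ suc e + ⟦ x ⟧ * β
              pointwise v (no _) y = z≤n
              pointwise v (yes (v∈B , v∉X)) (yes _) = ≤-trans (*-monoʳ-≤ 1 (degree-≤ Φ? (suc e) {suc t} {X ⊹ v} (trans (sym (+-suc t (suc e))) n≡) (trans (card-⊹ {X} v∉X) (cong (q *_) X-card)))) (m≤m+n _ _)
              pointwise v (yes (v∈B , v∉X)) (no v∉M′) = *-monoʳ-≤ 1 (≮⇒≥ λ lt →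
                v∉M′ (heavy⊑join {B′} {X ⊹ v} φB′ X⋢B′ (trans (card-⊹ {X} v∉X) (cong (q *_) X-card) , lt) v (⊹-new X v)))
              inM′ : # (λ v → P? v ×-dec dec M′ v) ≤ a * θ q d
              inM′ = begin
                # (λ v → P? v ×-dec dec M′ v)                       ≤⟨ #-mono (λ v → P? v ×-dec dec M′ v) (λ v → dec (ds B ⊓ M′) v ×-dec ¬? (dec X v)) (λ { v ((x , z) , y) → (x , y) , z }) ⟩
                # (λ v → dec (ds B ⊓ M′) v ×-dec ¬? (dec X v))      ≡⟨ card-∖ (ds B ⊓ M′) X ⟩
                ∣ ds B ⊓ M′ ∣ ∸ ∣ (ds B ⊓ M′) ⊓ X ∣                 ≡⟨ cong (∣ ds B ⊓ M′ ∣ ∸_) (ej′ {M′} (λ v v∈ → ⊞-upperˡ X (ds B′) v (proj₁ v∈))) ⟩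
                ∣ ds B ⊓ M′ ∣ ∸ q ^ j                               ≤⟨ ∸-monoˡ-≤ (q ^ j) (card-≤-pred (ds B ⊓ M′) (t + suc e) (subst (∣ ds B ⊓ M′ ∣ <_) (trans (dim B) (cong (q ^_) (trans (sym n≡) (+-suc t (suc e)))))
                                                                          (card-strict {ds B ⊓ M′} {ds B} (λ _ → proj₁) (λ B⊑ → B⋢M′ (λ v v∈ → proj₂ (B⊑ v v∈)))))) ⟩
                q ^ (t + suc e) ∸ q ^ j                             ≤⟨ branch-ratio j t (suc e) j<t ⟩
                a * θ q d ∎
              all-P : # P? ≤ a * Θ
              all-P = begin
                # P?                          ≡⟨ card-∖ (ds B) X ⟩
                ∣ ds B ∣ ∸ ∣ ds B ⊓ X ∣       ≡⟨ cong₂ _∸_ (trans (dim B) (cong (q ^_) (sym n≡))) (trans (card-cong {ds B ⊓ X} {X ⊓ ds B} (λ { _ (x , y) → y , x }) (λ { _ (x , y) → y , x })) ej) ⟩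
                q ^ (t + d) ∸ q ^ j           ≤⟨ branch-ratio j t d j<t ⟩
                a * Θ ∎

            pencil-small : Small (size Φ?)
            pencil-small = small-star (≤-trans (≤-reflexive (size-split Φ? (λ F → X ⊑? ds F)))
              (+-mono-≤ degree-X (size-light (λ F → Φ? F ×-dec ¬? (X ⊑? ds F)) T (proj₁ heavy) (heavy⇒Cover {T} heavy) (λ _ → proj₁)
                (λ { F (_ , X⋢F) {T′} h′ T′⊑F → X⋢F (⊑-trans {X} {T′} {ds F} (common {T′} h′) T′⊑F) }))))

        pencil : Outcome
        pencil with nontrivial X X-card
        ... | B , φB , X⋢B with ∃Member? (λ F → Φ? F ×-dec (¬? (X ⊑? ds F) ×-dec ¬? (ds F ⊑? M B φB X⋢B)))
                   (λ {F} {G} F≈G → λ { (φ , X⋢F , F⋢M) → Φ-resp F≈G φ ,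
                     (λ X⊑G → X⋢F (⊑-trans {X} {ds G} {ds F} X⊑G (proj₂ F≈G))) ,
                     (λ G⊑M → F⋢M (⊑-trans {ds F} {ds G} {M B φB X⋢B} (proj₁ F≈G) G⊑M)) })
        ...   | yes (B′ , φB′ , X⋢B′ , B′⋢M) = small (pencil-small B φB X⋢B B′ φB′ X⋢B′ B′⋢M)
        ...   | no none = hiltonMilner X (M B φB X⋢B) X-card (λ v v∈ → heavy-off {T} heavy v (X⊑T v v∈)) (join-card {B} φB X⋢B) (M-meet B φB X⋢B) (⊞-upperˡ X (ds B)) contained
          where
          contained : ∀ F → Φ F → (X ⊑ ds F × q ^ suc t ≤ ∣ ds F ⊓ M B φB X⋢B ∣) ⊎ ds F ⊑ M B φB X⋢B
          contained F φ with X ⊑? ds F | ds F ⊑? M B φB X⋢B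
          ... | yes X⊑F | _ = inj₁ (X⊑F , big B φB X⋢B {F} φ X⊑F)
          ... | no _ | yes F⊑M = inj₂ F⊑M
          ... | no X⋢F | no F⋢M = ⊥-elim (none (F , φ , X⋢F , F⋢M))

      -- Three heavy subspaces without a common t-space.

      module Triangle (T₀ T₁ T₂ : DS) (h₀ : Heavy T₀) (h₁ : Heavy T₁) (h₂ : Heavy T₂)
        (X-card : ∣ T₀ ⊓ T₁ ∣ ≡ q ^ t) (X⋢T₂ : ¬ (T₀ ⊓ T₁ ⊑ T₂)) where

        X Z : DS
        X = T₀ ⊓ T₁
        Z = T₀ ⊞ T₁

        Z-card : ∣ Z ∣ ≡ q ^ suc (suc t)
        Z-card = *-cancelʳ-≡ _ _ (q ^ t) ⦃ m^n≢0 q t ⦄ (begin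
          ∣ Z ∣ * q ^ t               ≡⟨ cong (∣ Z ∣ *_) (sym X-card) ⟩
          ∣ Z ∣ * ∣ X ∣               ≡⟨ card-⊞ T₀ T₁ ⟩
          ∣ T₀ ∣ * ∣ T₁ ∣             ≡⟨ cong₂ _*_ (proj₁ h₀) (proj₁ h₁) ⟩
          q * q ^ t * (q * q ^ t)     ≡⟨ rearrange q (q ^ t) ⟩
          q * (q * q ^ t) * q ^ t ∎)
          where
          open ≡-Reasoning
          rearrange : ∀ x y → x * y * (x * y) ≡ x * (x * y) * y
          rearrange = solve-∀

        X∩T₂ : ∣ X ⊓ T₂ ∣ < q ^ t
        X∩T₂ = subst (∣ X ⊓ T₂ ∣ <_) X-card (card-strict {X ⊓ T₂} {X} (λ _ → proj₁) (λ X⊑ → X⋢T₂ (λ v v∈ → proj₂ (X⊑ v v∈))))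

        -- T₂ meets T₀ and T₁ in dimension at least t each, and these two meets share only vectors
        -- of X ⊓ T₂, of dimension below t; so they generate T₂.
        T₂⊑Z : T₂ ⊑ Z
        T₂⊑Z = ⊑-trans {T₂} {(T₂ ⊓ T₀) ⊞ (T₂ ⊓ T₁)} {Z}
          (card-tight {(T₂ ⊓ T₀) ⊞ (T₂ ⊓ T₁)} {T₂} (⊞-least {T₂ ⊓ T₀} {T₂ ⊓ T₁} {T₂} (λ _ → proj₁) (λ _ → proj₁))
            (≤-trans (≤-reflexive (proj₁ h₂)) (sum-big t (T₂ ⊓ T₀) (T₂ ⊓ T₁) (heavy-meet {T₂} {T₀} h₂ h₀) (heavy-meet {T₂} {T₁} h₂ h₁)
              (≤-<-trans (card-mono {(T₂ ⊓ T₀) ⊓ (T₂ ⊓ T₁)} {X ⊓ T₂} (λ { v ((a , b) , (_ , c)) → (b , c) , a })) X∩T₂))))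
          (⊞-least {T₂ ⊓ T₀} {T₂ ⊓ T₁} {Z} (λ v v∈ → ⊞-upperˡ T₀ T₁ v (proj₂ v∈)) (λ v v∈ → ⊞-upperʳ T₀ T₁ v (proj₂ v∈)))

        -- Two subspaces of F ⊓ Z with dimension at least t and a smaller intersection are needed: X
        -- and F ⊓ T₂ if F contains X, otherwise F ⊓ T₀ and F ⊓ T₁.
        meets-Z : ∀ F → Φ F → q ^ suc t ≤ ∣ ds F ⊓ Z ∣
        meets-Z F φ with X ⊑? ds F
        ... | yes X⊑F = ≤-trans
          (sum-big t X (ds F ⊓ T₂) (≤-reflexive (sym X-card)) (heavy⇒Cover {T₂} h₂ F φ)
            (≤-<-trans (card-mono {X ⊓ (ds F ⊓ T₂)} {X ⊓ T₂} (λ { v (x , _ , y) → x , y })) X∩T₂))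
          (card-mono {X ⊞ (ds F ⊓ T₂)} {ds F ⊓ Z} (⊞-least {X} {ds F ⊓ T₂} {ds F ⊓ Z}
            (λ v v∈ → X⊑F v v∈ , ⊞-upperˡ T₀ T₁ v (proj₁ v∈)) (λ { v (x , y) → x , T₂⊑Z v y })))
        ... | no X⋢F = ≤-trans
          (sum-big t (ds F ⊓ T₀) (ds F ⊓ T₁) (heavy⇒Cover {T₀} h₀ F φ) (heavy⇒Cover {T₁} h₁ F φ)
            (≤-<-trans (card-mono {(ds F ⊓ T₀) ⊓ (ds F ⊓ T₁)} {X ⊓ ds F} (λ { v ((a , b) , (_ , c)) → (b , c) , a }))
              (subst (∣ X ⊓ ds F ∣ <_) X-card (card-strict {X ⊓ ds F} {X} (λ _ → proj₁) (λ X⊑ → X⋢F (λ v v∈ → proj₂ (X⊑ v v∈)))))))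
          (card-mono {(ds F ⊓ T₀) ⊞ (ds F ⊓ T₁)} {ds F ⊓ Z} (⊞-least {ds F ⊓ T₀} {ds F ⊓ T₁} {ds F ⊓ Z}
            (λ { v (x , y) → x , ⊞-upperˡ T₀ T₁ v y }) (λ { v (x , y) → x , ⊞-upperʳ T₀ T₁ v y })))

        triangle : Outcome
        triangle with card-power (Z ⊓ W)
        ... | zero , e₀ = star Z Z-card (λ v x y → card≡1⇒zero {Z ⊓ W} e₀ v (x , y)) meets-Z
        -- Members avoid Z ⊓ W, so only the (t+1)-subspaces of Z avoiding it matter; running the
        -- chain with E = Z ⊓ W gains a factor q at most per step, hence q^(t+1) in place of
        -- θ_{t+2}.
        ... | suc s , eₛ = small₂ (subst₂ _≤_ (trans (*-identityˡ _) (degree-zeroS Φ?)) refl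
          (chain-≤ 1 (λ u → q ^ u * Q ^ suc e) meets-Z step
            (λ { {S} (inside _ eS _) → ≤-trans (≤-reflexive (*-identityˡ _)) (≤-trans (degree-≤ Φ? (suc e) {suc t} {S} (trans (sym (+-suc t (suc e))) n≡) eS) (≤-reflexive (sym (*-identityˡ _)))) })
            (suc t) {0} {zeroS} refl (inside (zeroS-⊑ Z) card-zero (λ { _ v≡0 _ → v≡0 }))))
          where
          open Chain Φ? Z (Z ⊓ W) (suc (suc t)) (suc s) (suc t) (λ _ → proj₁) Z-card eₛ (λ F _ v v∈ v∈ZW → off-zero F v v∈ (proj₂ v∈ZW))
          open ≤-Reasoning
          step : ∀ {i u} → i + suc u ≡ suc t → (q ^ suc (suc t) ∸ q ^ (i + suc s)) * (q ^ u * Q ^ suc e) ≤ (q ^ suc t ∸ q ^ i) * (q ^ suc u * Q ^ suc e)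
          step {i} {u} _ = begin
            (q ^ suc (suc t) ∸ q ^ (i + suc s)) * (q ^ u * Q ^ suc e)       ≤⟨ *-monoˡ-≤ _ (∸-monoʳ-≤ (q ^ suc (suc t)) (^-monoʳ-≤ q (≤-trans (s≤s (m≤m+n i s)) (≤-reflexive (sym (+-suc i s)))))) ⟩
            (q * q ^ suc t ∸ q * q ^ i) * (q ^ u * Q ^ suc e)               ≡⟨ cong (_* (q ^ u * Q ^ suc e)) (sym (*-distribˡ-∸ q (q ^ suc t) (q ^ i))) ⟩
            q * (q ^ suc t ∸ q ^ i) * (q ^ u * Q ^ suc e)                   ≡⟨ rearrange q (q ^ suc t ∸ q ^ i) (q ^ u) (Q ^ suc e) ⟩
            (q ^ suc t ∸ q ^ i) * (q ^ suc u * Q ^ suc e) ∎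
            where
            rearrange : ∀ x y z w → x * y * (z * w) ≡ y * (x * z * w)
            rearrange = solve-∀

      axis-card : ∀ {T₀ T₁} → Heavy T₀ → Heavy T₁ → ¬ (T₀ ⊑ T₁) → ∣ T₀ ⊓ T₁ ∣ ≡ q ^ t
      axis-card {T₀} {T₁} h₀ h₁ T₀⋢T₁ = card-between (T₀ ⊓ T₁) t (heavy-meet {T₀} {T₁} h₀ h₁)
        (subst (∣ T₀ ⊓ T₁ ∣ <_) (proj₁ h₀) (card-strict {T₀ ⊓ T₁} {T₀} (λ _ → proj₁) (λ T₀⊑ → T₀⋢T₁ (λ v v∈ → proj₂ (T₀⊑ v v∈)))))

      heavies : ∀ T → ∣ T ∣ ≡ q ^ suc t → Cover T → Outcome
      heavies T eT cover with ∃DS? (suc t) heavy? (λ {A} {B} → degree-resp {A} {B})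
      ... | no none = small (small-cover₁ (size-light Φ? T eT cover (λ _ φ → φ) (λ { _ _ {T′} h′ _ → none (T′ , h′) })))
      ... | yes (T₀ , h₀) with ∃DS? (suc t) (λ T₁ → heavy? T₁ ×-dec ¬? (T₀ ⊑? T₁))
                                 (λ {A} {B} A≈B → λ { (h , T₀⋢A) → degree-resp {A} {B} A≈B h , λ T₀⊑B → T₀⋢A (⊑-trans {T₀} {B} {A} T₀⊑B (proj₂ A≈B)) })
      -- Every heavy subspace now contains T₀, so any t-dimensional subspace of T₀ can play the role
      -- of X.
      ...   | no none with subspaceOfDim T₀ t (≤-trans (^-monoʳ-≤ q (n≤1+n t)) (≤-reflexive (sym (proj₁ h₀))))
      ...     | X , X⊑T₀ , eX = Pencil.pencil T₀ h₀ X eX X⊑T₀ (λ {T′} → only {T′})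
        where
        only : ∀ {T′} → Heavy T′ → X ⊑ T′
        only {T′} (eT′ , lt) with T₀ ⊑? T′
        ... | yes T₀⊑T′ = ⊑-trans {X} {T₀} {T′} X⊑T₀ T₀⊑T′
        ... | no T₀⋢T′ = ⊥-elim (none (T′ , eT′ , lt , T₀⋢T′))
      heavies T eT cover | yes (T₀ , h₀) | yes (T₁ , e₁ , lt₁ , T₀⋢T₁)
        with ∃DS? (suc t) (λ T₂ → heavy? T₂ ×-dec ¬? ((T₀ ⊓ T₁) ⊑? T₂))
               (λ {A} {B} A≈B → λ { (h , X⋢A) → degree-resp {A} {B} A≈B h , λ X⊑B → X⋢A (⊑-trans {T₀ ⊓ T₁} {B} {A} X⊑B (proj₂ A≈B)) })
      ... | yes (T₂ , e₂ , lt₂ , X⋢T₂) = Triangle.triangle T₀ T₁ T₂ h₀ (e₁ , lt₁) (e₂ , lt₂) (axis-card {T₀} {T₁} h₀ (e₁ , lt₁) T₀⋢T₁) X⋢T₂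
      ... | no none = Pencil.pencil T₀ h₀ (T₀ ⊓ T₁) (axis-card {T₀} {T₁} h₀ (e₁ , lt₁) T₀⋢T₁) (λ _ → proj₁) (λ {T′} → all-contain {T′})
        where
        all-contain : ∀ {T′} → Heavy T′ → T₀ ⊓ T₁ ⊑ T′
        all-contain {T′} (eT′ , lt) with (T₀ ⊓ T₁) ⊑? T′
        ... | yes X⊑T′ = X⊑T′
        ... | no X⋢T′ = ⊥-elim (none (T′ , eT′ , lt , X⋢T′))

    outcome : Outcome
    outcome with minimalCover
    ... | suc zero , _ , _ , (T , eT , ¬nc) , _ = heavies T (trans eT (cong (q ^_) (+-comm t 1))) (¬NonCover⇒Cover {T} ¬nc)
    ... | suc (suc zero) , _ , _ , (C , eC , ¬nc) , none =
      small (small-cover₂ (size-cover₂ C (Θ ^ 2 * Q ^ e) eC (¬NonCover⇒Cover {C} ¬nc)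
        (λ {S} eS → degree-nonCovers 2 e t {S} (λ {m} {S} → none {m} {S}) eS (trans (+-assoc t 2 e) n≡))))
    ... | k@(suc (suc (suc j))) , _ , k≤d , (C , eC , ¬nc) , none =
      small (small-cover₃ j (d ∸ k) (m+[n∸m]≡n k≤d) (size-cover₃ k C (Θ ^ k * Q ^ (d ∸ k)) eC (¬NonCover⇒Cover {C} ¬nc)
        (λ {S} eS → degree-nonCovers k (d ∸ k) t {S} (λ {m} {S} → none {m} {S}) eS (trans (+-assoc t k (d ∸ k)) (trans (cong (t +_) (m+[n∸m]≡n k≤d)) n≡)))))

-- Lists of subspaces

module Main (𝔽 : FiniteField) (n ℓ t e : ℕ) (n≡ : t + suc (suc e) ≡ n) (1≤t : 1 ≤ t)
  (large : (3 ≤ FiniteField.size 𝔽 × 4 + (e + (t + t)) ≤ ℓ) ⊎ 6 + (e + (t + t)) ≤ ℓ)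
  (Wᵈ : Vectors.Decidable.DS 𝔽 (n + ℓ))
  (W-card : Vectors.Decidable.∣_∣ 𝔽 (n + ℓ) Wᵈ ≡ FiniteField.size 𝔽 ^ ℓ) where

  open Vectors 𝔽
  open Decidable (n + ℓ)

  private
    W : Subspace (n + ℓ)
    W = sub Wᵈ

  open Attenuated 𝔽 n ℓ Wᵈ W-card
  open Extremal 𝔽 n ℓ Wᵈ W-card
  open Intersecting 𝔽 n ℓ Wᵈ W-card
  open Bounds q 1<q t e ℓ 1≤t large using (prodTerm-≤; module Values)

  private
    d : ℕ
    d = suc (suc e)

  DimGE⇒ : ∀ A k → DimGE (sub A) k → q ^ k ≤ ∣ A ∣
  DimGE⇒ A k (m , dimA , k≤m) = ≤-trans (^-monoʳ-≤ q k≤m) (≤-reflexive (sym (dim⇒card A dimA)))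

  ⇒DimGE : ∀ A k → q ^ k ≤ ∣ A ∣ → DimGE (sub A) k
  ⇒DimGE A k le with card-power A
  ... | m , eA = m , card⇒dim A eA , ^-cancel-≤ k m (subst (q ^ k ≤_) eA le)

  toMember : ∀ F → HasType W F n 0 → Member
  toMember F (dimF , dimFW) = member (fromDim F dimF) (dim⇒card (fromDim F dimF) dimF) (dim⇒card (fromDim F dimF ⊓ Wᵈ) dimFW)

  hasType : ∀ F → HasType W (sub (ds F)) n 0
  hasType F = card⇒dim (ds F) (dim F) , card⇒dim (ds F ⊓ Wᵈ) (off F)

  type⇒disjoint : ∀ {A m} → HasType W (sub A) m 0 → Disjoint A Wᵈ
  type⇒disjoint {A} (_ , meet) v v∈A v∈W = card≡1⇒zero {A ⊓ Wᵈ} (dim⇒card (A ⊓ Wᵈ) meet) v (v∈A , v∈W)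

  disjoint⇒type : ∀ {A m} → ∣ A ∣ ≡ q ^ m → Disjoint A Wᵈ → HasType W (sub A) m 0
  disjoint⇒type {A} eA disj = card⇒dim A eA , card⇒dim (A ⊓ Wᵈ) (zero⇒card≡1 {A ⊓ Wᵈ} λ { v (x , y) → disj v x y })

  -- The list is recovered up to propositional equality, not merely up to `≐`, because `fromDim`
  -- keeps each subspace. Matching on `refl` then replaces ℱ by a list of members.
  members : (ℱ : List (Subspace (n + ℓ))) → (∀ F → F ∈ ℱ → HasType W F n 0) → ∃ λ Ms → List.map (λ M → sub (ds M)) Ms ≡ ℱ
  members [] _ = [] , refl
  members (F ∷ ℱ) types with members ℱ (λ G G∈ → types G (there G∈))
  ... | Ms , eq = toMember F (types F (here refl)) ∷ Ms , cong (F ∷_) eq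

  h₁ h₂ : ℕ
  h₁ = (q ^ (ℓ * (n ∸ t)) ∸ prodTerm q ℓ (n ∸ t)) + q ^ (n ∸ t) * (q ^ t ∸ 1)
  h₂ = q ^ (ℓ * (n ∸ t ∸ 1)) * θ q (t + 2) ∸ q ^ (ℓ * (n ∸ t ∸ 2) + 1) * θ q (t + 1)

  private
    n∸t≡d : n ∸ t ≡ d
    n∸t≡d = trans (cong (_∸ t) (sym n≡)) (m+n∸m≡n t d)

    h₁-eq : h₁ + (prodTerm q ℓ d + q ^ d) ≡ Q ^ d + q ^ (t + d)
    h₁-eq = begin
      h₁ + (P + q ^ d)
        ≡⟨ cong (λ k → (q ^ (ℓ * k) ∸ prodTerm q ℓ k) + q ^ k * (q ^ t ∸ 1) + (P + q ^ d)) n∸t≡d ⟩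
      (q ^ (ℓ * d) ∸ P) + q ^ d * (q ^ t ∸ 1) + (P + q ^ d)
        ≡⟨ cong (λ z → z ∸ P + q ^ d * (q ^ t ∸ 1) + (P + q ^ d)) (sym (^-*-assoc q ℓ d)) ⟩
      (Q ^ d ∸ P) + q ^ d * (q ^ t ∸ 1) + (P + q ^ d)
        ≡⟨ ring (Q ^ d ∸ P) (q ^ d) (q ^ t ∸ 1) P ⟩
      (Q ^ d ∸ P + P) + (q ^ t ∸ 1 + 1) * q ^ d
        ≡⟨ cong₂ (λ z w → z + w * q ^ d) (m∸n+n≡m (prodTerm-≤ d)) (m∸n+n≡m (1≤q^ t)) ⟩
      Q ^ d + q ^ t * q ^ d
        ≡⟨ cong (Q ^ d +_) (sym (^-distribˡ-+-* q t d)) ⟩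
      Q ^ d + q ^ (t + d) ∎
      where
      open ≡-Reasoning
      P = prodTerm q ℓ d
      ring : ∀ a b c p → a + b * c + (p + b) ≡ (a + p) + (c + 1) * b
      ring = solve-∀

    h₂-eq : h₂ + Q ^ e * (q * θ q (suc t)) ≡ Q ^ suc e * θ q (suc (suc t))
    h₂-eq = trans (cong (_+ Q ^ e * (q * θ q (suc t))) h₂≡) (m∸n+n≡m (*-mono-≤ (^-monoʳ-≤ Q ⦃ m^n≢0 q ℓ ⦄ (n≤1+n e))
        (≤-trans (n≤1+n _) (≤-reflexive (sym (θ-suc (suc t)))))))
      where
      open ≡-Reasoning
      h₂≡ : h₂ ≡ Q ^ suc e * θ q (suc (suc t)) ∸ Q ^ e * (q * θ q (suc t))
      h₂≡ = begin
        h₂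
          ≡⟨ cong (λ k → q ^ (ℓ * (k ∸ 1)) * θ q (t + 2) ∸ q ^ (ℓ * (k ∸ 2) + 1) * θ q (t + 1)) n∸t≡d ⟩
        q ^ (ℓ * suc e) * θ q (t + 2) ∸ q ^ (ℓ * e + 1) * θ q (t + 1)
          ≡⟨ cong₂ _∸_ (cong₂ (λ z k → z * θ q k) (sym (^-*-assoc q ℓ (suc e))) (+-comm t 2))
               (cong₂ (λ z k → z * θ q k) (trans (^-distribˡ-+-* q (ℓ * e) 1) (cong (_* q ^ 1) (sym (^-*-assoc q ℓ e)))) (+-comm t 1)) ⟩
        Q ^ suc e * θ q (suc (suc t)) ∸ Q ^ e * q ^ 1 * θ q (suc t)
          ≡⟨ cong (Q ^ suc e * θ q (suc (suc t)) ∸_) (trans (*-assoc (Q ^ e) (q ^ 1) _) (cong (λ z → Q ^ e * (z * θ q (suc t))) (*-identityʳ q))) ⟩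
        Q ^ suc e * θ q (suc (suc t)) ∸ Q ^ e * (q * θ q (suc t)) ∎

  open Values h₁ h₂ h₁-eq h₂-eq

  private
    d≤ℓ : d ≤ ℓ
    d≤ℓ = ≤-trans (+-monoʳ-≤ 2 (≤-trans (m≤m+n e (t + t)) (m≤n+m _ 2))) ([ proj₂ , ≤-trans (+-monoˡ-≤ (e + (t + t)) (m≤m+n 4 2)) ]′ large)

    n≡′ : suc (suc t) + e ≡ n
    n≡′ = trans (shift t e) n≡
      where
      shift : ∀ t e → suc (suc t) + e ≡ t + suc (suc e)
      shift = solve-∀

  module ForHiltonMilner {X M : DS} (eX : ∣ X ∣ ≡ q ^ t) (oX : Disjoint X Wᵈ) (eM : ∣ M ∣ ≡ q ^ suc n) (oM : ∣ M ⊓ Wᵈ ∣ ≡ q ^ 1) (X⊑M : X ⊑ M) where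
    open HiltonMilner t d n≡ d≤ℓ (s≤s z≤n) X eX oX M eM oM X⊑M public

    size≡h₁ : size H₁ ≡ h₁
    size≡h₁ = +-cancelʳ-≡ (prodTerm q ℓ d + q ^ d) _ _ (trans size-H₁ (trans (cong (λ k → Q ^ d + q ^ k) (sym n≡)) (sym h₁-eq)))

    H₁-resp : ∀ {F G} → ds F ≈ ds G → (X ⊑ ds F × Big F) ⊎ ds F ⊑ M → (X ⊑ ds G × Big G) ⊎ ds G ⊑ M
    H₁-resp {F} {G} (l , r) (inj₁ (X⊑F , big)) = inj₁ (⊑-trans {X} {ds F} {ds G} X⊑F l ,
      ≤-trans big (card-mono {ds F ⊓ M} {ds G ⊓ M} (λ { v (x , y) → l v x , y })))
    H₁-resp {F} {G} (l , r) (inj₂ F⊑M) = inj₂ (⊑-trans {ds G} {ds F} {M} r F⊑M)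

  module ForStar {Z : DS} (eZ : ∣ Z ∣ ≡ q ^ suc (suc t)) (oZ : Disjoint Z Wᵈ) where
    open Star t e n≡′ Z eZ oZ public

    size≡h₂ : size H₂ ≡ h₂
    size≡h₂ = +-cancelʳ-≡ (Q ^ e * (q * θ q (suc t))) _ _ (trans size-H₂ (sym h₂-eq))

    H₂-resp : ∀ {F G} → ds F ≈ ds G → q ^ suc t ≤ ∣ ds F ⊓ Z ∣ → q ^ suc t ≤ ∣ ds G ⊓ Z ∣
    H₂-resp {F} {G} (l , r) big = ≤-trans big (card-mono {ds F ⊓ Z} {ds G ⊓ Z} (λ { v (x , y) → l v x , y }))

  IsHiltonMilner IsStar : List (Subspace (n + ℓ)) → Set₁
  IsHiltonMilner ℱ = Σ (Subspace (n + ℓ)) λ X → Σ (Subspace (n + ℓ)) λ M →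
    HasType W X t 0 × HasType W M (n + 1) 1 × X ⊆S M
    × FamilyIs ℱ (λ F → HasType W F n 0 × ((X ⊆S F × DimGE (F ∩ M) (t + 1)) ⊎ F ⊆S M))
  IsStar ℱ = Σ (Subspace (n + ℓ)) λ Z →
    HasType W Z (t + 2) 0 × FamilyIs ℱ (λ F → HasType W F n 0 × DimGE (F ∩ Z) (t + 1))

  -- A family given by a list of members.

  module _ (Ms : List Member) where

    private
      ℱ : List (Subspace (n + ℓ))
      ℱ = List.map (λ M → sub (ds M)) Ms

      -- Membership is taken up to `≈`, since `𝔸` contains a representative of each listed subspace
      -- and perhaps not the listed one.
      Φ : Member → Set₁
      Φ G = Any (λ M → ds M ≈ ds G) Ms

      Φ? : ∀ G → Dec (Φ G)
      Φ? G = any? (λ M → ds M ≈? ds G) Ms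

      Φ-resp : ∀ {F G} → ds F ≈ ds G → Φ F → Φ G
      Φ-resp {F} {G} F≈G = Any.map (λ {M} M≈F → ≈-trans {ds M} {ds F} {ds G} M≈F F≈G)

      Φ-∈ : ∀ {M} → M ∈ Ms → Φ M
      Φ-∈ {M} M∈ = lose M∈ (≈-refl {ds M})

      ∈F⇒Φ : ∀ {G} → sub (ds G) ∈F ℱ → Φ G
      ∈F⇒Φ (P , P∈ , P≐G) with ∈-map⁻ (λ M → sub (ds M)) P∈
      ... | M , M∈ , refl = lose M∈ P≐G

      Φ⇒∈F : ∀ {G} → Φ G → sub (ds G) ∈F ℱ
      Φ⇒∈F φ with find φ
      ... | M , M∈ , M≈G = sub (ds M) , ∈-map⁺ (λ M → sub (ds M)) M∈ , M≈G

      -- Count pairs of a listed M and an equivalent G in `𝔸`: each M has exactly one G, and by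
      -- distinctness each G has at most one M.
      length-ℱ : Distinct ℱ → length ℱ ≡ size Φ?
      length-ℱ distinct = begin
        length ℱ                                          ≡⟨ List.length-map _ Ms ⟩
        length Ms                                         ≡⟨ sym (trans (∑-const Ms 1) (*-identityʳ _)) ⟩
        ∑ Ms (λ _ → 1)                                    ≡⟨ ∑-cong Ms (λ M → sym (trans (∑-cong 𝔸 λ G → ⟦⟧-cong (ds M ≈? ds G) (ds G ≈? ds M) (≈-sym {ds M} {ds G}) (≈-sym {ds G} {ds M})) (𝔸-once M))) ⟩
        (∑[ M ← Ms ] ∑[ G ← 𝔸 ] ⟦ ds M ≈? ds G ⟧)         ≡⟨ ∑-swap Ms 𝔸 _ ⟩
        (∑[ G ← 𝔸 ] ∑[ M ← Ms ] ⟦ ds M ≈? ds G ⟧)         ≡⟨ ∑-cong 𝔸 (λ G → sym (once G Ms (AllPairs.map⁻ distinct))) ⟩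
        size Φ? ∎
        where
        open ≡-Reasoning
        once : ∀ G Ms → AllPairs (λ M M′ → ¬ (ds M ≈ ds M′)) Ms →
               ⟦ any? (λ M → ds M ≈? ds G) Ms ⟧ ≡ (∑[ M ← Ms ] ⟦ ds M ≈? ds G ⟧)
        once G [] _ = refl
        once G (M ∷ Ms) (fresh ∷ distinct) = trans (add (ds M ≈? ds G) (any? (λ M → ds M ≈? ds G) Ms) (any? (λ M → ds M ≈? ds G) (M ∷ Ms)))
          (cong (⟦ ds M ≈? ds G ⟧ +_) (once G Ms distinct))
          where
          add : (x : Dec (ds M ≈ ds G)) (y : Dec (Any (λ M → ds M ≈ ds G) Ms)) (z : Dec (Any (λ M → ds M ≈ ds G) (M ∷ Ms))) → ⟦ z ⟧ ≡ ⟦ x ⟧ + ⟦ y ⟧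
          add (yes M≈G) (yes any) z with find any
          ... | M′ , M′∈ , M′≈G = ⊥-elim (All.lookup fresh M′∈ (≈-trans {ds M} {ds G} {ds M′} M≈G (≈-sym {ds M′} {ds G} M′≈G)))
          add (yes M≈G) (no _) z = ⟦⟧-yes z (here M≈G)
          add (no _) (yes any) z = ⟦⟧-yes z (there any)
          add (no M≉G) (no none) z = ⟦⟧-no z λ { (here M≈G) → M≉G M≈G ; (there any) → none any }

      module Compare {r} {Ψ : Member → Set r} (Ψ? : ∀ F → Dec (Ψ F)) (Ψ-resp : ∀ {F G} → ds F ≈ ds G → Ψ F → Ψ G)
        (cond : Subspace (n + ℓ) → Set) (cond-type : ∀ P → cond P → HasType W P n 0)
        (Ψ⇒cond : ∀ F → Ψ F → cond (sub (ds F))) (cond⇒Ψ : ∀ F → cond (sub (ds F)) → Ψ F) where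

        -- With equal totals the two indicators agree on all of `𝔸`; a subspace satisfying `cond` is
        -- first exchanged for its representative there.
        size≡⇒FamilyIs : (∀ F → Φ F → Ψ F) → size Φ? ≡ size Ψ? → FamilyIs ℱ cond
        size≡⇒FamilyIs Φ⇒Ψ eq = sound , complete
          where
          sound : ∀ P → P ∈ ℱ → cond P
          sound P P∈ with ∈-map⁻ (λ M → sub (ds M)) P∈
          ... | M , M∈ , refl = Ψ⇒cond M (Φ⇒Ψ M (Φ-∈ M∈))
          complete : ∀ P → cond P → P ∈F ℱ
          complete P c with find (representative (toMember P (cond-type P c)))
          ... | G , G∈ , G≈P = Φ⇒∈F {toMember P (cond-type P c)} (Φ-resp {G} {toMember P (cond-type P c)} G≈P
            (⟦⟧-≡⇒ (Ψ? G) (Φ? G) (sym (∑-mono-tight 𝔸 (λ F → ⟦⟧-mono (Φ? F) (Ψ? F) (Φ⇒Ψ F)) (≤-reflexive (sym eq)) G∈))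
              (Ψ-resp {toMember P (cond-type P c)} {G} (≈-sym {ds G} {ds (toMember P (cond-type P c))} G≈P) (cond⇒Ψ (toMember P (cond-type P c)) c))))

        FamilyIs⇒size≡ : FamilyIs ℱ cond → size Φ? ≡ size Ψ?
        FamilyIs⇒size≡ (sound , complete) = size-cong Φ? Ψ? to (λ F ψ → ∈F⇒Φ {F} (complete _ (Ψ⇒cond F ψ)))
          where
          to : ∀ F → Φ F → Ψ F
          to F φ with find φ
          ... | M , M∈ , M≈F = Ψ-resp {M} {F} M≈F (cond⇒Ψ M (sound _ (∈-map⁺ (λ M → sub (ds M)) M∈)))

      module CompareHiltonMilner {X M : DS} (eX : ∣ X ∣ ≡ q ^ t) (oX : Disjoint X Wᵈ) (eM : ∣ M ∣ ≡ q ^ suc n) (oM : ∣ M ⊓ Wᵈ ∣ ≡ q ^ 1) (X⊑M : X ⊑ M) where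
        open ForHiltonMilner {X} {M} eX oX eM oM X⊑M public

        private
          Condition : Subspace (n + ℓ) → Set
          Condition F = HasType W F n 0 × ((sub X ⊆S F × DimGE (F ∩ sub M) (t + 1)) ⊎ F ⊆S sub M)

          H₁⇒Condition : ∀ F → (X ⊑ ds F × Big F) ⊎ ds F ⊑ M → Condition (sub (ds F))
          H₁⇒Condition F (inj₁ (X⊑F , big)) = hasType F , inj₁ (X⊑F , ⇒DimGE (ds F ⊓ M) (t + 1) (subst (λ k → q ^ k ≤ ∣ ds F ⊓ M ∣) (+-comm 1 t) big))
          H₁⇒Condition F (inj₂ F⊑M) = hasType F , inj₂ F⊑M

          Condition⇒H₁ : ∀ F → Condition (sub (ds F)) → (X ⊑ ds F × Big F) ⊎ ds F ⊑ M
          Condition⇒H₁ F (_ , inj₁ (X⊑F , big)) = inj₁ (X⊑F , subst (λ k → q ^ k ≤ ∣ ds F ⊓ M ∣) (+-comm t 1) (DimGE⇒ (ds F ⊓ M) (t + 1) big))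
          Condition⇒H₁ F (_ , inj₂ F⊑M) = inj₂ F⊑M

        open Compare H₁ (λ {F} {G} → H₁-resp {F} {G}) Condition (λ _ → proj₁) H₁⇒Condition Condition⇒H₁ public

      module CompareStar {Z : DS} (eZ : ∣ Z ∣ ≡ q ^ suc (suc t)) (oZ : Disjoint Z Wᵈ) where
        open ForStar {Z} eZ oZ public

        private
          Condition : Subspace (n + ℓ) → Set
          Condition F = HasType W F n 0 × DimGE (F ∩ sub Z) (t + 1)

          H₂⇒Condition : ∀ F → q ^ suc t ≤ ∣ ds F ⊓ Z ∣ → Condition (sub (ds F))
          H₂⇒Condition F big = hasType F , ⇒DimGE (ds F ⊓ Z) (t + 1) (subst (λ k → q ^ k ≤ ∣ ds F ⊓ Z ∣) (+-comm 1 t) big)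

          Condition⇒H₂ : ∀ F → Condition (sub (ds F)) → q ^ suc t ≤ ∣ ds F ⊓ Z ∣
          Condition⇒H₂ F (_ , big) = subst (λ k → q ^ k ≤ ∣ ds F ⊓ Z ∣) (+-comm t 1) (DimGE⇒ (ds F ⊓ Z) (t + 1) big)

        open Compare H₂ (λ {F} {G} → H₂-resp {F} {G}) Condition (λ _ → proj₁) H₂⇒Condition Condition⇒H₂ public

    module _ (distinct : Distinct ℱ) (t-intersecting : TIntersecting t ℱ) (non-trivial : NonTrivial t ℱ) where

      private
        intersecting : ∀ {F G} → Φ F → Φ G → q ^ t ≤ ∣ ds F ⊓ ds G ∣
        intersecting {F} {G} φ γ with find φ | find γ
        ... | M , M∈ , M≈F | M′ , M′∈ , M′≈G = ≤-trans
          (DimGE⇒ (ds M ⊓ ds M′) t (t-intersecting _ _ (∈-map⁺ (λ M → sub (ds M)) M∈) (∈-map⁺ (λ M → sub (ds M)) M′∈)))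
          (card-mono {ds M ⊓ ds M′} {ds F ⊓ ds G} (λ { v (x , y) → proj₁ M≈F v x , proj₁ M′≈G v y }))

        -- A t-dimensional S inside every member would lie in ⋂ ℱ, whose dimension is below t.
        nontrivial : ∀ S → ∣ S ∣ ≡ q ^ t → ∃ λ F → Φ F × ¬ (S ⊑ ds F)
        nontrivial S eS with any? (λ M → ¬? (S ⊑? ds M)) Ms
        ... | yes some with find some
        ...   | M , M∈ , S⋢M = M , Φ-∈ M∈ , S⋢M
        nontrivial S eS | no none = ⊥-elim (contra non-trivial)
          where
          contained : ∀ v → v ∈ₛ S → ∀ Ms → ¬ Any (λ M → ¬ (S ⊑ ds M)) Ms → ⋂ (List.map (λ M → sub (ds M)) Ms) ∋ v
          contained v v∈ [] _ = tt
          contained v v∈ (M ∷ Ms) none with S ⊑? ds M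
          ... | yes S⊑M = S⊑M v v∈ , contained v v∈ Ms (λ any → none (there any))
          ... | no S⋢M = ⊥-elim (none (here S⋢M))
          contra : ¬ NonTrivial t ℱ
          contra (m , dim⋂ , m<t) = <⇒≱ (^-monoʳ-< q 1<q m<t) (≤-trans (≤-reflexive (sym eS))
            (≤-trans (card-mono {S} {fromDim (⋂ ℱ) dim⋂} (λ v v∈ → contained v v∈ Ms none)) (≤-reflexive (dim⇒card (fromDim (⋂ ℱ) dim⋂) dim⋂))))

      open Family t e n≡ 1≤t large {Φ} Φ? (λ {F} {G} → Φ-resp {F} {G}) (λ {F} {G} → intersecting {F} {G}) nontrivial

      private
        N≡ : length ℱ ≡ size Φ?
        N≡ = length-ℱ distinct

        star≤ : ∀ {Z} (eZ : ∣ Z ∣ ≡ q ^ suc (suc t)) (oZ : Disjoint Z Wᵈ) → (∀ F → Φ F → q ^ suc t ≤ ∣ ds F ⊓ Z ∣) → length ℱ ≤ h₂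
        star≤ {Z} eZ oZ sub = ≤-trans (≤-reflexive N≡) (≤-trans (size-mono Φ? H₂ sub) (≤-reflexive size≡h₂))
          where open ForStar {Z} eZ oZ

        hm≤ : ∀ {X M} (eX : ∣ X ∣ ≡ q ^ t) (oX : Disjoint X Wᵈ) (eM : ∣ M ∣ ≡ q ^ suc n) (oM : ∣ M ⊓ Wᵈ ∣ ≡ q ^ 1) (X⊑M : X ⊑ M) →
              (∀ F → Φ F → (X ⊑ ds F × q ^ suc t ≤ ∣ ds F ⊓ M ∣) ⊎ ds F ⊑ M) → length ℱ ≤ h₁
        hm≤ {X} {M} eX oX eM oM X⊑M sub = ≤-trans (≤-reflexive N≡) (≤-trans (size-mono Φ? H₁ sub) (≤-reflexive size≡h₁))
          where open ForHiltonMilner {X} {M} eX oX eM oM X⊑M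

        tight₁ : length ℱ < h₁ ⊎ (length ℱ ≤ h₁ × (length ℱ ≡ h₁ → IsHiltonMilner ℱ)) → length ℱ ≤ h₁ × (length ℱ ≡ h₁ → IsHiltonMilner ℱ)
        tight₁ (inj₁ lt) = <⇒≤ lt , λ eq → ⊥-elim (<⇒≢ lt eq)
        tight₁ (inj₂ r) = r

        tight₂ : length ℱ < h₂ ⊎ (length ℱ ≤ h₂ × (length ℱ ≡ h₂ → IsStar ℱ)) → length ℱ ≤ h₂ × (length ℱ ≡ h₂ → IsStar ℱ)
        tight₂ (inj₁ lt) = <⇒≤ lt , λ eq → ⊥-elim (<⇒≢ lt eq)
        tight₂ (inj₂ r) = r

      -- Every outcome but containment in some ℋ₁(X, M) is strictly below `h₁`. In that outcome
      -- attaining `h₁` forces the whole family, and conversely the size of ℋ₁(X, M) is `h₁` for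
      -- every admissible X and M.
      part₁ : t ≤ e → length ℱ ≤ h₁ × (length ℱ ≡ h₁ ⇔ IsHiltonMilner ℱ)
      part₁ t≤e = proj₁ result , mk⇔ (proj₂ result) from
        where
        cases : Outcome → length ℱ < h₁ ⊎ (length ℱ ≤ h₁ × (length ℱ ≡ h₁ → IsHiltonMilner ℱ))
        cases (small s) = inj₁ (subst (_< h₁) (sym N≡) (beats₁ t≤e (inj₁ s)))
        cases (small₂ s) = inj₁ (subst (_< h₁) (sym N≡) (beats₁ t≤e (inj₂ (inj₁ s))))
        cases (star Z eZ oZ sub) = inj₁ (beats₁ t≤e (inj₂ (inj₂ (star≤ {Z} eZ oZ sub))))
        cases (hiltonMilner X M eX oX eM oM X⊑M contained) = inj₂ (hm≤ {X} {M} eX oX eM oM X⊑M contained , λ eq →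
          sub X , sub M , disjoint⇒type {X} eX oX ,
          (card⇒dim M (trans eM (cong (q ^_) (+-comm 1 n))) , card⇒dim (M ⊓ Wᵈ) oM) , X⊑M ,
          size≡⇒FamilyIs contained (trans (sym N≡) (trans eq (sym size≡h₁))))
          where open CompareHiltonMilner {X} {M} eX oX eM oM X⊑M
        result = tight₁ (cases outcome)
        from : IsHiltonMilner ℱ → length ℱ ≡ h₁
        from (X , M , tX , tM , X⊆M , is) = trans N≡ (trans (FamilyIs⇒size≡ is) size≡h₁)
          where
          Xᵈ = fromDim X (proj₁ tX)
          Mᵈ = fromDim M (proj₁ tM)
          open CompareHiltonMilner {Xᵈ} {Mᵈ} (dim⇒card Xᵈ (proj₁ tX)) (type⇒disjoint {Xᵈ} tX)
            (trans (dim⇒card Mᵈ (proj₁ tM)) (cong (q ^_) (+-comm n 1))) (dim⇒card (Mᵈ ⊓ Wᵈ) (proj₂ tM)) X⊆M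

      part₂ : d ≤ suc t → length ℱ ≤ h₂ × (length ℱ ≡ h₂ ⇔ IsStar ℱ)
      part₂ d≤ = proj₁ result , mk⇔ (proj₂ result) from
        where
        cases : Outcome → length ℱ < h₂ ⊎ (length ℱ ≤ h₂ × (length ℱ ≡ h₂ → IsStar ℱ))
        cases (small s) = inj₁ (subst (_< h₂) (sym N≡) (beats₂ d≤ (inj₁ s)))
        cases (small₂ s) = inj₁ (subst (_< h₂) (sym N≡) (beats₂ d≤ (inj₂ (inj₁ s))))
        cases (hiltonMilner X M eX oX eM oM X⊑M contained) = inj₁ (beats₂ d≤ (inj₂ (inj₂ (hm≤ {X} {M} eX oX eM oM X⊑M contained))))
        cases (star Z eZ oZ contained) = inj₂ (star≤ {Z} eZ oZ contained , λ eq →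
          sub Z , disjoint⇒type {Z} (trans eZ (cong (q ^_) (+-comm 2 t))) oZ ,
          size≡⇒FamilyIs contained (trans (sym N≡) (trans eq (sym size≡h₂))))
          where open CompareStar {Z} eZ oZ
        result = tight₂ (cases outcome)
        from : IsStar ℱ → length ℱ ≡ h₂
        from (Z , tZ , is) = trans N≡ (trans (FamilyIs⇒size≡ is) size≡h₂)
          where
          Zᵈ = fromDim Z (proj₁ tZ)
          open CompareStar {Zᵈ} (trans (dim⇒card Zᵈ (proj₁ tZ)) (cong (q ^_) (+-comm t 2))) (type⇒disjoint {Zᵈ} tZ)

  conclusion : ∀ {ℱ} → (∃ λ Ms → List.map (λ M → sub (ds M)) Ms ≡ ℱ) → Distinct ℱ → TIntersecting t ℱ → NonTrivial t ℱ →
    (t ≤ e → length ℱ ≤ h₁ × (length ℱ ≡ h₁ ⇔ IsHiltonMilner ℱ)) ×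
    (d ≤ suc t → length ℱ ≤ h₂ × (length ℱ ≡ h₂ ⇔ IsStar ℱ))
  conclusion (Ms , refl) distinct t-intersecting non-trivial =
    part₁ Ms distinct t-intersecting non-trivial , part₂ Ms distinct t-intersecting non-trivial

open LinAlg

theorem1p2 :
    (𝔽 : FiniteField) →
    (n ℓ t : ℕ) →
    1 ≤ t → t + 2 ≤ n → n + t + 2 ≤ ℓ →
    ¬ (ℓ ≡ n + t + 2 × FiniteField.size 𝔽 ≡ 2) → ¬ (ℓ ≡ n + t + 3 × FiniteField.size 𝔽 ≡ 2) →
    (W : Subspace {𝔽} (n + ℓ)) → HasDim W ℓ →
    (ℱ : List (Subspace {𝔽} (n + ℓ))) → Distinct ℱ →
    (∀ F → F ∈ ℱ → HasType W F n 0) →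
    TIntersecting t ℱ → NonTrivial t ℱ →
    -- (i)  1 ≤ t ≤ n/2 - 1
    (2 * t + 2 ≤ n →
      (length ℱ ≤ ((FiniteField.size 𝔽) ^ (ℓ * (n ∸ t)) ∸ prodTerm (FiniteField.size 𝔽) ℓ (n ∸ t)) + (FiniteField.size 𝔽) ^ (n ∸ t) * ((FiniteField.size 𝔽) ^ t ∸ 1))
      × (length ℱ ≡ ((FiniteField.size 𝔽) ^ (ℓ * (n ∸ t)) ∸ prodTerm (FiniteField.size 𝔽) ℓ (n ∸ t)) + (FiniteField.size 𝔽) ^ (n ∸ t) * ((FiniteField.size 𝔽) ^ t ∸ 1)
         ⇔ Σ (Subspace {𝔽} (n + ℓ)) (λ X → Σ (Subspace {𝔽} (n + ℓ)) (λ M →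
              HasType W X t 0 × HasType W M (n + 1) 1 × X ⊆S M
              × FamilyIs ℱ (λ F → HasType W F n 0
                                 × ((X ⊆S F × DimGE (F ∩ M) (t + 1)) ⊎ F ⊆S M))))))
    ×
    -- (ii) n/2 - 1/2 ≤ t ≤ n - 2
    (n ≤ 2 * t + 1 →
      (length ℱ ≤ (FiniteField.size 𝔽) ^ (ℓ * (n ∸ t ∸ 1)) * θ (FiniteField.size 𝔽) (t + 2) ∸ (FiniteField.size 𝔽) ^ (ℓ * (n ∸ t ∸ 2) + 1) * θ (FiniteField.size 𝔽) (t + 1))
      × (length ℱ ≡ (FiniteField.size 𝔽) ^ (ℓ * (n ∸ t ∸ 1)) * θ (FiniteField.size 𝔽) (t + 2) ∸ (FiniteField.size 𝔽) ^ (ℓ * (n ∸ t ∸ 2) + 1) * θ (FiniteField.size 𝔽) (t + 1)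
         ⇔ Σ (Subspace {𝔽} (n + ℓ)) (λ Z →
              HasType W Z (t + 2) 0
              × FamilyIs ℱ (λ F → HasType W F n 0 × DimGE (F ∩ Z) (t + 1)))))
theorem1p2 𝔽 n ℓ t 1≤t t+2≤n n+t+2≤ℓ ≢₂ ≢₃ W W-dim ℱ distinct types t-intersecting non-trivial =
  -- With n = t + 2 + e, the condition 2t + 2 ≤ n is t ≤ e, and n ≤ 2t + 1 is d ≤ t + 1 for d = e +
  -- 2.
  (λ 2t+2≤n → proj₁ result (+-cancelˡ-≤ t t e (+-cancelʳ-≤ 2 (t + t) (t + e)
    (subst₂ _≤_ (double t 2) (trans (sym n≡) (shift t e)) 2t+2≤n)))) ,
  (λ n≤2t+1 → proj₂ result (+-cancelˡ-≤ t _ _ (subst₂ _≤_ (sym n≡) (trans (double t 1) (+-assoc-suc t)) n≤2t+1)))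
  where
  open Vectors 𝔽 using (q; 1<q; module Decidable)
  open Decidable (n + ℓ) using (DS; fromDim; dim⇒card)
  e : ℕ
  e = n ∸ (t + 2)
  n≡ : t + suc (suc e) ≡ n
  n≡ = trans (sym (+-assoc t 2 e)) (m+[n∸m]≡n t+2≤n)
  double : ∀ t k → 2 * t + k ≡ t + t + k
  double = solve-∀
  shift : ∀ t e → t + suc (suc e) ≡ t + e + 2
  shift = solve-∀
  +-assoc-suc : ∀ t → t + t + 1 ≡ t + suc t
  +-assoc-suc = solve-∀
  n+t+k : ∀ k → n + t + k ≡ (2 + k) + (e + (t + t))
  n+t+k k = trans (cong (λ m → m + t + k) (sym n≡)) (rearrange t e k)
    where
    rearrange : ∀ t e k → t + suc (suc e) + t + k ≡ (2 + k) + (e + (t + t))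
    rearrange = solve-∀
  -- If q is not at least 3 it is 2, and then each excluded value of `ℓ` raises the lower bound n +
  -- t + 2 by one, up to n + t + 4 = 6 + e + 2t.
  large : (3 ≤ q × 4 + (e + (t + t)) ≤ ℓ) ⊎ 6 + (e + (t + t)) ≤ ℓ
  large with 3 ≤? q
  ... | yes 3≤q = inj₁ (3≤q , subst (_≤ ℓ) (n+t+k 2) n+t+2≤ℓ)
  ... | no 3≰q = inj₂ (subst (_≤ ℓ) (n+t+k 4) (next 3 ≢₃ (next 2 ≢₂ n+t+2≤ℓ)))
    where
    next : ∀ k → ¬ (ℓ ≡ n + t + k × q ≡ 2) → n + t + k ≤ ℓ → n + t + suc k ≤ ℓ
    next k ≢ le = subst (_≤ ℓ) (sym (+-suc (n + t) k)) (≤∧≢⇒< le λ eq → ≢ (sym eq , ≤-antisym (≤-pred (≰⇒> 3≰q)) 1<q))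
  Wᵈ : DS
  Wᵈ = fromDim W W-dim
  open Main 𝔽 n ℓ t e n≡ 1≤t large Wᵈ (dim⇒card Wᵈ W-dim)
  result = conclusion (members ℱ types) distinct t-intersecting non-trivial
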